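{- For every integer $n\geq 2$, $$\frac{2^{n^2-n-1}}{n!\,(2^n-n)}\leq B_n<\frac{4}{n!}\,2^{n^2-n}.$$ For $n=1$, one has $B_1=1$.
   Context: For a positive integer $n$, a collection $\Phi\subseteq 2^{[n]}$ is balanced if there exist positive real weights $(\lambda_S)_{S\in\Phi}$ such that $\sum_{S\in\Phi}\lambda_S\mathbf{1}_S=\mathbf{1}$, where $\mathbf{1}_S\in\{0,1\}^n$ is the characteristic vector of $S$ and $\mathbf{1}=(1,\dots,1)^{\mathsf T}\in\mathbb{R}^n$. A balanced collection is minimal if none of its proper subcollections is balanced. $B_n$ denotes the number of minimal balanced collections on $[n]$. -}

module Defs where

open import Algebra.Bundles using (CommutativeMonoid)
import Algebra.Properties.CommutativeSemigroup as CommutativeSemigroupProperties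
open import Data.Bool using (Bool; T; if_then_else_)
open import Data.Fin using (Fin)
import Data.Fin.Properties as Fin
open import Data.Fin.Subset using (Subset; inside; outside)
open import Data.Fin.Subset.Properties using (_∈?_)
open import Data.List using (List; []; _∷_; _++_; map; foldr; filterᵇ)
open import Data.Nat as ℕ using (ℕ; zero; suc; _!)
import Data.Nat.Properties as ℕ
open import Data.Product using (Σ; ∃; _×_; _,_; proj₁)
open import Data.Rational as ℚ using (ℚ; 0ℚ; 1ℚ; ½; ∣_∣; Positive; positive)
import Data.Rational.Properties as ℚ
open import Data.Vec using ([]; _∷_)
open import Function.Bundles using (Inverse)
open import Level using (0ℓ)
open import Relation.Binary.Bundles using (Setoid)
import Relation.Binary.Construct.On as On
open import Relation.Binary.PropositionalEquality
  using (_≡_; sym; trans; cong; cong₂; subst; _→-setoid_; module ≡-Reasoning)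
open import Relation.Nullary using (¬_; does)

-- The library has no real numbers: they are Cauchy sequences of rationals.
IsCauchy : (ℕ → ℚ) → Set
IsCauchy x = ∀ ε → 0ℚ ℚ.< ε →
  ∃ λ N → ∀ m n → N ℕ.≤ m → N ℕ.≤ n → ∣ x m ℚ.- x n ∣ ℚ.< ε

record ℝ : Set where
  constructor mkℝ
  field
    seq    : ℕ → ℚ
    cauchy : IsCauchy seq

open ℝ public

infix  4 _≃_ _<ℝ_
infixl 6 _+ℝ_
infixl 7 _*ℝ_

-- Real numbers are compared with _≃_; propositional equality on ℝ is
-- finer than equality of limits.
_≃_ : ℝ → ℝ → Set
x ≃ y = ∀ ε → 0ℚ ℚ.< ε →
  ∃ λ N → ∀ n → N ℕ.≤ n → ∣ seq x n ℚ.- seq y n ∣ ℚ.< ε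

_<ℝ_ : ℝ → ℝ → Set
x <ℝ y = ∃ λ ε → 0ℚ ℚ.< ε ×
  (∃ λ N → ∀ n → N ℕ.≤ n → seq x n ℚ.+ ε ℚ.≤ seq y n)

private
  half-pos : ∀ {ε} → 0ℚ ℚ.< ε → 0ℚ ℚ.< ½ ℚ.* ε
  half-pos {ε} 0<ε = subst (ℚ._< ½ ℚ.* ε) (ℚ.*-zeroʳ ½) (ℚ.*-monoʳ-<-pos ½ 0<ε)

  half+half : ∀ ε → ½ ℚ.* ε ℚ.+ ½ ℚ.* ε ≡ ε
  half+half ε = trans (sym (ℚ.*-distribʳ-+ ε ½ ½)) (ℚ.*-identityˡ ε)

  const-cauchy : ∀ q → IsCauchy (λ _ → q)
  const-cauchy q ε 0<ε =
    0 , λ _ _ _ _ → subst (ℚ._< ε) (sym (cong ∣_∣ (ℚ.+-inverseʳ q))) 0<ε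

  +-rearrange : ∀ a b c d →
    (a ℚ.+ b) ℚ.- (c ℚ.+ d) ≡ (a ℚ.- c) ℚ.+ (b ℚ.- d)
  +-rearrange a b c d = trans
    (cong ((a ℚ.+ b) ℚ.+_) (ℚ.neg-distrib-+ c d))
    (interchange a b (ℚ.- c) (ℚ.- d))
    where open CommutativeSemigroupProperties
                 (CommutativeMonoid.commutativeSemigroup ℚ.+-0-commutativeMonoid)

  cancel-middle : ∀ a b c → (a ℚ.- b) ℚ.+ (b ℚ.+ c) ≡ a ℚ.+ c
  cancel-middle a b c = begin
    (a ℚ.- b) ℚ.+ (b ℚ.+ c)       ≡⟨ ℚ.+-assoc a (ℚ.- b) (b ℚ.+ c) ⟩
    a ℚ.+ (ℚ.- b ℚ.+ (b ℚ.+ c))   ≡⟨ cong (a ℚ.+_) (ℚ.+-assoc (ℚ.- b) b c) ⟨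
    a ℚ.+ ((ℚ.- b ℚ.+ b) ℚ.+ c)   ≡⟨ cong (λ t → a ℚ.+ (t ℚ.+ c)) (ℚ.+-inverseˡ b) ⟩
    a ℚ.+ (0ℚ ℚ.+ c)              ≡⟨ cong (a ℚ.+_) (ℚ.+-identityˡ c) ⟩
    a ℚ.+ c                       ∎
    where open ≡-Reasoning

  *-distribˡ-- : ∀ a b c → a ℚ.* (b ℚ.- c) ≡ a ℚ.* b ℚ.- a ℚ.* c
  *-distribˡ-- a b c = trans (ℚ.*-distribˡ-+ a b (ℚ.- c))
    (cong (a ℚ.* b ℚ.+_) (sym (ℚ.neg-distribʳ-* a c)))

  *-rearrange : ∀ a b c d →
    a ℚ.* b ℚ.- c ℚ.* d ≡ a ℚ.* (b ℚ.- d) ℚ.+ d ℚ.* (a ℚ.- c)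
  *-rearrange a b c d = sym (begin
    a ℚ.* (b ℚ.- d) ℚ.+ d ℚ.* (a ℚ.- c)
      ≡⟨ cong₂ ℚ._+_ (*-distribˡ-- a b d) (*-distribˡ-- d a c) ⟩
    (a ℚ.* b ℚ.- a ℚ.* d) ℚ.+ (d ℚ.* a ℚ.- d ℚ.* c)
      ≡⟨ cong₂ (λ s t → (a ℚ.* b ℚ.- a ℚ.* d) ℚ.+ (s ℚ.- t)) (ℚ.*-comm d a) (ℚ.*-comm d c) ⟩
    (a ℚ.* b ℚ.- a ℚ.* d) ℚ.+ (a ℚ.* d ℚ.- c ℚ.* d)
      ≡⟨ cancel-middle (a ℚ.* b) (a ℚ.* d) (ℚ.- (c ℚ.* d)) ⟩
    a ℚ.* b ℚ.- c ℚ.* d ∎)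
    where open ≡-Reasoning

  +-cauchy : ∀ {x y} → IsCauchy x → IsCauchy y → IsCauchy (λ n → x n ℚ.+ y n)
  +-cauchy {x} {y} cx cy ε 0<ε
    with M , p ← cx (½ ℚ.* ε) (half-pos 0<ε)
    with N , q ← cy (½ ℚ.* ε) (half-pos 0<ε)
    = M ℕ.⊔ N , λ m n m≥ n≥ → begin-strict
      ∣ (x m ℚ.+ y m) ℚ.- (x n ℚ.+ y n) ∣    ≡⟨ cong ∣_∣ (+-rearrange (x m) (y m) (x n) (y n)) ⟩
      ∣ (x m ℚ.- x n) ℚ.+ (y m ℚ.- y n) ∣    ≤⟨ ℚ.∣p+q∣≤∣p∣+∣q∣ (x m ℚ.- x n) (y m ℚ.- y n) ⟩
      ∣ x m ℚ.- x n ∣ ℚ.+ ∣ y m ℚ.- y n ∣    <⟨ ℚ.+-mono-<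
                                               (p m n (ℕ.m⊔n≤o⇒m≤o M N m≥) (ℕ.m⊔n≤o⇒m≤o M N n≥))
                                               (q m n (ℕ.m⊔n≤o⇒n≤o M N m≥) (ℕ.m⊔n≤o⇒n≤o M N n≥)) ⟩
      ½ ℚ.* ε ℚ.+ ½ ℚ.* ε                    ≡⟨ half+half ε ⟩
      ε                                      ∎
    where open ℚ.≤-Reasoning

  eventually-bounded : ∀ {x} → IsCauchy x →
    ∃ λ K → Positive K × (∃ λ N → ∀ n → N ℕ.≤ n → ∣ x n ∣ ℚ.≤ K)
  eventually-bounded {x} cx
    with N , p ← cx 1ℚ (ℚ.positive⁻¹ 1ℚ)
    = 1ℚ ℚ.+ ∣ x N ∣
    , ℚ.pos+nonNeg⇒pos 1ℚ ∣ x N ∣ {{ℚ.nonNegative (ℚ.0≤∣p∣ (x N))}}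
    , N
    , λ n n≥ → begin
      ∣ x n ∣                              ≡⟨ cong ∣_∣ (split (x n) (x N)) ⟩
      ∣ (x n ℚ.- x N) ℚ.+ x N ∣            ≤⟨ ℚ.∣p+q∣≤∣p∣+∣q∣ (x n ℚ.- x N) (x N) ⟩
      ∣ x n ℚ.- x N ∣ ℚ.+ ∣ x N ∣          ≤⟨ ℚ.+-monoˡ-≤ ∣ x N ∣ (ℚ.<⇒≤ (p n N n≥ ℕ.≤-refl)) ⟩
      1ℚ ℚ.+ ∣ x N ∣                       ∎
    where
    open ℚ.≤-Reasoning
    split : ∀ a b → a ≡ (a ℚ.- b) ℚ.+ b
    split a b = sym (trans (ℚ.+-assoc a (ℚ.- b) b)
      (trans (cong (a ℚ.+_) (ℚ.+-inverseˡ b)) (ℚ.+-identityʳ a)))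

  divide : ∀ K → Positive K → ∀ {ε} → 0ℚ ℚ.< ε →
    ∃ λ δ → 0ℚ ℚ.< δ × K ℚ.* δ ≡ ε
  divide K K>0 {ε} 0<ε = K⁻¹ ℚ.* ε , pos , eq
    where
    instance
      _ = K>0
      _ = ℚ.pos⇒nonZero K
      _ = positive 0<ε
    K⁻¹ = ℚ.1/ K
    instance _ = ℚ.1/pos⇒pos K
    pos : 0ℚ ℚ.< K⁻¹ ℚ.* ε
    pos = ℚ.positive⁻¹ (K⁻¹ ℚ.* ε) {{ℚ.pos*pos⇒pos K⁻¹ ε}}
    eq : K ℚ.* (K⁻¹ ℚ.* ε) ≡ ε
    eq = trans (sym (ℚ.*-assoc K K⁻¹ ε))
        (trans (cong (ℚ._* ε) (ℚ.*-inverseʳ K)) (ℚ.*-identityˡ ε))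

  ∣*∣-bound : ∀ {K δ} a b → Positive K → ∣ a ∣ ℚ.≤ K → ∣ b ∣ ℚ.< δ →
    ∣ a ℚ.* b ∣ ℚ.< K ℚ.* δ
  ∣*∣-bound {K} {δ} a b K>0 a≤K b<δ = begin-strict
    ∣ a ℚ.* b ∣        ≡⟨ ℚ.∣p*q∣≡∣p∣*∣q∣ a b ⟩
    ∣ a ∣ ℚ.* ∣ b ∣    ≤⟨ ℚ.*-monoʳ-≤-nonNeg ∣ b ∣ {{ℚ.nonNegative (ℚ.0≤∣p∣ b)}} a≤K ⟩
    K ℚ.* ∣ b ∣        <⟨ ℚ.*-monoʳ-<-pos K {{K>0}} b<δ ⟩
    K ℚ.* δ            ∎
    where open ℚ.≤-Reasoning

  product-bound : ∀ {K L δ η ε} a b c d → Positive K → Positive L →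
    K ℚ.* δ ≡ ½ ℚ.* ε → L ℚ.* η ≡ ½ ℚ.* ε →
    ∣ a ∣ ℚ.≤ K → ∣ d ∣ ℚ.≤ L → ∣ b ℚ.- d ∣ ℚ.< δ → ∣ a ℚ.- c ∣ ℚ.< η →
    ∣ a ℚ.* b ℚ.- c ℚ.* d ∣ ℚ.< ε
  product-bound {K} {L} {δ} {η} {ε} a b c d K>0 L>0 Kδ≡ Lη≡ a≤K d≤L b-d<δ a-c<η =
    begin-strict
    ∣ a ℚ.* b ℚ.- c ℚ.* d ∣
      ≡⟨ cong ∣_∣ (*-rearrange a b c d) ⟩
    ∣ a ℚ.* (b ℚ.- d) ℚ.+ d ℚ.* (a ℚ.- c) ∣
      ≤⟨ ℚ.∣p+q∣≤∣p∣+∣q∣ (a ℚ.* (b ℚ.- d)) (d ℚ.* (a ℚ.- c)) ⟩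
    ∣ a ℚ.* (b ℚ.- d) ∣ ℚ.+ ∣ d ℚ.* (a ℚ.- c) ∣
      <⟨ ℚ.+-mono-< (∣*∣-bound a (b ℚ.- d) K>0 a≤K b-d<δ)
                    (∣*∣-bound d (a ℚ.- c) L>0 d≤L a-c<η) ⟩
    K ℚ.* δ ℚ.+ L ℚ.* η
      ≡⟨ cong₂ ℚ._+_ Kδ≡ Lη≡ ⟩
    ½ ℚ.* ε ℚ.+ ½ ℚ.* ε
      ≡⟨ half+half ε ⟩
    ε ∎
    where open ℚ.≤-Reasoning

  *-cauchy : ∀ {x y} → IsCauchy x → IsCauchy y → IsCauchy (λ n → x n ℚ.* y n)
  *-cauchy {x} {y} cx cy ε 0<ε =
    let K , K>0 , A , x≤K = eventually-bounded cx
        L , L>0 , B , y≤L = eventually-bounded cy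
        δ , 0<δ , Kδ≡     = divide K K>0 (half-pos 0<ε)
        η , 0<η , Lη≡     = divide L L>0 (half-pos 0<ε)
        M , p             = cx η 0<η
        N , q             = cy δ 0<δ
    in (A ℕ.⊔ B) ℕ.⊔ (M ℕ.⊔ N) , λ m n m≥ n≥ →
      let m≥AB = ℕ.m⊔n≤o⇒m≤o (A ℕ.⊔ B) (M ℕ.⊔ N) m≥
          n≥AB = ℕ.m⊔n≤o⇒m≤o (A ℕ.⊔ B) (M ℕ.⊔ N) n≥
          m≥MN = ℕ.m⊔n≤o⇒n≤o (A ℕ.⊔ B) (M ℕ.⊔ N) m≥
          n≥MN = ℕ.m⊔n≤o⇒n≤o (A ℕ.⊔ B) (M ℕ.⊔ N) n≥
      in product-bound (x m) (y m) (x n) (y n) K>0 L>0 Kδ≡ Lη≡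
           (x≤K m (ℕ.m⊔n≤o⇒m≤o A B m≥AB))
           (y≤L n (ℕ.m⊔n≤o⇒n≤o A B n≥AB))
           (q m n (ℕ.m⊔n≤o⇒n≤o M N m≥MN) (ℕ.m⊔n≤o⇒n≤o M N n≥MN))
           (p m n (ℕ.m⊔n≤o⇒m≤o M N m≥MN) (ℕ.m⊔n≤o⇒m≤o M N n≥MN))

fromℚ : ℚ → ℝ
fromℚ q = mkℝ (λ _ → q) (const-cauchy q)

0ℝ 1ℝ : ℝ
0ℝ = fromℚ 0ℚ
1ℝ = fromℚ 1ℚ

_+ℝ_ _*ℝ_ : ℝ → ℝ → ℝ
x +ℝ y = mkℝ (λ n → seq x n ℚ.+ seq y n) (+-cauchy {seq x} {seq y} (cauchy x) (cauchy y))
x *ℝ y = mkℝ (λ n → seq x n ℚ.* seq y n) (*-cauchy {seq x} {seq y} (cauchy x) (cauchy y))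

-- A collection Φ ⊆ 2^[n] is given by its characteristic function, and
-- collections are identified when these agree pointwise.
Collection : ℕ → Set
Collection n = Subset n → Bool

infix 4 _∈ᶜ_ _∉ᶜ_ _⊆ᶜ_ _⊂ᶜ_

_∈ᶜ_ _∉ᶜ_ : ∀ {n} → Subset n → Collection n → Set
S ∈ᶜ Φ = T (Φ S)
S ∉ᶜ Φ = ¬ (S ∈ᶜ Φ)

_⊆ᶜ_ _⊂ᶜ_ : ∀ {n} → Collection n → Collection n → Set
Ψ ⊆ᶜ Φ = ∀ S → S ∈ᶜ Ψ → S ∈ᶜ Φ
Ψ ⊂ᶜ Φ = Ψ ⊆ᶜ Φ × ∃ λ S → S ∈ᶜ Φ × S ∉ᶜ Ψ

-- Every subset of [n], each listed exactly once.
subsets : ∀ n → List (Subset n)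
subsets zero    = [] ∷ []
subsets (suc n) = map (outside ∷_) (subsets n) ++ map (inside ∷_) (subsets n)

∑[_] : ∀ {n} → Collection n → (Subset n → ℝ) → ℝ
∑[_] {n} Φ f = foldr _+ℝ_ 0ℝ (map f (filterᵇ Φ (subsets n)))

𝟏[_] : ∀ {n} → Subset n → Fin n → ℝ
𝟏[ S ] i = if does (i ∈? S) then 1ℝ else 0ℝ

-- The values of w outside Φ are irrelevant.
Balanced : ∀ {n} → Collection n → Set
Balanced {n} Φ = ∃ λ (w : Subset n → ℝ) →
  (∀ S → S ∈ᶜ Φ → 0ℝ <ℝ w S) ×
  (∀ i → ∑[ Φ ] (λ S → w S *ℝ 𝟏[ S ] i) ≃ 1ℝ)

MinimalBalanced : ∀ {n} → Collection n → Set
MinimalBalanced Φ = Balanced Φ × (∀ Ψ → Ψ ⊂ᶜ Φ → ¬ Balanced Ψ)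

-- Equality ignores the balancedness and minimality witnesses.
minimalBalancedSetoid : ℕ → Setoid 0ℓ 0ℓ
minimalBalancedSetoid n =
  On.setoid {B = Σ (Collection n) MinimalBalanced} (Subset n →-setoid Bool) proj₁

NumberOfMinimalBalanced : ℕ → ℕ → Set
NumberOfMinimalBalanced n b = Inverse (Fin.≡-setoid b) (minimalBalancedSetoid n)

private
  1≤2^n : ∀ n → 1 ℕ.≤ 2 ℕ.^ n
  1≤2^n n = ℕ.m^n>0 2 n

  n<2^n : ∀ n → n ℕ.< 2 ℕ.^ n
  n<2^n zero    = ℕ.≤-refl
  n<2^n (suc n) = subst (suc (suc n) ℕ.≤_)
    (cong (2 ℕ.^ n ℕ.+_) (sym (ℕ.+-identityʳ (2 ℕ.^ n))))
    (ℕ.+-mono-≤ (1≤2^n n) (n<2^n n))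

n!*[2^n∸n]≢0 : ∀ n → ℕ.NonZero (n ! ℕ.* (2 ℕ.^ n ℕ.∸ n))
n!*[2^n∸n]≢0 n = ℕ.m*n≢0 (n !) (2 ℕ.^ n ℕ.∸ n)
  {{n ℕ.!≢0}} {{ℕ.>-nonZero (ℕ.m<n⇒0<n∸m (n<2^n n))}}

-- On [m+1], complementing sets that contain 0 turns weights on subsets of [m+1]
-- with equal loads into integer relations among the 0/1-vectors of ℤᵐ. Minimal
-- balanced collections correspond to the sign-oriented minimal relations, together
-- with the pairs {S, ∁ S}. The weights of a minimal collection span all relations on
-- it, so it has at most m+1 members and, given its classes {S, ∁ S}, only two
-- orientations are possible; counting sets of at most m+1 classes gives the upper
-- bound. For the lower bound, m vectors independent over 𝔽₂ together with their sum
-- mod 2 satisfy an integer relation all of whose coefficients are odd, hence nonzero;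
-- it orients to two minimal collections.
-- Real weights are replaced by integer ones through Stiemke's theorem: if no positive
-- integer weights exist, an integer certificate contradicts the real ones.
module Submission where

-- Order and equality of reals are undecidable, so the count cannot be defined by cases on
-- `Balanced`. Stiemke's alternative does double duty: being computed from the collection alone, it
-- also decides minimality and so makes `B` a function. Weights are kept homogeneous, with a common
-- positive load in place of load 1, so that scaling and subtraction stay among integers. The
-- constant 4 is 2 orientations times 2: the binomials of N = 2^m with lower index 1 to m+1 sum to
-- less than 2 N^(m+1) / (m+1)!, by 2(m+1) ≤ N when m ≥ 3 and by computation when m is 1 or 2. In
-- the other direction, at least a quarter of all m-tuples over 𝔽₂ are independent, each is taken
-- with two signs, and one collection accounts for at most (m+1)! pairs of tuple and sign. This
-- leaves the comparison 2^m ≤ 2^n - n for n = m+1. A lone vector equals its own parity sum, so this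
-- construction starts at m = 2, and for n = 2 the bound follows from B ≥ 1.

open import Defs

-- Finite counting: pigeonhole, combinations, arrangements

module Counting where

  open import Defs using (subsets)
  open import Data.Bool using (Bool; true; false)
  open import Data.Fin using (Fin; zero; suc)
  import Data.Fin.Properties as Fin
  open import Data.Fin.Subset using (Subset; inside; outside)
  open import Data.List
  open import Data.List.Properties using (length-map; length-++)
  open import Data.List.Membership.Propositional using (_∈_)
  open import Data.List.Membership.Propositional.Properties
  open import Data.List.Relation.Unary.All as All using (All; []; _∷_)
  import Data.List.Relation.Unary.All.Properties as All
  open import Data.List.Relation.Unary.AllPairs using (AllPairs; []; _∷_)
  open import Data.List.Relation.Unary.Any as Any using (here; there)
  open import Data.List.Relation.Unary.Unique.Propositional using (Unique)
  import Data.List.Relation.Unary.Unique.Propositional.Properties as Unique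
  import Data.List.Membership.Setoid.Properties as SetoidMembership
  open import Data.Nat using (ℕ; zero; suc; _+_; _*_; _≤_; _^_; _!; z≤n)
  open import Data.Nat.Combinatorics using (_C_; nCk+nC[k+1]≡[n+1]C[k+1])
  open import Data.Nat.Properties
  open import Data.Product using (∃; _×_; _,_; proj₁; proj₂; map₂)
  open import Data.Vec as Vec using ([]; _∷_)
  open import Relation.Binary.Definitions using (Symmetric)
  open import Relation.Binary.PropositionalEquality
  open import Relation.Nullary using (¬_; yes; no; contradiction)

  module _ {A : Set} where

    -- The relation is arbitrary because lists of collections are free of repetitions only up to
    -- pointwise equality.
    lookup-injective : ∀ {_≈_ : A → A → Set} → Symmetric _≈_ →
      ∀ {xs : List A} → AllPairs (λ x y → ¬ x ≈ y) xs →
      ∀ {i j} → lookup xs i ≈ lookup xs j → i ≡ j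
    lookup-injective ≈-sym (_ ∷ _)  {zero}  {zero}  _  = refl
    lookup-injective ≈-sym (p ∷ _)  {zero}  {suc j} eq = contradiction eq (All.lookup p (∈-lookup j))
    lookup-injective ≈-sym (p ∷ _)  {suc i} {zero}  eq = contradiction (≈-sym eq) (All.lookup p (∈-lookup i))
    lookup-injective ≈-sym (_ ∷ ps) {suc i} {suc j} eq = cong suc (lookup-injective ≈-sym ps eq)

    -- Positions of `xs` go injectively to positions of `ys`. Both bounds on the number of minimal
    -- collections end in this pigeonhole.
    unique-⊆⇒length≤ : ∀ {xs ys : List A} → Unique xs → (∀ {x} → x ∈ xs → x ∈ ys) →
      length xs ≤ length ys
    unique-⊆⇒length≤ {xs} {ys} xs! xs⊆ys =
      Fin.injective⇒≤ {f = λ i → Any.index (xs⊆ys (∈-lookup i))} λ {i} {j} eq →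
        lookup-injective sym xs! (SetoidMembership.index-injective (setoid A)
          (xs⊆ys (∈-lookup i)) (xs⊆ys (∈-lookup j)) eq)

  module _ {A B : Set} (f : A → List B) where

    length-concatMap-≤ : ∀ {c xs} → All (λ x → length (f x) ≤ c) xs →
      length (concatMap f xs) ≤ length xs * c
    length-concatMap-≤ []                = z≤n
    length-concatMap-≤ {xs = x ∷ xs} (p ∷ ps)
      rewrite length-++ (f x) {concatMap f xs} = +-mono-≤ p (length-concatMap-≤ ps)

    length-concatMap-≥ : ∀ {c xs} → All (λ x → c ≤ length (f x)) xs →
      length xs * c ≤ length (concatMap f xs)
    length-concatMap-≥ []                = z≤n
    length-concatMap-≥ {xs = x ∷ xs} (p ∷ ps)
      rewrite length-++ (f x) {concatMap f xs} = +-mono-≤ p (length-concatMap-≥ ps)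

  length-cartesianProduct : ∀ {A B : Set} (xs : List A) (ys : List B) →
    length (cartesianProduct xs ys) ≡ length xs * length ys
  length-cartesianProduct []       ys = refl
  length-cartesianProduct (x ∷ xs) ys = trans (length-++ (map (x ,_) ys))
    (cong₂ _+_ (length-map (x ,_) ys) (length-cartesianProduct xs ys))

  ∈-subsets : ∀ {n} (S : Subset n) → S ∈ subsets n
  ∈-subsets []            = here refl
  ∈-subsets (outside ∷ S) = ∈-++⁺ˡ (∈-map⁺ (outside ∷_) (∈-subsets S))
  ∈-subsets {suc n} (inside  ∷ S) =
    ∈-++⁺ʳ (map (outside ∷_) (subsets n)) (∈-map⁺ (inside ∷_) (∈-subsets S))

  ∷-injectiveʳ : ∀ {n b} {S S′ : Subset n} → (b ∷ S) ≡ (b ∷ S′) → S ≡ S′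
  ∷-injectiveʳ refl = refl

  subsets-unique : ∀ n → Unique (subsets n)
  subsets-unique zero    = [] ∷ []
  subsets-unique (suc n) = Unique.++⁺
    (Unique.map⁺ ∷-injectiveʳ (subsets-unique n))
    (Unique.map⁺ ∷-injectiveʳ (subsets-unique n))
    λ (p , q) → disjoint (∈-map⁻ _ p) (∈-map⁻ _ q)
    where
    disjoint : ∀ {v} → ∃ (λ S → S ∈ subsets n × v ≡ outside ∷ S) →
      ¬ ∃ (λ S → S ∈ subsets n × v ≡ inside ∷ S)
    disjoint (_ , _ , refl) (_ , _ , ())

  length-subsets : ∀ n → length (subsets n) ≡ 2 ^ n
  length-subsets zero    = refl
  length-subsets (suc n) =
    trans (length-++ (map (outside ∷_) (subsets n)))
          (cong₂ _+_ (trans (length-map _ (subsets n)) (length-subsets n))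
                     (trans (length-map _ (subsets n))
                            (trans (length-subsets n) (sym (+-identityʳ (2 ^ n))))))

  module _ {A : Set} where

    combinations : ℕ → List A → List (List A)
    combinations zero    _        = [] ∷ []
    combinations (suc k) []       = []
    combinations (suc k) (x ∷ xs) =
      map (x ∷_) (combinations k xs) ++ combinations (suc k) xs

    length-combinations : ∀ k xs → length (combinations k xs) ≡ length xs C k
    length-combinations zero    []       = refl
    length-combinations zero    (x ∷ xs) = refl
    length-combinations (suc k) []       = refl
    length-combinations (suc k) (x ∷ xs) =
      trans (length-++ (map (x ∷_) (combinations k xs)))
      (trans (cong₂ _+_ (trans (length-map (x ∷_) (combinations k xs)) (length-combinations k xs))
                        (length-combinations (suc k) xs))
             (nCk+nC[k+1]≡[n+1]C[k+1] (length xs) k))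

    filterᵇ∈combinations : ∀ (p : A → Bool) xs →
      filterᵇ p xs ∈ combinations (length (filterᵇ p xs)) xs
    filterᵇ∈combinations p [] = here refl
    filterᵇ∈combinations p (x ∷ xs) with p x
    ... | true  = ∈-++⁺ˡ (∈-map⁺ (x ∷_) (filterᵇ∈combinations p xs))
    ... | false with filterᵇ p xs | filterᵇ∈combinations p xs
    ...   | []     | _  = here refl
    ...   | y ∷ ys | ih = ∈-++⁺ʳ (map (x ∷_) (combinations (length ys) xs)) ih

    -- omits the empty combination
    combinationsUpTo : ℕ → List A → List (List A)
    combinationsUpTo zero    xs = []
    combinationsUpTo (suc k) xs = combinations (suc k) xs ++ combinationsUpTo k xs

    ∈-combinationsUpTo : ∀ {j k xs ys} → suc j ≤ k → ys ∈ combinations (suc j) xs →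
      ys ∈ combinationsUpTo k xs
    ∈-combinationsUpTo {j} {suc k} {xs} j<k ys∈ with j ≟ k
    ... | yes refl = ∈-++⁺ˡ ys∈
    ... | no  j≢k  = ∈-++⁺ʳ (combinations (suc k) xs)
                       (∈-combinationsUpTo (≤∧≢⇒< (≤-pred j<k) j≢k) ys∈)

    picks : List A → List (A × List A)
    picks []       = []
    picks (x ∷ xs) = (x , xs) ∷ map (map₂ (x ∷_)) (picks xs)

    length-picks : ∀ xs → length (picks xs) ≡ length xs
    length-picks []       = refl
    length-picks (x ∷ xs) = cong suc (trans (length-map _ (picks xs)) (length-picks xs))

    picks-rest : ∀ xs → All (λ p → suc (length (proj₂ p)) ≡ length xs) (picks xs)
    picks-rest []       = []
    picks-rest (x ∷ xs) = refl ∷ All.map⁺ (All.map (cong suc) (picks-rest xs))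

    ∈-picks : ∀ {x xs} → x ∈ xs →
      ∃ λ rest → (x , rest) ∈ picks xs × (∀ {y} → y ∈ xs → x ≢ y → y ∈ rest)
    ∈-picks {x} {.x ∷ xs} (here refl) = xs , here refl , λ
      { (here refl) x≢x → contradiction refl x≢x
      ; (there y∈)  _   → y∈ }
    ∈-picks {x} {z ∷ xs} (there x∈) with rest , p , q ← ∈-picks x∈ =
      z ∷ rest , there (∈-map⁺ (map₂ (z ∷_)) p) , λ
      { (here refl) _   → here refl
      ; (there y∈)  x≢y → there (q y∈ x≢y) }

    arrangements : ℕ → List A → List (List A)
    arrangements zero    xs = [] ∷ []
    arrangements (suc k) xs =
      concatMap (λ p → map (proj₁ p ∷_) (arrangements k (proj₂ p))) (picks xs)

    -- Choosing k of k+1 entries in order can be done in (k+1)k⋯2 ways, and the missing factor 1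
    -- makes this the full factorial.
    length-arrangements : ∀ k xs → length xs ≤ suc k → length (arrangements k xs) ≤ suc k !
    length-arrangements zero    xs _  = ≤-refl
    length-arrangements (suc k) xs le = begin
      length (arrangements (suc k) xs)  ≤⟨ length-concatMap-≤ _ (All.map bound (picks-rest xs)) ⟩
      length (picks xs) * suc k !       ≡⟨ cong (_* suc k !) (length-picks xs) ⟩
      length xs * suc k !               ≤⟨ *-monoˡ-≤ (suc k !) le ⟩
      suc (suc k) !                     ∎
      where
      open ≤-Reasoning
      bound : ∀ {p} → suc (length (proj₂ p)) ≡ length xs →
        length (map (proj₁ p ∷_) (arrangements k (proj₂ p))) ≤ suc k !
      bound {x , rest} eq = subst (_≤ suc k !) (sym (length-map (x ∷_) (arrangements k rest)))
        (length-arrangements k rest (≤-pred (subst (_≤ suc (suc k)) (sym eq) le)))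

    ∈-arrangements : ∀ {xs ys} → Unique ys → (∀ {y} → y ∈ ys → y ∈ xs) →
      ys ∈ arrangements (length ys) xs
    ∈-arrangements {ys = []}     _          _     = here refl
    ∈-arrangements {xs} {y ∷ ys} (y≢ ∷ ys!) ys⊆xs
      with rest , p , q ← ∈-picks (ys⊆xs (here refl)) =
      ∈-concatMap⁺ (λ p → map (proj₁ p ∷_) (arrangements (length ys) (proj₂ p)))
        (Any.map (λ { refl → ∈-map⁺ (y ∷_) (∈-arrangements ys!
          λ z∈ → q (ys⊆xs (there z∈)) (All.lookup y≢ z∈)) }) p)

-- Numerical estimates behind the two bounds

module Arithmetic where

  open import Defs using (subsets)
  open Counting
  open import Data.List using (List; length)
  open import Data.List.Properties using (length-++)
  open import Data.Nat using (ℕ; zero; suc; _+_; _*_; _∸_; _≤_; _<_; _^_; _!; z≤n; s≤s; _<?_)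
  open import Data.Nat.Combinatorics using (_C_; nCk+nC[k+1]≡[n+1]C[k+1])
  open import Data.Nat.Combinatorics.Specification using (k>n⇒nCk≡0)
  open import Data.Nat.Properties
  open import Data.Nat.Tactic.RingSolver using (solve-∀)
  open import Data.Product using (_,_)
  open import Relation.Binary.PropositionalEquality
  open import Relation.Nullary.Decidable using (from-yes)

  -- The left side consists of the two leading terms of the binomial expansion of the right side. It
  -- closes the Pascal step in `k!*nCk≤n^k`.
  [1+k]*m^k+m^[1+k]≤[1+m]^[1+k] : ∀ m k → suc k * m ^ k + m ^ suc k ≤ suc m ^ suc k
  [1+k]*m^k+m^[1+k]≤[1+m]^[1+k] m zero    = ≤-reflexive (lemma m)
    where
    lemma : ∀ m → 1 * 1 + m * 1 ≡ (1 + m) * 1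
    lemma = solve-∀
  [1+k]*m^k+m^[1+k]≤[1+m]^[1+k] m (suc k) = begin
    suc (suc k) * m ^ suc k + m ^ suc (suc k)        ≡⟨ lemma m (m ^ k) k ⟩
    m ^ suc k + m * (suc k * m ^ k + m ^ suc k)      ≤⟨ +-mono-≤ (^-monoˡ-≤ (suc k) (n≤1+n m))
                                                         (*-monoʳ-≤ m ([1+k]*m^k+m^[1+k]≤[1+m]^[1+k] m k)) ⟩
    suc m ^ suc (suc k)                              ∎
    where
    open ≤-Reasoning
    lemma : ∀ m p k → (2 + k) * (m * p) + m * (m * p) ≡ m * p + m * ((1 + k) * p + m * p)
    lemma = solve-∀

  k!*nCk≤n^k : ∀ k n → k ! * (n C k) ≤ n ^ k
  k!*nCk≤n^k zero    zero    = ≤-refl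
  k!*nCk≤n^k zero    (suc n) = ≤-refl
  k!*nCk≤n^k (suc k) zero    =
    ≤-reflexive (trans (cong (suc k ! *_) (k>n⇒nCk≡0 {0} {suc k} (s≤s z≤n))) (*-zeroʳ (suc k !)))
  k!*nCk≤n^k (suc k) (suc n) = begin
    suc k ! * (suc n C suc k)                       ≡⟨ cong (suc k ! *_) (nCk+nC[k+1]≡[n+1]C[k+1] n k) ⟨
    suc k ! * (n C k + n C suc k)                   ≡⟨ lemma (suc k) (k !) (n C k) (n C suc k) ⟩
    suc k * (k ! * (n C k)) + suc k ! * (n C suc k) ≤⟨ +-mono-≤ (*-monoʳ-≤ (suc k) (k!*nCk≤n^k k n))
                                                                (k!*nCk≤n^k (suc k) n) ⟩
    suc k * n ^ k + n ^ suc k                       ≤⟨ [1+k]*m^k+m^[1+k]≤[1+m]^[1+k] n k ⟩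
    suc n ^ suc k                                   ∎
    where
    open ≤-Reasoning
    lemma : ∀ s f a b → (s * f) * (a + b) ≡ s * (f * a) + (s * f) * b
    lemma = solve-∀

  module _ {A : Set} where

    -- By induction the smaller combinations contribute less than (k+1) · 2N^k after scaling by
    -- (k+1)!, and 2(k+1) ≤ N bounds this by N · N^k, the same as the bound for the top binomial.
    -- Strictness starts with the empty list at k = 0.
    length-combinationsUpTo : ∀ k (xs : List A) → 2 * k ≤ length xs →
      k ! * length (combinationsUpTo k xs) < 2 * length xs ^ k
    length-combinationsUpTo zero    xs _  = s≤s z≤n
    length-combinationsUpTo (suc k) xs le = begin-strict
      suc k ! * length (combinationsUpTo (suc k) xs)
        ≡⟨ cong (suc k ! *_) (trans (length-++ (combinations (suc k) xs))
             (cong (_+ length (combinationsUpTo k xs)) (length-combinations (suc k) xs))) ⟩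
      suc k ! * (N C suc k + length (combinationsUpTo k xs))
        ≡⟨ lemma₁ (suc k) (k !) (N C suc k) (length (combinationsUpTo k xs)) ⟩
      suc k ! * (N C suc k) + suc k * (k ! * length (combinationsUpTo k xs))
        <⟨ +-mono-≤-< (k!*nCk≤n^k (suc k) N) (*-monoʳ-< (suc k)
             (length-combinationsUpTo k xs (≤-trans (*-monoʳ-≤ 2 (n≤1+n k)) le))) ⟩
      N ^ suc k + suc k * (2 * N ^ k)
        ≡⟨ cong (N ^ suc k +_) (lemma₂ (suc k) (N ^ k)) ⟩
      N ^ suc k + 2 * suc k * N ^ k
        ≤⟨ +-monoʳ-≤ (N ^ suc k) (*-monoˡ-≤ (N ^ k) le) ⟩
      N ^ suc k + N * N ^ k
        ≡⟨ lemma₃ (N ^ suc k) ⟩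
      2 * N ^ suc k ∎
      where
      open ≤-Reasoning
      N = length xs
      lemma₁ : ∀ s f a b → (s * f) * (a + b) ≡ (s * f) * a + s * (f * b)
      lemma₁ = solve-∀
      lemma₂ : ∀ s p → s * (2 * p) ≡ (2 * s) * p
      lemma₂ = solve-∀
      lemma₃ : ∀ p → p + p ≡ 2 * p
      lemma₃ = solve-∀

  1+n≤2^n : ∀ n → suc n ≤ 2 ^ n
  1+n≤2^n zero    = ≤-refl
  1+n≤2^n (suc n) = begin
    suc (suc n)    ≤⟨ +-mono-≤ (m^n>0 2 n) (1+n≤2^n n) ⟩
    2 ^ n + 2 ^ n  ≡⟨ cong (2 ^ n +_) (+-identityʳ (2 ^ n)) ⟨
    2 ^ suc n      ∎
    where open ≤-Reasoning

  2*[4+n]≤2^[3+n] : ∀ n → 2 * (4 + n) ≤ 2 ^ (3 + n)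
  2*[4+n]≤2^[3+n] zero    = ≤-refl
  2*[4+n]≤2^[3+n] (suc n) = begin
    2 * (5 + n)              ≡⟨ *-distribˡ-+ 2 1 (4 + n) ⟩
    2 + 2 * (4 + n)          ≤⟨ +-mono-≤ (*-monoʳ-≤ 2 (m^n>0 2 (2 + n))) (2*[4+n]≤2^[3+n] n) ⟩
    2 ^ (3 + n) + 2 ^ (3 + n) ≡⟨ cong (2 ^ (3 + n) +_) (+-identityʳ (2 ^ (3 + n))) ⟨
    2 ^ (4 + n)              ∎
    where open ≤-Reasoning

  few-small-families : ∀ m → 1 ≤ m →
    suc m ! * length (combinationsUpTo (suc m) (subsets m)) < 2 * (2 ^ m) ^ suc m
  -- For m = 1 and m = 2 the inequality 2(m+1) ≤ 2^m fails, so the combinations are enumerated: 6 <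
  -- 8 and 84 < 128.
  few-small-families 1 _ =
    from-yes (2 ! * length (combinationsUpTo 2 (subsets 1)) <? 2 * (2 ^ 1) ^ 2)
  few-small-families 2 _ =
    from-yes (3 ! * length (combinationsUpTo 3 (subsets 2)) <? 2 * (2 ^ 2) ^ 3)
  few-small-families m@(suc (suc (suc k))) _ =
    subst (λ N → suc m ! * length (combinationsUpTo (suc m) (subsets m)) < 2 * N ^ suc m)
      (length-subsets m)
      (length-combinationsUpTo (suc m) (subsets m)
        (subst (2 * suc m ≤_) (sym (length-subsets m)) (2*[4+n]≤2^[3+n] k)))

  n*n∸n : ∀ m → suc m * suc m ∸ suc m ≡ m * suc m
  n*n∸n m = m+n∸m≡n (suc m) (m * suc m)

  upper-arithmetic : ∀ m b → 1 ≤ m →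
    b ≤ 2 * length (combinationsUpTo (suc m) (subsets m)) →
    b * suc m ! < 4 * 2 ^ (suc m * suc m ∸ suc m)
  upper-arithmetic m b 1≤m b≤ = begin-strict
    b * suc m !                      ≤⟨ *-monoˡ-≤ (suc m !) b≤ ⟩
    2 * L * suc m !                  ≡⟨ lemma L (suc m !) ⟩
    2 * (suc m ! * L)                <⟨ *-monoʳ-< 2 (few-small-families m 1≤m) ⟩
    2 * (2 * (2 ^ m) ^ suc m)        ≡⟨ *-assoc 2 2 ((2 ^ m) ^ suc m) ⟨
    4 * (2 ^ m) ^ suc m              ≡⟨ cong (4 *_) (trans (^-*-assoc 2 m (suc m))
                                          (cong (2 ^_) (sym (n*n∸n m)))) ⟩
    4 * 2 ^ (suc m * suc m ∸ suc m)  ∎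
    where
    open ≤-Reasoning
    L = length (combinationsUpTo (suc m) (subsets m))
    lemma : ∀ l f → (2 * l) * f ≡ 2 * (f * l)
    lemma = solve-∀

  -- the number of linearly independent k-tuples in a space of q = 2^m vectors over 𝔽₂
  independentTuples : ℕ → ℕ → ℕ
  independentTuples q zero    = 1
  independentTuples q (suc k) = independentTuples q k * (q ∸ 2 ^ k)

  -- Divided by q^(k+1) this is a union bound: the product of the factors 1 - 2^i/q over i < k is at
  -- least 1 - 2^k/q. The induction step is q(q - 2a) ≤ (q - a)² with a = 2^k.
  q^k*[q∸2^k]≤q*independentTuples : ∀ q k → 2 ^ k ≤ q →
    q ^ k * (q ∸ 2 ^ k) ≤ q * independentTuples q k
  q^k*[q∸2^k]≤q*independentTuples q zero    _  = begin
    1 * (q ∸ 1)  ≡⟨ *-identityˡ (q ∸ 1) ⟩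
    q ∸ 1        ≤⟨ m∸n≤m q 1 ⟩
    q            ≡⟨ *-identityʳ q ⟨
    q * 1        ∎
    where open ≤-Reasoning
  q^k*[q∸2^k]≤q*independentTuples q (suc k) le = begin
    q ^ suc k * (q ∸ 2 ^ suc k)               ≡⟨ lemma₁ q (q ^ k) (q ∸ 2 ^ suc k) ⟩
    q ^ k * (q * (q ∸ 2 ^ suc k))             ≤⟨ *-monoʳ-≤ (q ^ k) square ⟩
    q ^ k * ((q ∸ 2 ^ k) * (q ∸ 2 ^ k))       ≡⟨ *-assoc (q ^ k) (q ∸ 2 ^ k) (q ∸ 2 ^ k) ⟨
    q ^ k * (q ∸ 2 ^ k) * (q ∸ 2 ^ k)         ≤⟨ *-monoˡ-≤ (q ∸ 2 ^ k)
                                                  (q^k*[q∸2^k]≤q*independentTuples q k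
                                                    (≤-trans (m≤m+n (2 ^ k) _) le)) ⟩
    q * independentTuples q k * (q ∸ 2 ^ k)   ≡⟨ *-assoc q (independentTuples q k) (q ∸ 2 ^ k) ⟩
    q * independentTuples q (suc k)           ∎
    where
    open ≤-Reasoning
    lemma₁ : ∀ q p r → (q * p) * r ≡ p * (q * r)
    lemma₁ = solve-∀
    lemma₂ : ∀ a t → (a + t) * (a + t) ≡ (2 * a + t) * t + a * a
    lemma₂ = solve-∀
    square : q * (q ∸ 2 ^ suc k) ≤ (q ∸ 2 ^ k) * (q ∸ 2 ^ k)
    square with t , refl ← m≤n⇒∃[o]m+o≡n le = begin
      (2 * a + t) * ((2 * a + t) ∸ 2 * a)     ≡⟨ cong ((2 * a + t) *_) (m+n∸m≡n (2 * a) t) ⟩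
      (2 * a + t) * t                         ≤⟨ m≤m+n _ (a * a) ⟩
      (2 * a + t) * t + a * a                 ≡⟨ lemma₂ a t ⟨
      (a + t) * (a + t)                       ≡⟨ cong₂ _*_ drop drop ⟨
      ((2 * a + t) ∸ a) * ((2 * a + t) ∸ a)   ∎
      where
      a = 2 ^ k
      lemma₃ : ∀ a t → 2 * a + t ≡ a + (a + t)
      lemma₃ = solve-∀
      drop : (2 * a + t) ∸ a ≡ a + t
      drop = trans (cong (_∸ a) (lemma₃ a t)) (m+n∸m≡n a (a + t))

  -- At k = m the union bound would give 0. It is therefore applied to the first m-1 factors, where
  -- it leaves 1/2, and the last factor is exactly 1/2.
  many-independent-tuples : ∀ m → 1 ≤ m → (2 ^ m) ^ m ≤ 4 * independentTuples (2 ^ m) m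
  many-independent-tuples (suc p) _ = *-cancelˡ-≤ (2 ^ suc p) {{m^n≢0 2 (suc p)}} (begin
    q * (q * q ^ p)                              ≡⟨ lemma₁ (2 ^ p) (q ^ p) ⟩
    4 * (q ^ p * 2 ^ p * 2 ^ p)                  ≡⟨ cong (λ t → 4 * (q ^ p * t * 2 ^ p)) half ⟨
    4 * (q ^ p * (q ∸ 2 ^ p) * 2 ^ p)            ≤⟨ *-monoʳ-≤ 4 (*-monoˡ-≤ (2 ^ p)
                                                      (q^k*[q∸2^k]≤q*independentTuples q p (m≤m+n (2 ^ p) _))) ⟩
    4 * (q * independentTuples q p * 2 ^ p)      ≡⟨ lemma₂ q (independentTuples q p) (2 ^ p) ⟩
    q * (4 * (independentTuples q p * 2 ^ p))    ≡⟨ cong (λ t → q * (4 * (independentTuples q p * t))) half ⟨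
    q * (4 * independentTuples q (suc p))        ∎)
    where
    open ≤-Reasoning
    q = 2 ^ suc p
    half : q ∸ 2 ^ p ≡ 2 ^ p
    half = trans (m+n∸m≡n (2 ^ p) (2 ^ p + 0)) (+-identityʳ (2 ^ p))
    lemma₁ : ∀ h r → (2 * h) * ((2 * h) * r) ≡ 4 * (r * h * h)
    lemma₁ = solve-∀
    lemma₂ : ∀ q t h → 4 * (q * t * h) ≡ q * (4 * (t * h))
    lemma₂ = solve-∀

  -- The exponent n² - n splits as m² + m: the m² comes from the tuples, the factor 2^m is absorbed
  -- by `gap`. Of the 4 lost on independence, one 2 is regained from the signs and the other is the
  -- `∸ 1` in the exponent.
  lower-arithmetic : ∀ m b → 1 ≤ m → 2 * independentTuples (2 ^ m) m ≤ b * suc m ! →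
    2 ^ (suc m * suc m ∸ suc m ∸ 1) ≤ b * (suc m ! * (2 ^ suc m ∸ suc m))
  lower-arithmetic m@(suc _) b 1≤m le = *-cancelˡ-≤ 2 (begin
    2 * 2 ^ (suc m * suc m ∸ suc m ∸ 1)                ≡⟨ cong (λ e → 2 ^ suc (e ∸ 1)) (n*n∸n m) ⟩
    2 ^ (m * suc m)                                    ≡⟨ cong (2 ^_) (*-suc m m) ⟩
    2 ^ (m + m * m)                                    ≡⟨ ^-distribˡ-+-* 2 m (m * m) ⟩
    2 ^ m * 2 ^ (m * m)                                ≡⟨ cong (2 ^ m *_) (^-*-assoc 2 m m) ⟨
    2 ^ m * (2 ^ m) ^ m                                ≤⟨ *-monoʳ-≤ (2 ^ m) (many-independent-tuples m 1≤m) ⟩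
    2 ^ m * (4 * independentTuples (2 ^ m) m)          ≡⟨ lemma (2 ^ m) (independentTuples (2 ^ m) m) ⟩
    2 * (2 * independentTuples (2 ^ m) m * 2 ^ m)      ≤⟨ *-monoʳ-≤ 2 (*-mono-≤ le gap) ⟩
    2 * (b * suc m ! * (2 ^ suc m ∸ suc m))            ≡⟨ cong (2 *_) (*-assoc b (suc m !) (2 ^ suc m ∸ suc m)) ⟩
    2 * (b * (suc m ! * (2 ^ suc m ∸ suc m)))          ∎)
    where
    open ≤-Reasoning
    lemma : ∀ h t → h * (4 * t) ≡ 2 * (2 * t * h)
    lemma = solve-∀
    gap : 2 ^ m ≤ 2 ^ suc m ∸ suc m
    gap = begin
      2 ^ m              ≡⟨ trans (m+n∸m≡n (2 ^ m) (2 ^ m + 0)) (+-identityʳ (2 ^ m)) ⟨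
      2 ^ suc m ∸ 2 ^ m  ≤⟨ ∸-monoʳ-≤ (2 ^ suc m) (1+n≤2^n m) ⟩
      2 ^ suc m ∸ suc m  ∎

-- Comparing and embedding integers in the rationals

module Rationals where

  open import Data.Integer as ℤ using (ℤ; +_; 1ℤ)
  import Data.Integer.Properties as ℤ
  open import Data.Integer.Tactic.RingSolver using (solve-∀)
  open import Data.Nat as ℕ using (ℕ; suc)
  import Data.Nat.Properties as ℕ
  open import Data.Rational
  open import Data.Rational.Properties
  open import Data.Rational.Unnormalised as ℚᵘ using (mkℚᵘ; *≡*; *≤*; *<*)
  import Data.Rational.Unnormalised.Properties as ℚᵘ
  open import Relation.Binary.PropositionalEquality

  -- `_/_` reduces its fraction, so the comparison is made among unnormalised rationals, where it is
  -- cross-multiplication.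
  /-mono-≤ : ∀ {a b c d} .{{_ : ℕ.NonZero b}} .{{_ : ℕ.NonZero d}} →
    a ℕ.* d ℕ.≤ c ℕ.* b → + a / b ≤ + c / d
  /-mono-≤ {a} {suc b} {c} {suc d} le = toℚᵘ-cancel-≤ (begin
    toℚᵘ (+ a / suc b)  ≃⟨ toℚᵘ-fromℚᵘ (mkℚᵘ (+ a) b) ⟩
    mkℚᵘ (+ a) b        ≤⟨ *≤* (subst₂ ℤ._≤_ (ℤ.pos-* a (suc d)) (ℤ.pos-* c (suc b)) (ℤ.+≤+ le)) ⟩
    mkℚᵘ (+ c) d        ≃⟨ toℚᵘ-fromℚᵘ (mkℚᵘ (+ c) d) ⟨
    toℚᵘ (+ c / suc d)  ∎)
    where open ℚᵘ.≤-Reasoning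

  <-/-* : ∀ {a b c d} .{{_ : ℕ.NonZero c}} →
    a ℕ.* c ℕ.< b ℕ.* d → + a / 1 < (+ b / c) * (+ d / 1)
  <-/-* {a} {b} {suc c} {d} lt = toℚᵘ-cancel-< (begin-strict
    toℚᵘ (+ a / 1)                             ≃⟨ toℚᵘ-fromℚᵘ (mkℚᵘ (+ a) 0) ⟩
    mkℚᵘ (+ a) 0                               <⟨ *<* (subst₂ ℤ._<_
                                                    (trans (ℤ.pos-* a (suc c)) (cong (λ t → + a ℤ.* + t) (sym (ℕ.*-identityʳ (suc c)))))
                                                    (trans (ℤ.pos-* b d) (sym (ℤ.*-identityʳ (+ b ℤ.* + d))))
                                                    (ℤ.+<+ lt)) ⟩
    mkℚᵘ (+ b) c ℚᵘ.* mkℚᵘ (+ d) 0             ≃⟨ ℚᵘ.*-cong (toℚᵘ-fromℚᵘ (mkℚᵘ (+ b) c)) (toℚᵘ-fromℚᵘ (mkℚᵘ (+ d) 0)) ⟨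
    toℚᵘ (+ b / suc c) ℚᵘ.* toℚᵘ (+ d / 1)     ≃⟨ toℚᵘ-homo-* (+ b / suc c) (+ d / 1) ⟨
    toℚᵘ ((+ b / suc c) * (+ d / 1))           ∎)
    where
    open ℚᵘ.≤-Reasoning


  ι : ℤ → ℚ
  ι i = i / 1

  private
    toℚᵘ-ι : ∀ i → toℚᵘ (ι i) ℚᵘ.≃ mkℚᵘ i 0
    toℚᵘ-ι i = toℚᵘ-fromℚᵘ (mkℚᵘ i 0)

  ι-+ : ∀ i j → ι (i ℤ.+ j) ≡ ι i + ι j
  ι-+ i j = toℚᵘ-injective (begin
    toℚᵘ (ι (i ℤ.+ j))             ≈⟨ toℚᵘ-ι (i ℤ.+ j) ⟩
    mkℚᵘ (i ℤ.+ j) 0               ≈⟨ *≡* (lemma i j) ⟩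
    mkℚᵘ i 0 ℚᵘ.+ mkℚᵘ j 0         ≈⟨ ℚᵘ.+-cong (toℚᵘ-ι i) (toℚᵘ-ι j) ⟨
    toℚᵘ (ι i) ℚᵘ.+ toℚᵘ (ι j)     ≈⟨ toℚᵘ-homo-+ (ι i) (ι j) ⟨
    toℚᵘ (ι i + ι j)               ∎)
    where
    open ℚᵘ.≃-Reasoning
    lemma : ∀ i j → (i ℤ.+ j) ℤ.* 1ℤ ≡ (i ℤ.* 1ℤ ℤ.+ j ℤ.* 1ℤ) ℤ.* 1ℤ
    lemma = solve-∀

  ι-* : ∀ i j → ι (i ℤ.* j) ≡ ι i * ι j
  ι-* i j = toℚᵘ-injective (begin
    toℚᵘ (ι (i ℤ.* j))             ≈⟨ toℚᵘ-ι (i ℤ.* j) ⟩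
    mkℚᵘ i 0 ℚᵘ.* mkℚᵘ j 0         ≈⟨ ℚᵘ.*-cong (toℚᵘ-ι i) (toℚᵘ-ι j) ⟨
    toℚᵘ (ι i) ℚᵘ.* toℚᵘ (ι j)     ≈⟨ toℚᵘ-homo-* (ι i) (ι j) ⟨
    toℚᵘ (ι i * ι j)               ∎)
    where open ℚᵘ.≃-Reasoning

  ι-mono-≤ : ∀ {i j} → i ℤ.≤ j → ι i ≤ ι j
  ι-mono-≤ {i} {j} le = toℚᵘ-cancel-≤ (begin
    toℚᵘ (ι i)  ≃⟨ toℚᵘ-ι i ⟩
    mkℚᵘ i 0    ≤⟨ *≤* (ℤ.*-monoʳ-≤-nonNeg 1ℤ le) ⟩
    mkℚᵘ j 0    ≃⟨ toℚᵘ-ι j ⟨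
    toℚᵘ (ι j)  ∎)
    where open ℚᵘ.≤-Reasoning

  ι-mono-< : ∀ {i j} → i ℤ.< j → ι i < ι j
  ι-mono-< {i} {j} lt = toℚᵘ-cancel-< (begin-strict
    toℚᵘ (ι i)  ≃⟨ toℚᵘ-ι i ⟩
    mkℚᵘ i 0    <⟨ *<* (ℤ.*-monoʳ-<-pos 1ℤ lt) ⟩
    mkℚᵘ j 0    ≃⟨ toℚᵘ-ι j ⟨
    toℚᵘ (ι j)  ∎)
    where open ℚᵘ.≤-Reasoning

-- Integer elimination: linear dependence and Stiemke's alternative

module IntegerLinearAlgebra where

  open import Data.Fin using (Fin; zero; suc; punchIn)
  open import Data.Fin.Properties using (any?; suc-injective; punchIn-injective; punchInᵢ≢i)
  open import Data.Integer hiding (suc; pred; pos; neg; _⊔_; _⊓_)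
  open import Data.Integer.Properties
  open import Data.Integer.Tactic.RingSolver using (solve-∀)
  open import Data.List using (List; []; _∷_; _++_; foldr; filter; length; cartesianProductWith)
  open import Data.List.Membership.Propositional using (_∈_; find; lose)
  open import Data.List.Membership.Propositional.Properties
  open import Data.List.Relation.Unary.All as All using (All; []; _∷_)
  open import Data.List.Relation.Unary.Any as Any using (Any; here; there)
  open import Data.Nat as ℕ using (ℕ; zero; suc; s≤s)
  open import Data.Product using (∃; ∃₂; _×_; _,_; proj₁; proj₂)
  open import Data.Sum using (_⊎_; inj₁; inj₂)
  open import Function using (_∘_)
  open import Relation.Binary.Definitions using (tri<; tri≈; tri>)
  open import Relation.Binary.PropositionalEquality
  open import Relation.Nullary using (¬_; yes; no; contradiction; ¬?)
  open import Relation.Nullary.Decidable using (decidable-stable)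

  0≤a*b : ∀ {a b} → 0ℤ ≤ a → 0ℤ ≤ b → 0ℤ ≤ a * b
  0≤a*b {a} {b} 0≤a 0≤b =
    subst (_≤ a * b) (*-zeroʳ a) (*-monoˡ-≤-nonNeg a {{nonNegative 0≤a}} 0≤b)

  0<a*b : ∀ {a b} → 0ℤ < a → 0ℤ < b → 0ℤ < a * b
  0<a*b {a} {b} 0<a 0<b =
    subst (_< a * b) (*-zeroʳ a) (*-monoˡ-<-pos a {{positive 0<a}} 0<b)

  a+b*0≡a : ∀ a b {c} → c ≡ 0ℤ → a + b * c ≡ a
  a+b*0≡a a b refl = trans (cong (λ t → a + t) (*-zeroʳ b)) (+-identityʳ a)

  a*0+b*0≡0 : ∀ a b {c d} → c ≡ 0ℤ → d ≡ 0ℤ → a * c + b * d ≡ 0ℤ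
  a*0+b*0≡0 a b refl refl = cong₂ _+_ (*-zeroʳ a) (*-zeroʳ b)

  -- the least of the ratios num a / den a, by cross-multiplication
  argmin : ∀ {A : Set} (num den : A → ℤ) (xs : List A) → (∃ λ a → a ∈ xs) →
    (∀ {a} → a ∈ xs → 0ℤ < den a) →
    ∃ λ a → a ∈ xs × (∀ {b} → b ∈ xs → num a * den b ≤ num b * den a)
  argmin num den (x ∷ [])     _ pos = x , here refl , λ { (here refl) → ≤-refl }
  argmin num den (x ∷ y ∷ ys) _ pos
    with a , a∈ , min ← argmin num den (y ∷ ys) (y , here refl) (pos ∘ there)
    with ≤-total (num x * den a) (num a * den x)
  ... | inj₁ x≤a = x , here refl , least
    where
    chain : ∀ nx dx na da nb db → 0ℤ < dx → 0ℤ < db →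
      nx * da ≤ na * dx → na * db ≤ nb * da → nx * db * da ≤ nb * dx * da
    chain nx dx na da nb db 0<dx 0<db p q = begin
      nx * db * da   ≡⟨ lemma nx db da ⟩
      nx * da * db   ≤⟨ *-monoʳ-≤-nonNeg db {{nonNegative (<⇒≤ 0<db)}} p ⟩
      na * dx * db   ≡⟨ lemma na dx db ⟩
      na * db * dx   ≤⟨ *-monoʳ-≤-nonNeg dx {{nonNegative (<⇒≤ 0<dx)}} q ⟩
      nb * da * dx   ≡⟨ lemma nb da dx ⟩
      nb * dx * da   ∎
      where
      open ≤-Reasoning
      lemma : ∀ a b c → a * b * c ≡ a * c * b
      lemma = solve-∀
    least : ∀ {b} → b ∈ x ∷ y ∷ ys → num x * den b ≤ num b * den x
    least     (here refl) = ≤-refl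
    least {b} (there b∈)  = *-cancelʳ-≤-pos _ _ (den a) {{positive (pos (there a∈))}}
      (chain (num x) (den x) (num a) (den a) (num b) (den b)
        (pos (here refl)) (pos (there b∈)) x≤a (min b∈))
  ... | inj₂ a≤x = a , there a∈ , λ { (here refl) → a≤x ; (there b∈) → min b∈ }

  module Elimination {A : Set} where

    combine : ℤ → ℤ → (A → ℤ) → (A → ℤ) → A → ℤ
    combine a b u v i = a * u i + b * v i

    0ᵥ : A → ℤ
    0ᵥ _ = 0ℤ

    -- Vectors are functions and pointwise equal ones are not interchangeable, so linearity is
    -- demanded at `combine` itself, and the value at `0ᵥ` is a field of its own.
    record Functional : Set where
      field
        apply  : (A → ℤ) → ℤ
        linear : ∀ a b u v → apply (combine a b u v) ≡ a * apply u + b * apply v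
        null   : apply 0ᵥ ≡ 0ℤ

    open Functional public

    Vanish : List Functional → (A → ℤ) → Set
    Vanish fs u = All (λ f → apply f u ≡ 0ℤ) fs

    record Subspace (P : (A → ℤ) → Set) : Set where
      field
        closed : ∀ a b {u v} → P u → P v → P (combine a b u v)

    kernel : ∀ {P} (f : Functional) → Subspace P → Subspace (λ u → P u × apply f u ≡ 0ℤ)
    kernel f sub = record { closed = λ a b {u} {v} (Pu , fu) (Pv , fv) →
      Subspace.closed sub a b Pu Pv ,
      trans (linear f a b u v) (a*0+b*0≡0 a b fu fv) }

    -- The private coordinate as i of us i keeps the family independent during elimination.
    dependent : ∀ fs {P} → Subspace P → ∀ {k} (us : Fin k → A → ℤ) (as : Fin k → A) →
      (∀ i → P (us i)) → (∀ i → us i (as i) ≢ 0ℤ) → (∀ i j → i ≢ j → us i (as j) ≡ 0ℤ) →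
      length fs ℕ.< k →
      ∃ λ u → P u × (∃ λ a → u a ≢ 0ℤ) × Vanish fs u
    dependent []       sub us as Pus diag off (s≤s _) =
      us zero , Pus zero , (as zero , diag zero) , []
    dependent (f ∷ fs) {P} sub {suc k} us as Pus diag off (s≤s lt)
      with any? (λ i → ¬? (apply f (us i) ≟ 0ℤ))
    ... | no none
      with u , (Pu , fu) , u≢0 , rest ← dependent fs (kernel f sub) (us ∘ suc) (as ∘ suc)
        (λ i → Pus (suc i) , decidable-stable (apply f (us (suc i)) ≟ 0ℤ) (λ ≢0 → none (suc i , ≢0)))
        (λ i → diag (suc i)) (λ i j i≢j → off (suc i) (suc j) (i≢j ∘ suc-injective)) lt
      = u , Pu , u≢0 , fu ∷ rest
    -- `us p` is the pivot and is dropped. Cross-multiplying replaces division; since the pivot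
    -- vanishes at the other private coordinates, each diagonal entry is merely multiplied by the
    -- nonzero value `apply f (us p)`.
    ... | yes (p , fp≢0) =
      let u , (Pu , fu) , u≢0 , rest = dependent fs (kernel f sub) us′ (as ∘ punchIn p)
            (λ i → Subspace.closed sub (apply f (us p)) (- apply f (us (punchIn p i)))
                     (Pus (punchIn p i)) (Pus p) , f-us′ i) diag′ off′ lt
      in u , Pu , u≢0 , fu ∷ rest
      where
      us′ : Fin k → A → ℤ
      us′ i = combine (apply f (us p)) (- apply f (us (punchIn p i))) (us (punchIn p i)) (us p)
      f-us′ : ∀ i → apply f (us′ i) ≡ 0ℤ
      f-us′ i = trans (linear f (apply f (us p)) (- apply f (us (punchIn p i))) (us (punchIn p i)) (us p))
        (lemma (apply f (us p)) (apply f (us (punchIn p i))))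
        where
        lemma : ∀ a b → a * b + (- b) * a ≡ 0ℤ
        lemma = solve-∀
      at : ∀ i j → us′ i (as (punchIn p j)) ≡ apply f (us p) * us (punchIn p i) (as (punchIn p j))
      at i j = a+b*0≡a _ (- apply f (us (punchIn p i))) (off p (punchIn p j) (punchInᵢ≢i p j ∘ sym))
      diag′ : ∀ i → us′ i (as (punchIn p i)) ≢ 0ℤ
      diag′ i eq with i*j≡0⇒i≡0∨j≡0 (apply f (us p)) (trans (sym (at i i)) eq)
      ... | inj₁ z = fp≢0 z
      ... | inj₂ z = diag (punchIn p i) z
      off′ : ∀ i j → i ≢ j → us′ i (as (punchIn p j)) ≡ 0ℤ
      off′ i j i≢j = trans (at i j)
        (trans (cong (apply f (us p) *_) (off (punchIn p i) (punchIn p j) (i≢j ∘ punchIn-injective p i j)))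
               (*-zeroʳ (apply f (us p))))

    record Cone (P : (A → ℤ) → Set) : Set where
      field
        nonneg : ∀ {u} → P u → ∀ a → 0ℤ ≤ u a
        zero∈  : P 0ᵥ
        closed : ∀ a b {u v} → 0ℤ ≤ a → 0ℤ ≤ b → P u → P v → P (combine a b u v)

    face : ∀ {P} (f : Functional) → Cone P → Cone (λ u → P u × apply f u ≡ 0ℤ)
    face f cone = record
      { nonneg = λ (Pu , _) → nonneg Pu
      ; zero∈  = zero∈ , null f
      ; closed = λ a b {u} {v} 0≤a 0≤b (Pu , fu) (Pv , fv) →
          closed a b 0≤a 0≤b Pu Pv ,
          trans (linear f a b u v) (a*0+b*0≡0 a b fu fv) }
      where open Cone cone

    data Span (fs : List Functional) : ((A → ℤ) → ℤ) → Set where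
      generator : ∀ {f} → f ∈ fs → Span fs (apply f)
      combined  : ∀ a b {g h} → Span fs g → Span fs h → Span fs (λ u → a * g u + b * h u)

    Span-∷ : ∀ {f fs g} → Span fs g → Span (f ∷ fs) g
    Span-∷ (generator f∈)    = generator (there f∈)
    Span-∷ (combined a b s t) = combined a b (Span-∷ s) (Span-∷ t)

    Span-linear : ∀ {fs g} → Span fs g → ∀ a b u v → g (combine a b u v) ≡ a * g u + b * g v
    Span-linear (generator {f} _) a b u v = linear f a b u v
    Span-linear (combined c d {g} {h} s t) a b u v =
      trans (cong₂ (λ p q → c * p + d * q) (Span-linear s a b u v) (Span-linear t a b u v))
            (lemma a b c d (g u) (g v) (h u) (h v))
      where
      lemma : ∀ a b c d gu gv hu hv →
        c * (a * gu + b * gv) + d * (a * hu + b * hv) ≡ a * (c * gu + d * hu) + b * (c * gv + d * hv)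
      lemma = solve-∀

    -- Positivity is asked for coordinatewise, wherever some generator is positive, and not as
    -- positive coefficients on the generators. This form passes from the mixed generators back to
    -- the original ones.
    Feasible : ((A → ℤ) → Set) → List Functional → List (A → ℤ) → Set
    Feasible P fs us =
      ∃ λ x → P x × (∀ a → Any (λ u → 0ℤ < u a) us → 0ℤ < x a) × Vanish fs x

    Separated : List Functional → List (A → ℤ) → Set
    Separated fs us =
      ∃ λ g → Span fs g × (∀ {u} → u ∈ us → 0ℤ ≤ g u) × (∃ λ u → u ∈ us × 0ℤ < g u)

    -- Passage to the hyperplane of `f`: generators on it are kept, and every pair on opposite sides
    -- contributes the positive combination `mix` that lies on it.
    module Step {P : (A → ℤ) → Set} (cone : Cone P) (f : Functional) (fs : List Functional)
                (us : List (A → ℤ)) (Pus : All P us) where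

      open Cone cone
      F = apply f

      pos neg zer : List (A → ℤ)
      pos = filter (λ u → 0ℤ <? F u) us
      neg = filter (λ u → F u <? 0ℤ) us
      zer = filter (λ u → F u ≟ 0ℤ) us

      mix : (A → ℤ) → (A → ℤ) → A → ℤ
      mix p q = combine (F p) (- F q) q p

      us′ : List (A → ℤ)
      us′ = zer ++ cartesianProductWith mix pos neg

      pos⁻ : ∀ {u} → u ∈ pos → u ∈ us × 0ℤ < F u
      pos⁻ = ∈-filter⁻ (λ u → 0ℤ <? F u)
      neg⁻ : ∀ {u} → u ∈ neg → u ∈ us × F u < 0ℤ
      neg⁻ = ∈-filter⁻ (λ u → F u <? 0ℤ)

      mix∈ : ∀ {p q} → p ∈ pos → q ∈ neg → mix p q ∈ us′
      mix∈ p∈ q∈ = ∈-++⁺ʳ zer (∈-cartesianProductWith⁺ mix p∈ q∈)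

      mix-P : ∀ {p q} → p ∈ pos → q ∈ neg → P (mix p q)
      mix-P {p} {q} p∈ q∈ with p∈us , 0<Fp ← pos⁻ p∈ | q∈us , Fq<0 ← neg⁻ q∈ =
        closed (F p) (- F q) (<⇒≤ 0<Fp) (<⇒≤ (neg-mono-< Fq<0)) (All.lookup Pus q∈us) (All.lookup Pus p∈us)

      ∈us′ : ∀ {u} → u ∈ us′ →
        (u ∈ zer × u ∈ us × F u ≡ 0ℤ) ⊎ (∃₂ λ p q → p ∈ pos × q ∈ neg × u ≡ mix p q)
      ∈us′ u∈ with ∈-++⁻ zer u∈
      ... | inj₁ u∈zer = inj₁ (u∈zer , ∈-filter⁻ (λ u → F u ≟ 0ℤ) u∈zer)
      ... | inj₂ u∈mix = inj₂ (∈-cartesianProductWith⁻ mix pos neg u∈mix)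

      Pus′ : All (λ u → P u × F u ≡ 0ℤ) us′
      Pus′ = All.tabulate λ u∈ → good (∈us′ u∈)
        where
        lemma : ∀ a b → a * b + (- b) * a ≡ 0ℤ
        lemma = solve-∀
        good : ∀ {u} → _ → P u × F u ≡ 0ℤ
        good (inj₁ (_ , u∈us , Fu≡0))         = All.lookup Pus u∈us , Fu≡0
        good (inj₂ (p , q , p∈ , q∈ , refl)) =
          mix-P p∈ q∈ , trans (linear f (F p) (- F q) q p) (lemma (F p) (F q))

      mix-pos : ∀ {s t} u v → 0ℤ < s → 0ℤ ≤ t → 0ℤ < u → 0ℤ ≤ v → 0ℤ < s * u + t * v
      mix-pos u v 0<s 0≤t 0<u 0≤v = +-mono-<-≤ (0<a*b 0<s 0<u) (0≤a*b 0≤t 0≤v)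

      -- A coordinate where `u` is positive remains covered after mixing, for `u` enters with a
      -- positive coefficient and its partner is nonnegative. The two hypotheses supply a partner
      -- for every generator off the hyperplane.
      feasible : (∀ {u} → u ∈ pos → ∃ λ q → q ∈ neg) → (∀ {u} → u ∈ neg → ∃ λ p → p ∈ pos) →
        Feasible (λ u → P u × F u ≡ 0ℤ) fs us′ → Feasible P (f ∷ fs) us
      feasible pos⇒neg neg⇒pos (x , (Px , Fx) , cover , rest) =
        x , Px , (λ a any → let u , u∈ , 0<ua = find any in cover a (cover′ a u u∈ 0<ua)) , Fx ∷ rest
        where
        cover′ : ∀ a u → u ∈ us → 0ℤ < u a → Any (λ u → 0ℤ < u a) us′
        cover′ a u u∈ 0<ua with <-cmp (F u) 0ℤ
        ... | tri≈ _ Fu≡0 _ = lose (∈-++⁺ˡ (∈-filter⁺ (λ u → F u ≟ 0ℤ) u∈ Fu≡0)) 0<ua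
        ... | tri< Fu<0 _ _
          with u∈neg ← ∈-filter⁺ (λ u → F u <? 0ℤ) u∈ Fu<0
          with p , p∈ ← neg⇒pos u∈neg =
          lose (mix∈ p∈ u∈neg)
            (mix-pos (u a) (p a) (proj₂ (pos⁻ p∈)) (<⇒≤ (neg-mono-< Fu<0)) 0<ua
              (nonneg (All.lookup Pus (proj₁ (pos⁻ p∈))) a))
        ... | tri> _ _ 0<Fu
          with u∈pos ← ∈-filter⁺ (λ u → 0ℤ <? F u) u∈ 0<Fu
          with q , q∈ ← pos⇒neg u∈pos =
          lose (mix∈ u∈pos q∈)
            (subst (0ℤ <_) (+-comm (- F q * u a) (F u * q a))
              (mix-pos (u a) (q a) (neg-mono-< (proj₂ (neg⁻ q∈))) (<⇒≤ 0<Fu) 0<ua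
                (nonneg (All.lookup Pus (proj₁ (neg⁻ q∈))) a)))

      separated-all-zero : (∀ {u} → u ∈ us → F u ≡ 0ℤ) → Separated fs us′ → Separated (f ∷ fs) us
      separated-all-zero F≡0 (g , g∈ , g≥0 , u , u∈ , 0<gu) =
        g , Span-∷ g∈ ,
        (λ u∈ → g≥0 (∈-++⁺ˡ (∈-filter⁺ (λ u → F u ≟ 0ℤ) u∈ (F≡0 u∈)))) ,
        original (∈us′ u∈)
        where
        original : _ → ∃ λ u → u ∈ us × 0ℤ < g u
        original (inj₁ (_ , u∈us , _)) = u , u∈us , 0<gu
        original (inj₂ (p , q , p∈ , _)) =
          contradiction (F≡0 (proj₁ (pos⁻ p∈))) (<⇒≢ (proj₂ (pos⁻ p∈)) ∘ sym)

      -- g is corrected by the multiple of f that is tight at the vector p₀ with least g p / f p.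
      separated : (∃ λ p → p ∈ pos) → Separated fs us′ → Separated (f ∷ fs) us
      separated nonempty (g , g∈ , g≥0 , u₁ , u₁∈ , 0<gu₁)
        with p₀ , p₀∈ , min ← argmin g F pos nonempty (proj₂ ∘ pos⁻)
        = h , combined (F p₀) (- g p₀) (Span-∷ g∈) (generator (here refl)) , h≥0 , h-pos (∈us′ u₁∈)
        where
        h : (A → ℤ) → ℤ
        h u = F p₀ * g u + (- g p₀) * F u
        0<Fp₀ : 0ℤ < F p₀
        0<Fp₀ = proj₂ (pos⁻ p₀∈)
        g-mix : ∀ p q → g (mix p q) ≡ F p * g q + (- F q) * g p
        g-mix p q = Span-linear g∈ (F p) (- F q) q p
        h-zer : ∀ u → F u ≡ 0ℤ → F p₀ * g u ≡ h u
        h-zer u eq = sym (a+b*0≡a (F p₀ * g u) (- g p₀) eq)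
        -- On the negative side `h u` equals `g (mix p₀ u)`; on the positive side its sign is the
        -- minimality of the ratio at `p₀`.
        h≥0 : ∀ {u} → u ∈ us → 0ℤ ≤ h u
        h≥0 {u} u∈ with <-cmp (F u) 0ℤ
        ... | tri≈ _ Fu≡0 _ = subst (0ℤ ≤_) (h-zer u Fu≡0)
          (0≤a*b (<⇒≤ 0<Fp₀) (g≥0 (∈-++⁺ˡ (∈-filter⁺ (λ u → F u ≟ 0ℤ) u∈ Fu≡0))))
        ... | tri< Fu<0 _ _ = subst (0ℤ ≤_) (trans (g-mix p₀ u) (lemma (F p₀) (g u) (F u) (g p₀)))
          (g≥0 (mix∈ p₀∈ (∈-filter⁺ (λ u → F u <? 0ℤ) u∈ Fu<0)))
          where
          lemma : ∀ a b c d → a * b + (- c) * d ≡ a * b + (- d) * c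
          lemma = solve-∀
        ... | tri> _ _ 0<Fu = subst (0ℤ ≤_) (lemma (g u) (F p₀) (g p₀) (F u))
          (i≤j⇒0≤j-i (min (∈-filter⁺ (λ u → 0ℤ <? F u) u∈ 0<Fu)))
          where
          lemma : ∀ a b c d → a * b + - (c * d) ≡ b * a + (- c) * d
          lemma = solve-∀
        h-pos : _ → ∃ λ u → u ∈ us × 0ℤ < h u
        h-pos (inj₁ (_ , u∈us , Fu≡0)) =
          u₁ , u∈us , subst (0ℤ <_) (h-zer u₁ Fu≡0) (0<a*b 0<Fp₀ 0<gu₁)
        -- `F p₀ * g (mix p q)` is a combination of `h q` and `h p` with positive coefficients, so
        -- both cannot be 0 when `g` is positive on the mix.
        h-pos (inj₂ (p , q , p∈ , q∈ , refl)) with 0ℤ <? h p | 0ℤ <? h q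
        ... | yes 0<hp | _        = p , proj₁ (pos⁻ p∈) , 0<hp
        ... | no  _    | yes 0<hq = q , proj₁ (neg⁻ q∈) , 0<hq
        ... | no  hp≯0 | no  hq≯0 = contradiction (begin-strict
          0ℤ                                     <⟨ 0<a*b 0<Fp₀ 0<gu₁ ⟩
          F p₀ * g (mix p q)                     ≡⟨ cong (F p₀ *_) (g-mix p q) ⟩
          F p₀ * (F p * g q + (- F q) * g p)     ≡⟨ lemma (F p₀) (F p) (g q) (F q) (g p) (g p₀) ⟩
          F p * h q + (- F q) * h p              ≡⟨ cong₂ (λ s t → F p * s + (- F q) * t)
                                                     (≤-antisym (≮⇒≥ hq≯0) (h≥0 (proj₁ (neg⁻ q∈))))
                                                     (≤-antisym (≮⇒≥ hp≯0) (h≥0 (proj₁ (pos⁻ p∈)))) ⟩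
          F p * 0ℤ + (- F q) * 0ℤ                ≡⟨ a*0+b*0≡0 (F p) (- F q) refl refl ⟩
          0ℤ                                     ∎) (<-irrefl refl)
          where
          open ≤-Reasoning
          lemma : ∀ f₀ fp gq fq gp g₀ → f₀ * (fp * gq + (- fq) * gp)
            ≡ fp * (f₀ * gq + (- g₀) * fq) + (- fq) * (f₀ * gp + (- g₀) * fp)
          lemma = solve-∀

    empty? : (xs : List (A → ℤ)) → (∃ λ x → x ∈ xs) ⊎ (∀ {x} → ¬ x ∈ xs)
    empty? []       = inj₂ λ ()
    empty? (x ∷ xs) = inj₁ (x , here refl)

    -- Stiemke's alternative, by Fourier–Motzkin elimination.
    stiemke : ∀ fs {P} → Cone P → ∀ us → All P us → Feasible P fs us ⊎ Separated fs us
    stiemke [] cone us Pus = inj₁ (sum us , sum-P us Pus , cover us Pus , [])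
      where
      open Cone cone
      sum : List (A → ℤ) → A → ℤ
      sum = foldr (combine 1ℤ 1ℤ) 0ᵥ
      0≤1 : 0ℤ ≤ 1ℤ
      0≤1 = +≤+ ℕ.z≤n
      0<1 : 0ℤ < 1ℤ
      0<1 = +<+ (s≤s ℕ.z≤n)
      sum-P : ∀ us → All _ us → _
      sum-P []       []         = zero∈
      sum-P (u ∷ us) (Pu ∷ Pus) = closed 1ℤ 1ℤ 0≤1 0≤1 Pu (sum-P us Pus)
      cover : ∀ us → All _ us → ∀ a → Any (λ u → 0ℤ < u a) us → 0ℤ < sum us a
      cover (u ∷ us) (Pu ∷ Pus) a (here 0<ua) =
        +-mono-<-≤ (0<a*b 0<1 0<ua) (0≤a*b 0≤1 (nonneg (sum-P us Pus) a))
      cover (u ∷ us) (Pu ∷ Pus) a (there any) =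
        +-mono-≤-< (0≤a*b 0≤1 (nonneg Pu a)) (0<a*b 0<1 (cover us Pus a any))
    stiemke (f ∷ fs) cone us Pus with empty? (Step.pos cone f fs us Pus) | empty? (Step.neg cone f fs us Pus)
    -- If `f` takes only one strict sign on the generators, then `f` or its negative already
    -- separates. The negative is written as a combination with second coefficient 0.
    ... | inj₁ (p , p∈) | inj₂ ¬neg = inj₂
      ( apply f , generator (here refl)
      , (λ u∈ → ≮⇒≥ λ Fu<0 → ¬neg (∈-filter⁺ (λ u → apply f u <? 0ℤ) u∈ Fu<0))
      , p , Step.pos⁻ cone f fs us Pus p∈ )
    ... | inj₂ ¬pos | inj₁ (q , q∈) = inj₂
      ( _ , combined -1ℤ 0ℤ (generator (here refl)) (generator (here refl))
      , (λ {u} u∈ → subst (0ℤ ≤_) (lemma (apply f u))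
          (neg-mono-≤ (≮⇒≥ λ 0<Fu → ¬pos (∈-filter⁺ (λ u → 0ℤ <? apply f u) u∈ 0<Fu))))
      , q , proj₁ (Step.neg⁻ cone f fs us Pus q∈)
      , subst (0ℤ <_) (lemma (apply f q)) (neg-mono-< (proj₂ (Step.neg⁻ cone f fs us Pus q∈))) )
      where
      lemma : ∀ a → - a ≡ -1ℤ * a + 0ℤ * a
      lemma = solve-∀
    ... | inj₁ p | inj₁ q with stiemke fs (face f cone) (Step.us′ cone f fs us Pus) (Step.Pus′ cone f fs us Pus)
    ...   | inj₁ x = inj₁ (Step.feasible cone f fs us Pus (λ _ → q) (λ _ → p) x)
    ...   | inj₂ g = inj₂ (Step.separated cone f fs us Pus p g)
    stiemke (f ∷ fs) cone us Pus | inj₂ ¬pos | inj₂ ¬neg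
      with stiemke fs (face f cone) (Step.us′ cone f fs us Pus) (Step.Pus′ cone f fs us Pus)
    ...   | inj₁ x = inj₁ (Step.feasible cone f fs us Pus
                       (λ u∈ → contradiction u∈ ¬pos) (λ u∈ → contradiction u∈ ¬neg) x)
    ...   | inj₂ g = inj₂ (Step.separated-all-zero cone f fs us Pus
                       (λ u∈ → ≤-antisym (≮⇒≥ λ 0<Fu → ¬pos (∈-filter⁺ (λ u → 0ℤ <? apply f u) u∈ 0<Fu))
                                         (≮⇒≥ λ Fu<0 → ¬neg (∈-filter⁺ (λ u → apply f u <? 0ℤ) u∈ Fu<0))) g)

-- Loads of integer weights and the folding of complements

module Loads where

  open import Defs using (subsets)
  open Counting
  open IntegerLinearAlgebra
  open import Data.Bool using (Bool; true; false; if_then_else_)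
  import Data.Bool.Properties as Bool
  open import Data.Fin using (Fin; zero; suc)
  open import Data.Fin.Subset using (Subset; inside; outside; ∁)
  open import Data.Integer hiding (suc; pred; pos; neg; _⊔_; _⊓_)
  open import Data.Integer.Properties
  open import Data.Integer.Tactic.RingSolver using (solve-∀)
  open import Data.List using (List; []; _∷_; _++_; map)
  open import Data.List.Membership.Propositional using (_∈_; _∉_)
  open import Data.List.Relation.Unary.All as All using (All; []; _∷_)
  open import Data.List.Relation.Unary.AllPairs using ([]; _∷_)
  open import Data.List.Relation.Unary.Any using (here; there)
  open import Data.List.Relation.Unary.Unique.Propositional using (Unique)
  open import Data.Nat as ℕ using (ℕ; zero; suc)
  open import Data.Vec using ([]; _∷_; lookup)
  import Data.Vec.Properties as Vec
  open import Function using (_∘_)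
  open import Relation.Binary.Definitions using (DecidableEquality)
  open import Relation.Binary.PropositionalEquality
  open import Relation.Nullary using (yes; no; contradiction; Dec)

  infix 4 _≟ˢ_

  _≟ˢ_ : ∀ {n} → DecidableEquality (Subset n)
  _≟ˢ_ = Vec.≡-dec Bool._≟_

  ∑ : ∀ {A : Set} → List A → (A → ℤ) → ℤ
  ∑ []       f = 0ℤ
  ∑ (x ∷ xs) f = f x + ∑ xs f

  module _ {A : Set} where

    ∑-cong : ∀ (xs : List A) {f g} → (∀ {x} → x ∈ xs → f x ≡ g x) → ∑ xs f ≡ ∑ xs g
    ∑-cong []       _  = refl
    ∑-cong (x ∷ xs) eq = cong₂ _+_ (eq (here refl)) (∑-cong xs (eq ∘ there))

    ∑-linear : ∀ (xs : List A) a b f g →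
      ∑ xs (λ x → a * f x + b * g x) ≡ a * ∑ xs f + b * ∑ xs g
    ∑-linear []       a b f g = sym (a*0+b*0≡0 a b refl refl)
    ∑-linear (x ∷ xs) a b f g =
      trans (cong (λ t → a * f x + b * g x + t) (∑-linear xs a b f g))
            (lemma a b (f x) (g x) (∑ xs f) (∑ xs g))
      where
      lemma : ∀ a b p q r s →
        a * p + b * q + (a * r + b * s) ≡ a * (p + r) + b * (q + s)
      lemma = solve-∀

    ∑-++ : ∀ (xs {ys} : List A) f → ∑ (xs ++ ys) f ≡ ∑ xs f + ∑ ys f
    ∑-++ []            f = sym (+-identityˡ _)
    ∑-++ (x ∷ xs) {ys} f =
      trans (cong (λ t → f x + t) (∑-++ xs f)) (sym (+-assoc (f x) (∑ xs f) (∑ ys f)))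

    ∑-zero : ∀ (xs : List A) {f} → (∀ x → f x ≡ 0ℤ) → ∑ xs f ≡ 0ℤ
    ∑-zero []       eq = refl
    ∑-zero (x ∷ xs) eq = cong₂ _+_ (eq x) (∑-zero xs eq)

    ∑-nonneg : ∀ (xs : List A) {f} → (∀ x → 0ℤ ≤ f x) → 0ℤ ≤ ∑ xs f
    ∑-nonneg []       _   = ≤-refl
    ∑-nonneg (x ∷ xs) f≥0 = +-mono-≤ (f≥0 x) (∑-nonneg xs f≥0)

    ∑-positive : ∀ (xs : List A) {f} → (∀ x → 0ℤ ≤ f x) → ∀ {x} → x ∈ xs → 0ℤ < f x →
      0ℤ < ∑ xs f
    ∑-positive (x ∷ xs) f≥0 (here refl) 0<fx = +-mono-<-≤ 0<fx (∑-nonneg xs f≥0)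
    ∑-positive (x ∷ xs) f≥0 (there x∈)  0<fx = +-mono-≤-< (f≥0 x) (∑-positive xs f≥0 x∈ 0<fx)

  ∑-map : ∀ {A B : Set} (xs : List A) (h : A → B) f → ∑ (map h xs) f ≡ ∑ xs (f ∘ h)
  ∑-map []       h f = refl
  ∑-map (x ∷ xs) h f = cong (λ t → f (h x) + t) (∑-map xs h f)

  total : ∀ {n} → (Subset n → ℤ) → ℤ
  total {n} = ∑ (subsets n)

  total-suc : ∀ {n} (f : Subset (suc n) → ℤ) →
    total f ≡ total (λ S → f (outside ∷ S)) + total (λ S → f (inside ∷ S))
  total-suc {n} f = trans (∑-++ (map (outside ∷_) (subsets n)) f)
    (cong₂ _+_ (∑-map (subsets n) (outside ∷_) f) (∑-map (subsets n) (inside ∷_) f))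

  total-cong : ∀ {n} {f g : Subset n → ℤ} → (∀ S → f S ≡ g S) → total f ≡ total g
  total-cong {n} eq = ∑-cong (subsets n) (λ {S} _ → eq S)

  total-∁ : ∀ {n} (f : Subset n → ℤ) → total (f ∘ ∁) ≡ total f
  total-∁ {zero}  f = refl
  total-∁ {suc n} f = begin
    total (f ∘ ∁)
      ≡⟨ total-suc (f ∘ ∁) ⟩
    total ((λ S → f (inside ∷ S)) ∘ ∁) + total ((λ S → f (outside ∷ S)) ∘ ∁)
      ≡⟨ cong₂ _+_ (total-∁ (λ S → f (inside ∷ S))) (total-∁ (λ S → f (outside ∷ S))) ⟩
    total (λ S → f (inside ∷ S)) + total (λ S → f (outside ∷ S))
      ≡⟨ +-comm (total (λ S → f (inside ∷ S))) (total (λ S → f (outside ∷ S))) ⟩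
    total (λ S → f (outside ∷ S)) + total (λ S → f (inside ∷ S))
      ≡⟨ total-suc f ⟨
    total f ∎
    where open ≡-Reasoning

  ∁-involutive : ∀ {n} (S : Subset n) → ∁ (∁ S) ≡ S
  ∁-involutive []      = refl
  ∁-involutive (b ∷ S) = cong₂ _∷_ (Bool.not-involutive b) (∁-involutive S)

  total-single : ∀ {n} (U : Subset n) {f} → (∀ S → S ≢ U → f S ≡ 0ℤ) → total f ≡ f U
  total-single []            {f} off = +-identityʳ (f [])
  total-single {suc n} (outside ∷ U) {f} off = begin
    total f                          ≡⟨ total-suc f ⟩
    total (λ S → f (outside ∷ S)) + total (λ S → f (inside ∷ S))
                                     ≡⟨ cong₂ _+_ (total-single U λ S S≢U → off (outside ∷ S) (S≢U ∘ ∷-injectiveʳ))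
                                                  (∑-zero (subsets n) λ S → off (inside ∷ S) λ ()) ⟩
    f (outside ∷ U) + 0ℤ             ≡⟨ +-identityʳ (f (outside ∷ U)) ⟩
    f (outside ∷ U)                  ∎
    where open ≡-Reasoning
  total-single {suc n} (inside ∷ U)  {f} off = begin
    total f                          ≡⟨ total-suc f ⟩
    total (λ S → f (outside ∷ S)) + total (λ S → f (inside ∷ S))
                                     ≡⟨ cong₂ _+_ (∑-zero (subsets n) λ S → off (outside ∷ S) λ ())
                                                  (total-single U λ S S≢U → off (inside ∷ S) (S≢U ∘ ∷-injectiveʳ)) ⟩
    0ℤ + f (inside ∷ U)              ≡⟨ +-identityˡ (f (inside ∷ U)) ⟩
    f (inside ∷ U)                   ∎
    where open ≡-Reasoning

  total-support : ∀ {n} (L : List (Subset n)) → Unique L → ∀ {f} →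
    (∀ S → S ∉ L → f S ≡ 0ℤ) → total f ≡ ∑ L f
  total-support {n} []      _          off = ∑-zero (subsets n) λ S → off S λ ()
  total-support {n} (U ∷ L) (U∉ ∷ L!) {f} off = begin
    total f                           ≡⟨ total-cong (λ S → split S (S ≟ˢ U)) ⟩
    total (λ S → 1ℤ * h S + 1ℤ * g S) ≡⟨ ∑-linear (subsets n) 1ℤ 1ℤ h g ⟩
    1ℤ * total h + 1ℤ * total g       ≡⟨ cong₂ _+_ (*-identityˡ (total h)) (*-identityˡ (total g)) ⟩
    total h + total g                 ≡⟨ cong₂ _+_ (total-single U (λ S S≢U → h-off S S≢U (S ≟ˢ U)))
                                           (total-support L L! (λ S S∉L → g-off S S∉L (S ≟ˢ U))) ⟩
    h U + ∑ L g                       ≡⟨ cong₂ _+_ (h-at (U ≟ˢ U))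
                                           (∑-cong L λ {S} S∈ → g-at S (λ { refl → All.lookup U∉ S∈ refl }) (S ≟ˢ U)) ⟩
    f U + ∑ L f                       ∎
    where
    open ≡-Reasoning
    -- f is split into its part at `U` and the rest. The decision is an argument so that each case
    -- computes even though the sums evaluate it at every `S`.
    h′ g′ : ∀ S → Dec (S ≡ U) → ℤ
    h′ S (yes _) = f S
    h′ S (no _)  = 0ℤ
    g′ S (yes _) = 0ℤ
    g′ S (no _)  = f S
    h g : Subset n → ℤ
    h S = h′ S (S ≟ˢ U)
    g S = g′ S (S ≟ˢ U)
    split : ∀ S d → f S ≡ 1ℤ * h′ S d + 1ℤ * g′ S d
    split S (yes _) = sym (trans (+-identityʳ (1ℤ * f S)) (*-identityˡ (f S)))
    split S (no _)  = sym (trans (+-identityˡ (1ℤ * f S)) (*-identityˡ (f S)))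
    h-off : ∀ S → S ≢ U → ∀ d → h′ S d ≡ 0ℤ
    h-off S S≢U (yes S≡U) = contradiction S≡U S≢U
    h-off S S≢U (no _)    = refl
    g-off : ∀ S → S ∉ L → ∀ d → g′ S d ≡ 0ℤ
    g-off S S∉L (yes _)  = refl
    g-off S S∉L (no S≢U) = off S λ { (here S≡U) → S≢U S≡U ; (there S∈) → S∉L S∈ }
    h-at : ∀ d → h′ U d ≡ f U
    h-at (yes _)   = refl
    h-at (no U≢U)  = contradiction refl U≢U
    g-at : ∀ S → U ≢ S → ∀ d → g′ S d ≡ f S
    g-at S U≢S (yes S≡U) = contradiction (sym S≡U) U≢S
    g-at S U≢S (no _)    = refl

  χ : ∀ {n} → Subset n → Fin n → ℤ
  χ S i = if lookup S i then 1ℤ else 0ℤ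

  χ-∁ : ∀ {n} (S : Subset n) i → χ (∁ S) i ≡ 1ℤ - χ S i
  χ-∁ (inside  ∷ S) zero    = refl
  χ-∁ (outside ∷ S) zero    = refl
  χ-∁ (_ ∷ S)       (suc i) = χ-∁ S i

  χ-nonneg : ∀ {n} (S : Subset n) i → 0ℤ ≤ χ S i
  χ-nonneg S i with lookup S i
  ... | true  = +≤+ ℕ.z≤n
  ... | false = +≤+ ℕ.z≤n

  load : ∀ {n} → (Subset n → ℤ) → Fin n → ℤ
  load x i = total (λ S → x S * χ S i)

  load-linear : ∀ {n} a b (x y : Subset n → ℤ) i →
    load (λ S → a * x S + b * y S) i ≡ a * load x i + b * load y i
  load-linear {n} a b x y i =
    trans (total-cong λ S → lemma a b (x S) (y S) (χ S i))
          (∑-linear (subsets n) a b (λ S → x S * χ S i) (λ S → y S * χ S i))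
    where
    lemma : ∀ a b p q c → (a * p + b * q) * c ≡ a * (p * c) + b * (q * c)
    lemma = solve-∀

  load-positive : ∀ {n} {x : Subset n → ℤ} → (∀ S → 0ℤ ≤ x S) →
    ∀ {S i} → lookup S i ≡ inside → 0ℤ < x S → 0ℤ < load x i
  load-positive {n} {x} x≥0 {S} {i} i∈S 0<xS =
    ∑-positive (subsets n) (λ S → 0≤a*b (x≥0 S) (χ-nonneg S i)) (∈-subsets S)
      (subst (λ b → 0ℤ < x S * (if b then 1ℤ else 0ℤ)) (sym i∈S)
        (subst (0ℤ <_) (sym (*-identityʳ (x S))) 0<xS))

  -- The pair {S, ∁ S} is represented by its member avoiding 0.
  signed : ∀ {m} → (Subset (suc m) → ℤ) → Subset m → ℤ
  signed x s = x (outside ∷ s) - x (inside ∷ ∁ s)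

  -- A set containing 0 has indicator 1 minus that of its complement. The ones add up to the load at
  -- 0, and the remainder is the negative half of `signed x`. Equal loads thus become a relation
  -- among vectors of ℤᵐ.
  load-suc : ∀ {m} (x : Subset (suc m) → ℤ) j →
    load x (suc j) ≡ load x zero + load (signed x) j
  load-suc {m} x j = begin
    load x (suc j)
      ≡⟨ total-suc (λ S → x S * χ S (suc j)) ⟩
    A + total (λ s → p s * χ s j)
      ≡⟨ cong (λ t → A + t) (total-∁ (λ s → p s * χ s j)) ⟨
    A + total (λ s → p (∁ s) * χ (∁ s) j)
      ≡⟨ cong (λ t → A + t) (trans (total-cong λ s → trans (cong (λ t → p (∁ s) * t) (χ-∁ s j)) (lemma₁ (p (∁ s)) (χ s j)))
                                   (∑-linear (subsets m) 1ℤ -1ℤ (p ∘ ∁) (λ s → p (∁ s) * χ s j))) ⟩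
    A + (1ℤ * total (p ∘ ∁) + -1ℤ * C)
      ≡⟨ cong (λ t → A + (1ℤ * t + -1ℤ * C)) (trans (total-∁ p) (sym load-zero)) ⟩
    A + (1ℤ * load x zero + -1ℤ * C)
      ≡⟨ lemma₂ A (load x zero) C ⟩
    load x zero + (1ℤ * A + -1ℤ * C)
      ≡⟨ cong (λ t → load x zero + t) (trans (total-cong λ s → lemma₃ (x (outside ∷ s)) (p (∁ s)) (χ s j))
                                             (∑-linear (subsets m) 1ℤ -1ℤ _ _)) ⟨
    load x zero + load (signed x) j ∎
    where
    open ≡-Reasoning
    p : Subset m → ℤ
    p s = x (inside ∷ s)
    A C : ℤ
    A = total (λ s → x (outside ∷ s) * χ s j)
    C = total (λ s → p (∁ s) * χ s j)
    load-zero : load x zero ≡ total p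
    load-zero = begin
      load x zero
        ≡⟨ total-suc (λ S → x S * χ S zero) ⟩
      total (λ s → x (outside ∷ s) * 0ℤ) + total (λ s → p s * 1ℤ)
        ≡⟨ cong₂ _+_ (∑-zero (subsets m) λ s → *-zeroʳ (x (outside ∷ s)))
                     (total-cong λ s → *-identityʳ (p s)) ⟩
      0ℤ + total p
        ≡⟨ +-identityˡ (total p) ⟩
      total p ∎
    lemma₁ : ∀ p c → p * (1ℤ - c) ≡ 1ℤ * p + -1ℤ * (p * c)
    lemma₁ = solve-∀
    lemma₂ : ∀ a l c → a + (1ℤ * l + -1ℤ * c) ≡ l + (1ℤ * a + -1ℤ * c)
    lemma₂ = solve-∀
    lemma₃ : ∀ a p c → (a - p) * c ≡ 1ℤ * (a * c) + -1ℤ * (p * c)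
    lemma₃ = solve-∀

-- Structure of minimal collections with integer weights

module MinimalCollections where

  open import Defs using (Collection; _∈ᶜ_; _∉ᶜ_; _⊂ᶜ_; _⊆ᶜ_; subsets)
  open Counting
  open IntegerLinearAlgebra
  open Loads
  open import Data.Bool using (Bool; true; false; T; if_then_else_)
  open import Data.Bool.Properties using (T?)
  open import Data.Fin using (Fin; zero; suc)
  import Data.Fin.Properties as Fin
  open import Data.Fin.Subset using (Subset; inside; outside; ∁)
  open import Data.Integer hiding (suc; pred; pos; neg; _⊔_; _⊓_)
  open import Data.Integer.Properties
  open import Data.Integer.Tactic.RingSolver using (solve-∀)
  open import Data.List using (List; []; _∷_; map; filterᵇ; length; allFin)
  import Data.List as List
  open import Data.List.Properties using (length-map; length-tabulate)
  open import Data.List.Membership.Propositional using (_∈_; _∉_; find; lose)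
  open import Data.List.Membership.Propositional.Properties
  open import Data.List.Relation.Unary.All as All using (All; []; _∷_)
  open import Data.List.Relation.Unary.Any using (any?)
  open import Data.List.Relation.Unary.Unique.Propositional using (Unique)
  import Data.List.Relation.Unary.Unique.Propositional.Properties as Unique
  open import Data.Nat as ℕ using (ℕ; zero; suc; s≤s)
  import Data.Nat.Properties as ℕ
  open import Data.Product using (∃; ∃₂; _×_; _,_; proj₂)
  open import Data.Sum using (_⊎_; inj₁; inj₂; [_,_]′)
  open import Data.Vec using ([]; _∷_; lookup)
  open import Function using (_∘_)
  open import Relation.Binary.PropositionalEquality
  open import Relation.Nullary using (¬_; yes; no; contradiction; Dec; does; ⌊_⌋)
  open import Relation.Nullary.Decidable using (toWitness; fromWitness; _×-dec_; decidable-stable)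
  import Data.Bool.Properties as Bool

  private
    variable
      m n : ℕ

  a*b>0⇒b>0 : ∀ a b → 0ℤ ≤ a → 0ℤ < a * b → 0ℤ < b
  a*b>0⇒b>0 a b 0≤a 0<ab with 0ℤ <? b
  ... | yes 0<b = 0<b
  ... | no  b≯0 = contradiction 0<ab (≤⇒≯ (subst (a * b ≤_) (*-zeroʳ a)
                    (*-monoˡ-≤-nonNeg a {{nonNegative 0≤a}} (≮⇒≥ b≯0))))

  -- The ratio of u to x is -b/a throughout. One coordinate with `u₁` positive shows that it is
  -- positive, which settles every coordinate where x is positive.
  same-sign : ∀ a b u₁ x₁ u x → 0ℤ < a → 0ℤ ≤ x₁ → 0ℤ < u₁ → 0ℤ < x →
    a * u₁ + b * x₁ ≡ 0ℤ → a * u + b * x ≡ 0ℤ → 0ℤ < u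
  same-sign a b u₁ x₁ u x 0<a 0≤x₁ 0<u₁ 0<x eq₁ eq =
    a*b>0⇒b>0 a u (<⇒≤ 0<a) (subst (0ℤ <_) (move u x eq) (0<a*b {a = - b} {b = x} 0<-b 0<x))
    where
    lemma : ∀ a b u x → (- b) * x ≡ a * u + - (a * u + b * x)
    lemma = solve-∀
    move : ∀ u x → a * u + b * x ≡ 0ℤ → (- b) * x ≡ a * u
    move u x eq = trans (lemma a b u x)
      (trans (cong (λ t → a * u + - t) eq) (+-identityʳ (a * u)))
    0<-b : 0ℤ < - b
    0<-b = a*b>0⇒b>0 x₁ (- b) 0≤x₁
      (subst (0ℤ <_) (trans (sym (move u₁ x₁ eq₁)) (*-comm (- b) x₁)) (0<a*b {a = a} {b = u₁} 0<a 0<u₁))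

  only-zero : ∀ a b l₁ l u x → 0ℤ < a → 0ℤ < l → l₁ ≡ 0ℤ →
    a * l₁ + b * l ≡ 0ℤ → a * u + b * x ≡ 0ℤ → u ≡ 0ℤ
  only-zero a b l₁ l u x 0<a 0<l refl eq₁ eq
    with i*j≡0⇒i≡0∨j≡0 b (trans (sym (trans (cong (λ t → t + b * l) (*-zeroʳ a)) (+-identityˡ (b * l)))) eq₁)
  ... | inj₂ l≡0  = contradiction (sym l≡0) (<⇒≢ 0<l)
  ... | inj₁ refl with i*j≡0⇒i≡0∨j≡0 a (trans (sym (+-identityʳ (a * u))) eq)
  ...   | inj₁ a≡0 = contradiction (sym a≡0) (<⇒≢ 0<a)
  ...   | inj₂ u≡0 = u≡0

  members : Collection n → List (Subset n)
  members {n} Φ = filterᵇ Φ (subsets n)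

  ∈-members : ∀ {Φ : Collection n} {S} → S ∈ᶜ Φ → S ∈ members Φ
  ∈-members {Φ = Φ} {S} S∈ = ∈-filter⁺ (T? ∘ Φ) (∈-subsets S) S∈

  members-∈ : ∀ {Φ : Collection n} {S} → S ∈ members Φ → S ∈ᶜ Φ
  members-∈ {n} {Φ} S∈ = proj₂ (∈-filter⁻ (T? ∘ Φ) {xs = subsets n} S∈)

  members-unique : (Φ : Collection n) → Unique (members Φ)
  members-unique {n} Φ = Unique.filter⁺ (T? ∘ Φ) (subsets-unique n)

  δ : Subset n → Subset n → ℤ
  δ U S = if does (S ≟ˢ U) then 1ℤ else 0ℤ

  δ-diag : (U : Subset n) → δ U U ≡ 1ℤ
  δ-diag U with U ≟ˢ U
  ... | yes _   = refl
  ... | no U≢U = contradiction refl U≢U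

  δ-off : (U S : Subset n) → S ≢ U → δ U S ≡ 0ℤ
  δ-off U S S≢U with S ≟ˢ U
  ... | yes S≡U = contradiction S≡U S≢U
  ... | no _    = refl

  δ-nonneg : (U S : Subset n) → 0ℤ ≤ δ U S
  δ-nonneg U S with does (S ≟ˢ U)
  ... | true  = +≤+ ℕ.z≤n
  ... | false = +≤+ ℕ.z≤n

  load-δ : (U : Subset n) → ∀ i → load (δ U) i ≡ χ U i
  load-δ U i = trans
    (total-single U (λ S S≢U → cong (_* χ S i) (δ-off U S S≢U)))
    (trans (cong (_* χ U i) (δ-diag U)) (*-identityˡ (χ U i)))

  open Elimination

  load-functional : Fin n → Functional {Subset n}
  load-functional {n} i = record
    { apply  = λ x → load x i
    ; linear = λ a b x y → load-linear a b x y i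
    ; null   = ∑-zero (subsets n) λ _ → refl
    }

  -- The n loads are n linear conditions on the more than n vectors `δ U`. As `L` has no
  -- repetitions, `U` itself serves as the private coordinate of `δ U` in the elimination.
  relation : (L : List (Subset n)) → Unique L → n ℕ.< length L →
    ∃ λ z → (∀ S → S ∉ L → z S ≡ 0ℤ) × (∃ λ S → z S ≢ 0ℤ) × (∀ i → load z i ≡ 0ℤ)
  relation {n} L L! n<L
    with z , z-off , z≢0 , vanish ← dependent
      (map load-functional (allFin n)) {P = λ z → ∀ S → S ∉ L → z S ≡ 0ℤ}
      (record { closed = λ a b u-off v-off S S∉ → a*0+b*0≡0 a b (u-off S S∉) (v-off S S∉) })
      (λ i → δ (List.lookup L i)) (List.lookup L)
      (λ i S S∉ → δ-off (List.lookup L i) S λ { refl → S∉ (∈-lookup i) })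
      (λ i eq → contradiction (trans (sym (δ-diag (List.lookup L i))) eq) λ ())
      (λ i j i≢j → δ-off (List.lookup L i) (List.lookup L j) λ eq → i≢j (sym (lookup-injective sym L! eq)))
      (subst (ℕ._< length L) (sym (trans (length-map _ (allFin n)) (length-tabulate _))) n<L)
    = z , z-off , z≢0 , λ i → All.lookup vanish (∈-map⁺ load-functional (∈-allFin i))

  EqualLoads : (Subset (suc m) → ℤ) → Set
  EqualLoads x = ∀ i → load x i ≡ load x zero

  equalLoads-combine : ∀ a b {x y : Subset (suc m) → ℤ} → EqualLoads x → EqualLoads y →
    EqualLoads (combine a b x y)
  equalLoads-combine a b {x} {y} ex ey i = begin
    load (combine a b x y) i         ≡⟨ load-linear a b x y i ⟩
    a * load x i + b * load y i      ≡⟨ cong₂ (λ s t → a * s + b * t) (ex i) (ey i) ⟩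
    a * load x zero + b * load y zero ≡⟨ load-linear a b x y zero ⟨
    load (combine a b x y) zero      ∎
    where open ≡-Reasoning

  signed⇒equalLoads : (x : Subset (suc m) → ℤ) → (∀ j → load (signed x) j ≡ 0ℤ) → EqualLoads x
  signed⇒equalLoads x eq zero    = refl
  signed⇒equalLoads x eq (suc j) =
    trans (load-suc x j) (trans (cong (λ t → load x zero + t) (eq j)) (+-identityʳ (load x zero)))

  equalLoads⇒signed : (x : Subset (suc m) → ℤ) → EqualLoads x → ∀ j → load (signed x) j ≡ 0ℤ
  equalLoads⇒signed x eq j = trans (lemma (load x zero) (load (signed x) j))
    (i≡j⇒i-j≡0 (trans (sym (load-suc x j)) (eq (suc j))))
    where
    lemma : ∀ a b → b ≡ a + b - a
    lemma = solve-∀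

  -- Homogeneous integer form of balancedness: any common positive load replaces load 1. Extending
  -- the weights by 0 outside Φ turns its loads into sums over all subsets, so weights of different
  -- collections can be combined.
  record Weights (Φ : Collection (suc m)) : Set where
    field
      weight   : Subset (suc m) → ℤ
      positive-on : ∀ {S} → S ∈ᶜ Φ → 0ℤ < weight S
      zero-off : ∀ {S} → S ∉ᶜ Φ → weight S ≡ 0ℤ
      level    : 0ℤ < load weight zero
      equal    : EqualLoads weight

    nonneg : ∀ S → 0ℤ ≤ weight S
    nonneg S with T? (Φ S)
    ... | yes S∈ = <⇒≤ (positive-on S∈)
    ... | no  S∉ = ≤-reflexive (sym (zero-off S∉))

    positive⇒∈ : ∀ {S} → 0ℤ < weight S → S ∈ᶜ Φ
    positive⇒∈ {S} 0<x = decidable-stable (T? (Φ S)) λ S∉ → <⇒≢ 0<x (sym (zero-off S∉))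

    inhabited : ∃ λ S → S ∈ᶜ Φ
    inhabited with any? (T? ∘ Φ) (subsets (suc m))
    ... | yes any = let S , _ , S∈ = find any in S , S∈
    ... | no none = contradiction level (≤⇒≯ (≤-reflexive
            (∑-zero (subsets (suc m)) λ S →
              cong (_* χ S zero) (zero-off λ S∈ → none (lose (∈-subsets S) S∈)))))

  open Weights

  support : (Subset n → ℤ) → Collection n
  support x S = ⌊ 0ℤ <? x S ⌋

  support-weights : (x : Subset (suc m) → ℤ) → (∀ S → 0ℤ ≤ x S) → 0ℤ < load x zero → EqualLoads x →
    Weights (support x)
  support-weights x x≥0 0<load eq = record
    { weight      = x
    ; positive-on = toWitness
    ; zero-off    = λ S∉ → ≤-antisym (≮⇒≥ (S∉ ∘ fromWitness)) (x≥0 _)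
    ; level       = 0<load
    ; equal       = eq
    }

  weights-cong : {Φ Ψ : Collection (suc m)} → (∀ S → Φ S ≡ Ψ S) → Weights Φ → Weights Ψ
  weights-cong eq W = record
    { weight      = weight W
    ; positive-on = λ {S} S∈ → positive-on W (subst T (sym (eq S)) S∈)
    ; zero-off    = λ {S} S∉ → zero-off W (S∉ ∘ subst T (eq S))
    ; level       = level W
    ; equal       = equal W
    }

  record Minimal (Φ : Collection (suc m)) : Set where
    field
      weights : Weights Φ
      minimal : ∀ Ψ → Ψ ⊂ᶜ Φ → ¬ Weights Ψ

    x : Subset (suc m) → ℤ
    x = weight weights

    -- Cancelling the weight of an empty set changes no load, so a minimal collection cannot contain
    -- one.
    ∅∉ : ∀ {S} → S ∈ᶜ Φ → ∃ λ i → lookup S i ≡ inside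
    ∅∉ {S} S∈ with Fin.any? (λ i → lookup S i Bool.≟ inside)
    ... | yes found = found
    ... | no  empty = contradiction
      (support-weights x′ x′≥0 (subst (0ℤ <_) (sym (load-x′ zero)) (level weights))
        (λ i → trans (load-x′ i) (trans (equal weights i) (sym (load-x′ zero)))))
      (minimal (support x′)
        ( (λ U U∈ → positive⇒∈ weights (bounded U (U ≟ˢ S) (toWitness U∈)))
        , S , S∈ , λ S∈′ → <⇒≢ (toWitness S∈′) (sym (at-S (S ≟ˢ S)))))
      where
      x″ : ∀ U → Dec (U ≡ S) → ℤ
      x″ U (yes _) = 0ℤ
      x″ U (no _)  = x U
      x′ : Subset (suc m) → ℤ
      x′ U = x″ U (U ≟ˢ S)
      x′≥0 : ∀ U → 0ℤ ≤ x′ U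
      x′≥0 U with U ≟ˢ S
      ... | yes _ = ≤-refl
      ... | no  _ = nonneg weights U
      bounded : ∀ U d → 0ℤ < x″ U d → 0ℤ < x U
      bounded U (yes _) 0<0 = contradiction refl (<⇒≢ 0<0)
      bounded U (no _)  0<x = 0<x
      at-S : ∀ d → x″ S d ≡ 0ℤ
      at-S (yes _)  = refl
      at-S (no S≢S) = contradiction refl S≢S
      χ-S : ∀ i → χ S i ≡ 0ℤ
      χ-S i with lookup S i in eq
      ... | true  = contradiction (i , eq) empty
      ... | false = refl
      load-x′ : ∀ i → load x′ i ≡ load x i
      load-x′ i = total-cong λ U → same U (U ≟ˢ S)
        where
        same : ∀ U d → x″ U d * χ U i ≡ x U * χ U i
        same U (yes refl) = sym (trans (cong (x U *_) (χ-S i)) (*-zeroʳ (x U)))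
        same U (no _)     = refl

    -- Otherwise the support of `v` would be a proper subcollection with weights. Its common load is
    -- positive because a member where `v` is positive has an element.
    vanishing : ∀ {v S₀} → (∀ S → 0ℤ ≤ v S) → (∀ {S} → S ∉ᶜ Φ → v S ≡ 0ℤ) → EqualLoads v →
      S₀ ∈ᶜ Φ → v S₀ ≡ 0ℤ → ∀ S → v S ≡ 0ℤ
    vanishing {v} {S₀} v≥0 v-off eq S₀∈ vS₀≡0 S with T? (Φ S) | 0ℤ <? v S
    ... | no S∉  | _       = v-off S∉
    ... | yes _  | no v≯0  = ≤-antisym (≮⇒≥ v≯0) (v≥0 S)
    ... | yes S∈ | yes 0<v with i , i∈S ← ∅∉ S∈ = contradiction
      (support-weights v v≥0 (subst (0ℤ <_) (eq i) (load-positive v≥0 {S} i∈S 0<v)) eq)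
      (minimal (support v)
        ( (λ U U∈ → decidable-stable (T? (Φ U)) λ U∉ → <⇒≢ (toWitness U∈) (sym (v-off U∉)))
        , S₀ , S₀∈ , λ S₀∈′ → <⇒≢ (toWitness S₀∈′) (sym vS₀≡0)))

    -- Subtracting from u the largest multiple of x that keeps it nonnegative
    -- creates a zero inside Φ.
    proportional : ∀ {u} → (∀ {S} → S ∉ᶜ Φ → u S ≡ 0ℤ) → EqualLoads u →
      ∃₂ λ a b → 0ℤ < a × (∀ S → a * u S + b * x S ≡ 0ℤ)
    proportional {u} u-off eq
      with S₀ , S₀∈ , least ← argmin u x (members Φ)
             (let S , S∈ = inhabited weights in S , ∈-members S∈)
             (positive-on weights ∘ members-∈)
      = x S₀ , - u S₀ , positive-on weights (members-∈ S₀∈)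
      , vanishing v≥0 v-off (equalLoads-combine (x S₀) (- u S₀) eq (equal weights))
          (members-∈ S₀∈) (lemma₁ (x S₀) (u S₀))
      where
      lemma₁ : ∀ a b → a * b + (- b) * a ≡ 0ℤ
      lemma₁ = solve-∀
      lemma₂ : ∀ p q r s → p * q + - (r * s) ≡ q * p + (- r) * s
      lemma₂ = solve-∀
      v : Subset (suc m) → ℤ
      v = combine (x S₀) (- u S₀) u x
      v-off : ∀ {S} → S ∉ᶜ Φ → v S ≡ 0ℤ
      v-off S∉ = a*0+b*0≡0 (x S₀) (- u S₀) (u-off S∉) (zero-off weights S∉)
      v≥0 : ∀ S → 0ℤ ≤ v S
      v≥0 S with T? (Φ S)
      ... | no  S∉ = ≤-reflexive (sym (v-off S∉))
      ... | yes S∈ = subst (0ℤ ≤_) (lemma₂ (u S) (x S₀) (u S₀) (x S))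
                       (i≤j⇒0≤j-i (least (∈-members S∈)))

    positive-everywhere : ∀ {u} → (∀ {S} → S ∉ᶜ Φ → u S ≡ 0ℤ) → EqualLoads u →
      ∀ {S₁} → 0ℤ < u S₁ → ∀ {S} → S ∈ᶜ Φ → 0ℤ < u S
    positive-everywhere {u} u-off eq {S₁} 0<u {S} S∈ =
      let a , b , 0<a , prop = proportional u-off eq in
      same-sign a b (u S₁) (x S₁) (u S) (x S) 0<a (nonneg weights S₁) 0<u (positive-on weights S∈)
        (prop S₁) (prop S)

    -- Proportional to weights of positive load, `u` can have load 0 only as the zero multiple. The
    -- characteristic vectors of the members are thus linearly independent, which caps their number
    -- at m+1.
    independent : ∀ {u} → (∀ {S} → S ∉ᶜ Φ → u S ≡ 0ℤ) → (∀ i → load u i ≡ 0ℤ) → ∀ S → u S ≡ 0ℤ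
    independent {u} u-off loads≡0 S =
      let a , b , 0<a , prop = proportional u-off (λ i → trans (loads≡0 i) (sym (loads≡0 zero))) in
      only-zero a b (load u zero) (load x zero) (u S) (x S) 0<a (level weights) (loads≡0 zero)
        (trans (sym (load-linear a b u x zero))
               (∑-zero (subsets (suc m)) λ S → cong (_* χ S zero) (prop S)))
        (prop S)

    length-members : length (members Φ) ℕ.≤ suc m
    length-members = ℕ.≮⇒≥ λ lt →
      let z , z-off , (S , z≢0) , loads = relation (members Φ) (members-unique Φ) lt
      in z≢0 (independent (λ {U} U∉ → z-off U (U∉ ∘ members-∈)) loads S)

    -- Weight 1 on `S` and on `∁ S` already gives all loads equal to 1. By proportionality such
    -- weights are positive on all of Φ, so no third member is left.
    complementary-pair : ∀ {S} → S ∈ᶜ Φ → ∁ S ∈ᶜ Φ → ∀ {U} → U ∈ᶜ Φ → U ≡ S ⊎ U ≡ ∁ S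
    complementary-pair {S} S∈ ∁S∈ {U} U∈ with U ≟ˢ S | U ≟ˢ ∁ S
    ... | yes U≡S | _         = inj₁ U≡S
    ... | no _    | yes U≡∁S  = inj₂ U≡∁S
    ... | no U≢S  | no U≢∁S   = contradiction
      (sym (a*0+b*0≡0 1ℤ 1ℤ (δ-off S U U≢S) (δ-off (∁ S) U U≢∁S)))
      (<⇒≢ (positive-everywhere pair-off pair-equal {S} pair-S U∈))
      where
      pair : Subset (suc m) → ℤ
      pair = combine 1ℤ 1ℤ (δ S) (δ (∁ S))
      pair-off : ∀ {V} → V ∉ᶜ Φ → pair V ≡ 0ℤ
      pair-off {V} V∉ = a*0+b*0≡0 1ℤ 1ℤ (δ-off S V λ { refl → V∉ S∈ }) (δ-off (∁ S) V λ { refl → V∉ ∁S∈ })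
      pair-loads : ∀ i → load pair i ≡ 1ℤ
      pair-loads i = begin
        load pair i                                   ≡⟨ load-linear 1ℤ 1ℤ (δ S) (δ (∁ S)) i ⟩
        1ℤ * load (δ S) i + 1ℤ * load (δ (∁ S)) i     ≡⟨ cong₂ (λ s t → 1ℤ * s + 1ℤ * t) (load-δ S i)
                                                          (trans (load-δ (∁ S) i) (χ-∁ S i)) ⟩
        1ℤ * χ S i + 1ℤ * (1ℤ - χ S i)                ≡⟨ lemma (χ S i) ⟩
        1ℤ                                            ∎
        where
        open ≡-Reasoning
        lemma : ∀ c → 1ℤ * c + 1ℤ * (1ℤ - c) ≡ 1ℤ
        lemma = solve-∀
      pair-equal : EqualLoads pair
      pair-equal i = trans (pair-loads i) (sym (pair-loads zero))
      pair-S : 0ℤ < pair S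
      pair-S = +-mono-<-≤ {0ℤ} {1ℤ * δ S S} {0ℤ} {1ℤ * δ (∁ S) S}
        (subst (0ℤ <_) (sym (trans (*-identityˡ (δ S S)) (δ-diag S))) (+<+ (s≤s ℕ.z≤n)))
        (subst (0ℤ ≤_) (sym (*-identityˡ (δ (∁ S) S))) (δ-nonneg (∁ S) S))

  open Minimal

  minimal-⊆ : {Φ Ψ : Collection (suc m)} → Minimal Φ → Minimal Ψ → Φ ⊆ᶜ Ψ → ∀ S → Φ S ≡ Ψ S
  minimal-⊆ {Φ = Φ} {Ψ} M N Φ⊆Ψ S with Φ S in p | Ψ S in q
  ... | true  | true  = refl
  ... | false | false = refl
  ... | true  | false = contradiction (subst T q (Φ⊆Ψ S (subst T (sym p) _))) λ ()
  ... | false | true  = contradiction (weights M)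
    (minimal N Φ (Φ⊆Ψ , S , subst T (sym q) _ , λ S∈ → subst T p S∈))

  PairFree : Collection n → Set
  PairFree Φ = ∀ S → S ∈ᶜ Φ → ∁ S ∉ᶜ Φ

  -- Moving the weights of Ψ over to Φ, with the sign changed on the sets that
  -- have to be complemented, gives a relation on Φ; it is a multiple of the
  -- weights of Φ, and the common set S₁ shows that no sign was changed.
  transported-⊆ : {Φ Ψ : Collection (suc m)} → Minimal Φ → Minimal Ψ → PairFree Φ → PairFree Ψ →
    (∀ S → S ∈ᶜ Ψ → S ∈ᶜ Φ ⊎ ∁ S ∈ᶜ Φ) → ∀ {S₁} → S₁ ∈ᶜ Φ → S₁ ∈ᶜ Ψ → Φ ⊆ᶜ Ψ
  transported-⊆ {m} {Φ} {Ψ} M N Φ-free Ψ-free Ψ→Φ {S₁} S₁∈Φ S₁∈Ψ S S∈ =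
    positive⇒∈ (weights N) (≤-<-trans (nonneg (weights N) (∁ S))
      (0<j-i⇒i<j (y (∁ S)) (y S)
        (subst (0ℤ <_) (u-on S∈) (positive-everywhere M u-off u-equal 0<uS₁ S∈))))
    where
    0<j-i⇒i<j : ∀ i j → 0ℤ < j - i → i < j
    0<j-i⇒i<j i j lt = subst₂ _<_ (+-identityˡ i) (lemma i j) (+-monoˡ-< i lt)
      where
      lemma : ∀ i j → j - i + i ≡ j
      lemma = solve-∀
    y = x N
    u : Subset (suc m) → ℤ
    u S = if Φ S then y S - y (∁ S) else 0ℤ
    u-on : ∀ {S} → S ∈ᶜ Φ → u S ≡ y S - y (∁ S)
    u-on {S} S∈ with true ← Φ S = refl
    u-off : ∀ {S} → S ∉ᶜ Φ → u S ≡ 0ℤ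
    u-off {S} S∉ with Φ S
    ... | true  = contradiction _ S∉
    ... | false = refl
    0<uS₁ : 0ℤ < u S₁
    0<uS₁ = subst (0ℤ <_) (sym (trans (u-on S₁∈Φ)
      (trans (cong (λ t → y S₁ - t) (zero-off (weights N) (Ψ-free S₁ S₁∈Ψ))) (+-identityʳ (y S₁)))))
      (positive-on (weights N) S₁∈Ψ)
    -- Φ has at most one set of each class, and `u` puts the whole signed weight of the class there.
    -- A class missing from Φ is missing from Ψ, where both sides are 0.
    same : ∀ s → signed u s ≡ signed y s
    same s with T? (Φ (outside ∷ s)) | T? (Φ (inside ∷ ∁ s))
    ... | yes p | yes q = contradiction q (Φ-free _ p)
    ... | yes p | no  q = trans (cong₂ _-_ (u-on p) (u-off q)) (+-identityʳ (signed y s))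
    ... | no  p | yes q = trans (cong₂ _-_ (u-off p) (u-on q))
      (trans (lemma (y (inside ∷ ∁ s)) (y (outside ∷ ∁ (∁ s))))
             (cong (λ t → y (outside ∷ t) - y (inside ∷ ∁ s)) (∁-involutive s)))
      where
      lemma : ∀ a b → 0ℤ - (a - b) ≡ b - a
      lemma = solve-∀
    ... | no  p | no  q = trans (cong₂ _-_ (u-off p) (u-off q)) (sym (cong₂ _-_
      (zero-off (weights N) λ ∈Ψ → [ p , q ]′ (Ψ→Φ _ ∈Ψ))
      (zero-off (weights N) λ ∈Ψ → [ q , p ∘ subst (λ t → (outside ∷ t) ∈ᶜ Φ) (∁-involutive s) ]′ (Ψ→Φ _ ∈Ψ))))
    u-equal : EqualLoads u
    u-equal = signed⇒equalLoads u λ j →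
      trans (total-cong λ s → cong (_* χ s j) (same s)) (equalLoads⇒signed y (equal (weights N)) j)

  pair-or-free : (Φ : Collection (suc m)) → (∃ λ S → S ∈ᶜ Φ × ∁ S ∈ᶜ Φ) ⊎ PairFree Φ
  pair-or-free {m} Φ with any? (λ S → T? (Φ S) ×-dec T? (Φ (∁ S))) (subsets (suc m))
  ... | yes any = inj₁ (let S , _ , p = find any in S , p)
  ... | no none = inj₂ λ S S∈ ∁S∈ → none (lose (∈-subsets S) (S∈ , ∁S∈))

  pair-⊇ : {Φ Ψ : Collection (suc m)} → Minimal Φ → ∀ {S} → S ∈ᶜ Φ → ∁ S ∈ᶜ Φ →
    (∀ U → U ∈ᶜ Ψ → U ∈ᶜ Φ ⊎ ∁ U ∈ᶜ Φ) → Ψ ⊆ᶜ Φ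
  pair-⊇ {Φ = Φ} M {S} S∈ ∁S∈ Ψ→Φ U U∈ with Ψ→Φ U U∈
  ... | inj₁ U∈Φ  = U∈Φ
  ... | inj₂ ∁U∈Φ with complementary-pair M S∈ ∁S∈ ∁U∈Φ
  ...   | inj₁ ∁U≡S  = subst (_∈ᶜ Φ) (trans (cong ∁ (sym ∁U≡S)) (∁-involutive U)) ∁S∈
  ...   | inj₂ ∁U≡∁S = subst (_∈ᶜ Φ)
    (trans (sym (∁-involutive S)) (trans (cong ∁ (sym ∁U≡∁S)) (∁-involutive U))) S∈

  -- A minimal collection with a complementary pair consists of that pair, hence includes any
  -- collection with the same classes. If neither has such a pair, transporting weights gives an
  -- inclusion. Inclusions between minimal collections are equalities.
  determined : {Φ Ψ : Collection (suc m)} → Minimal Φ → Minimal Ψ →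
    (∀ S → S ∈ᶜ Φ → S ∈ᶜ Ψ ⊎ ∁ S ∈ᶜ Ψ) → (∀ S → S ∈ᶜ Ψ → S ∈ᶜ Φ ⊎ ∁ S ∈ᶜ Φ) →
    ∀ {S₁} → S₁ ∈ᶜ Φ → S₁ ∈ᶜ Ψ → ∀ S → Φ S ≡ Ψ S
  determined {Φ = Φ} {Ψ} M N Φ→Ψ Ψ→Φ S₁∈Φ S₁∈Ψ with pair-or-free Φ | pair-or-free Ψ
  ... | inj₁ (S , S∈ , ∁S∈) | _ = λ U → sym (minimal-⊆ N M (pair-⊇ M S∈ ∁S∈ Ψ→Φ) U)
  ... | inj₂ _ | inj₁ (S , S∈ , ∁S∈) = minimal-⊆ M N (pair-⊇ N S∈ ∁S∈ Φ→Ψ)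
  ... | inj₂ Φ-free | inj₂ Ψ-free =
    minimal-⊆ M N (transported-⊆ M N Φ-free Ψ-free Ψ→Φ S₁∈Φ S₁∈Ψ)

-- From real to integer weights and back

module RealWeights where

  open import Defs hiding (_≃_)
  open Counting
  open Rationals
  open IntegerLinearAlgebra
  open Loads
  open MinimalCollections
  open import Data.Bool using (Bool; true; false; if_then_else_)
  import Data.Bool.Properties as Bool
  open import Data.Bool.Properties using (T?)
  open import Data.Empty using (⊥)
  open import Data.Fin using (Fin; zero; suc)
  open import Data.Fin.Subset using (Subset; inside; outside)
  open import Data.Fin.Subset.Properties using (_∈?_)
  open import Data.Integer as ℤ using (ℤ; 0ℤ; 1ℤ; -1ℤ)
  import Data.Integer.Properties as ℤ
  import Data.Integer.Tactic.RingSolver as ℤ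
  open import Data.List using (List; []; _∷_; map; foldr; allFin)
  open import Data.List.Membership.Propositional using (_∈_; find; lose)
  open import Data.List.Membership.Propositional.Properties
  open import Data.List.Relation.Unary.All as All using (All; []; _∷_)
  import Data.List.Relation.Unary.All.Properties as All
  open import Data.List.Relation.Unary.Any using (here; there; any?)
  open import Data.Nat as ℕ using (ℕ; zero; suc)
  import Data.Nat.Properties as ℕ
  open import Data.Product using (∃; _×_; _,_; proj₁; proj₂)
  open import Data.Rational
  open import Data.Rational.Properties
  open import Data.Rational.Solver using (module +-*-Solver)
  open import Data.Sum as Sum using (_⊎_; inj₁; inj₂; [_,_]′)
  open import Data.Vec using ([]; _∷_; lookup)
  open import Function using (_∘_)
  open import Relation.Binary.PropositionalEquality
  open import Relation.Nullary using (¬_; yes; no; contradiction; Dec; does)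
  open import Relation.Nullary.Decidable using (_×-dec_)

  open Elimination
  open Weights

  private
    variable
      m n : ℕ

  ∑ℚ : ∀ {A : Set} → List A → (A → ℚ) → ℚ
  ∑ℚ []       f = 0ℚ
  ∑ℚ (x ∷ xs) f = f x + ∑ℚ xs f

  module _ {A : Set} where

    ∑ℚ-cong : ∀ (xs : List A) {f g} → (∀ x → f x ≡ g x) → ∑ℚ xs f ≡ ∑ℚ xs g
    ∑ℚ-cong []       eq = refl
    ∑ℚ-cong (x ∷ xs) eq = cong₂ _+_ (eq x) (∑ℚ-cong xs eq)

    ∑ℚ-linear : ∀ (xs : List A) (v : A → ℚ) a b (g h : A → ℤ) →
      ∑ℚ xs (λ x → v x * ι (a ℤ.* g x ℤ.+ b ℤ.* h x))
        ≡ ι a * ∑ℚ xs (λ x → v x * ι (g x)) + ι b * ∑ℚ xs (λ x → v x * ι (h x))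
    ∑ℚ-linear []       v a b g h = sym (trans (cong₂ _+_ (*-zeroʳ (ι a)) (*-zeroʳ (ι b))) refl)
    ∑ℚ-linear (x ∷ xs) v a b g h = trans
      (cong₂ (λ s t → v x * s + t)
        (trans (ι-+ (a ℤ.* g x) (b ℤ.* h x)) (cong₂ _+_ (ι-* a (g x)) (ι-* b (h x))))
        (∑ℚ-linear xs v a b g h))
      (lemma (v x) (ι a) (ι b) (ι (g x)) (ι (h x))
        (∑ℚ xs (λ x → v x * ι (g x))) (∑ℚ xs (λ x → v x * ι (h x))))
      where
      open +-*-Solver
      lemma : ∀ v a b g h r s →
        v * (a * g + b * h) + (a * r + b * s) ≡ a * (v * g + r) + b * (v * h + s)
      lemma = solve 7 (λ v a b g h r s →
        v :* (a :* g :+ b :* h) :+ (a :* r :+ b :* s) := a :* (v :* g :+ r) :+ b :* (v :* h :+ s)) refl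

    ∑ℚ-scaled : ∀ (xs : List A) r (f g : A → ℤ) →
      ∑ℚ xs (λ x → ι (f x) * r * ι (g x)) ≡ r * ι (∑ xs (λ x → f x ℤ.* g x))
    ∑ℚ-scaled []       r f g = sym (*-zeroʳ r)
    ∑ℚ-scaled (x ∷ xs) r f g = begin
      ι (f x) * r * ι (g x) + ∑ℚ xs (λ x → ι (f x) * r * ι (g x))
        ≡⟨ cong (ι (f x) * r * ι (g x) +_) (∑ℚ-scaled xs r f g) ⟩
      ι (f x) * r * ι (g x) + r * ι Σ
        ≡⟨ lemma (ι (f x)) r (ι (g x)) (ι Σ) ⟩
      r * (ι (f x) * ι (g x) + ι Σ)
        ≡⟨ cong (λ t → r * (t + ι Σ)) (ι-* (f x) (g x)) ⟨
      r * (ι (f x ℤ.* g x) + ι Σ)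
        ≡⟨ cong (r *_) (ι-+ (f x ℤ.* g x) Σ) ⟨
      r * ι (f x ℤ.* g x ℤ.+ Σ) ∎
      where
      open ≡-Reasoning
      Σ = ∑ xs (λ x → f x ℤ.* g x)
      open +-*-Solver
      lemma : ∀ f r g s → f * r * g + r * s ≡ r * (f * g + s)
      lemma = solve 4 (λ f r g s → f :* r :* g :+ r :* s := r :* (f :* g :+ s)) refl

    ∑ℚ-nonneg : ∀ (xs : List A) {f} → (∀ {x} → x ∈ xs → 0ℚ ≤ f x) → 0ℚ ≤ ∑ℚ xs f
    ∑ℚ-nonneg []       _   = ≤-refl
    ∑ℚ-nonneg (x ∷ xs) f≥0 = +-mono-≤ (f≥0 (here refl)) (∑ℚ-nonneg xs (f≥0 ∘ there))

    term≤∑ℚ : ∀ (xs : List A) {f} → (∀ {x} → x ∈ xs → 0ℚ ≤ f x) →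
      ∀ {x} → x ∈ xs → f x ≤ ∑ℚ xs f
    term≤∑ℚ (x ∷ xs) {f} f≥0 (here refl) = subst (_≤ f x + ∑ℚ xs f) (+-identityʳ (f x))
      (+-monoʳ-≤ (f x) (∑ℚ-nonneg xs (f≥0 ∘ there)))
    term≤∑ℚ (y ∷ xs) {f} f≥0 {x} (there x∈) = subst (_≤ f y + ∑ℚ xs f) (+-identityˡ (f x))
      (+-mono-≤ (f≥0 (here refl)) (term≤∑ℚ xs (f≥0 ∘ there) x∈))

  seq-∑ : ∀ {A : Set} (xs : List A) (f : A → ℝ) k →
    seq (foldr _+ℝ_ 0ℝ (map f xs)) k ≡ ∑ℚ xs (λ x → seq (f x) k)
  seq-∑ []       f k = refl
  seq-∑ (x ∷ xs) f k = cong (seq (f x) k +_) (seq-∑ xs f k)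

  does-∈? : ∀ (S : Subset n) i → does (i ∈? S) ≡ lookup S i
  does-∈? (inside  ∷ S) zero    = refl
  does-∈? (outside ∷ S) zero    = refl
  does-∈? (_ ∷ S)       (suc i) = does-∈? S i

  seq-𝟏 : ∀ (S : Subset n) i k → seq (𝟏[ S ] i) k ≡ ι (χ S i)
  seq-𝟏 S i k rewrite does-∈? S i with lookup S i
  ... | true  = refl
  ... | false = refl

  seq-load : ∀ (Φ : Collection n) (w : Subset n → ℝ) i k →
    seq (∑[ Φ ] (λ S → w S *ℝ 𝟏[ S ] i)) k ≡ ∑ℚ (members Φ) (λ S → seq (w S) k * ι (χ S i))
  seq-load Φ w i k = trans (seq-∑ (members Φ) (λ S → w S *ℝ 𝟏[ S ] i) k)
    (∑ℚ-cong (members Φ) λ S → cong (seq (w S) k *_) (seq-𝟏 S i k))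

  0<a*b′ : ∀ {a b} → 0ℚ < a → 0ℚ < b → 0ℚ < a * b
  0<a*b′ {a} {b} 0<a 0<b =
    positive⁻¹ (a * b) {{pos*pos⇒pos a {{positive 0<a}} b {{positive 0<b}}}}

  p≤∣p∣ : ∀ p → p ≤ ∣ p ∣
  p≤∣p∣ p with ≤-total 0ℚ p
  ... | inj₁ 0≤p = ≤-reflexive (sym (0≤p⇒∣p∣≡p 0≤p))
  ... | inj₂ p≤0 = ≤-trans p≤0 (0≤∣p∣ p)

  -- Division by the common load gives constant sequences whose load is exactly 1.
  weights⇒balanced : {Φ : Collection (suc m)} → Weights Φ → Balanced Φ
  weights⇒balanced {m} {Φ} W = w , w-pos , w-sum
    where
    x = weight W
    μ = ι (load x zero)
    0<μ : 0ℚ < μ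
    0<μ = ι-mono-< (level W)
    instance
      _ = positive 0<μ
      _ = pos⇒nonZero μ
    r = 1/ μ
    0<r : 0ℚ < r
    0<r = positive⁻¹ r {{1/pos⇒pos μ}}
    w : Subset (suc m) → ℝ
    w S = fromℚ (ι (x S) * r)
    w-pos : ∀ S → S ∈ᶜ Φ → 0ℝ <ℝ w S
    w-pos S S∈ = ι (x S) * r , 0<a*b′ (ι-mono-< (positive-on W S∈)) 0<r ,
      0 , λ _ _ → ≤-reflexive (+-identityˡ (ι (x S) * r))
    w-sum : ∀ i → ∑[ Φ ] (λ S → w S *ℝ 𝟏[ S ] i) Defs.≃ 1ℝ
    w-sum i ε 0<ε = 0 , λ k _ → subst (_< ε) (sym (cong (λ t → ∣ t - 1ℚ ∣) (sum≡1 k))) 0<ε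
      where
      sum≡1 : ∀ k → seq (∑[ Φ ] (λ S → w S *ℝ 𝟏[ S ] i)) k ≡ 1ℚ
      sum≡1 k = begin
        seq (∑[ Φ ] (λ S → w S *ℝ 𝟏[ S ] i)) k
          ≡⟨ seq-load Φ w i k ⟩
        ∑ℚ (members Φ) (λ S → ι (x S) * r * ι (χ S i))
          ≡⟨ ∑ℚ-scaled (members Φ) r x (λ S → χ S i) ⟩
        r * ι (∑ (members Φ) (λ S → x S ℤ.* χ S i))
          ≡⟨ cong (λ t → r * ι t) (total-support (members Φ) (members-unique Φ)
               λ S S∉ → cong (ℤ._* χ S i) (zero-off W (S∉ ∘ ∈-members))) ⟨
        r * ι (load x i)
          ≡⟨ cong (λ t → r * ι t) (equal W i) ⟩
        r * μ
          ≡⟨ *-inverseˡ μ ⟩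
        1ℚ ∎
        where open ≡-Reasoning

  Null : (ℕ → ℚ) → Set
  Null f = ∀ ε → 0ℚ < ε → ∃ λ N → ∀ k → N ℕ.≤ k → ∣ f k ∣ < ε

  Null-cong : ∀ {f g} → (∀ k → f k ≡ g k) → Null f → Null g
  Null-cong eq null ε 0<ε with N , p ← null ε 0<ε =
    N , λ k k≥N → subst (λ t → ∣ t ∣ < ε) (eq k) (p k k≥N)

  Null-+ : ∀ {f g} → Null f → Null g → Null (λ k → f k + g k)
  Null-+ {f} {g} nf ng ε 0<ε
    with M , p ← nf (½ * ε) (0<a*b′ {½} (positive⁻¹ ½) 0<ε)
    with N , q ← ng (½ * ε) (0<a*b′ {½} (positive⁻¹ ½) 0<ε)
    = M ℕ.⊔ N , λ k k≥ → begin-strict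
      ∣ f k + g k ∣        ≤⟨ ∣p+q∣≤∣p∣+∣q∣ (f k) (g k) ⟩
      ∣ f k ∣ + ∣ g k ∣    <⟨ +-mono-< (p k (ℕ.m⊔n≤o⇒m≤o M N k≥)) (q k (ℕ.m⊔n≤o⇒n≤o M N k≥)) ⟩
      ½ * ε + ½ * ε        ≡⟨ *-distribʳ-+ ε ½ ½ ⟨
      1ℚ * ε               ≡⟨ *-identityˡ ε ⟩
      ε                    ∎
    where open ≤-Reasoning

  Null-* : ∀ c {f} → Null f → Null (λ k → c * f k)
  Null-* c {f} null ε 0<ε = N , λ k k≥N → begin-strict
    ∣ c * f k ∣      ≡⟨ ∣p*q∣≡∣p∣*∣q∣ c (f k) ⟩
    ∣ c ∣ * ∣ f k ∣  ≤⟨ *-monoʳ-≤-nonNeg ∣ f k ∣ {{nonNegative (0≤∣p∣ (f k))}} ∣c∣≤K ⟩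
    K * ∣ f k ∣      <⟨ *-monoʳ-<-pos K (proj₂ small k k≥N) ⟩
    K * (1/ K * ε)   ≡⟨ *-assoc K (1/ K) ε ⟨
    K * 1/ K * ε     ≡⟨ cong (_* ε) (*-inverseʳ K) ⟩
    1ℚ * ε           ≡⟨ *-identityˡ ε ⟩
    ε                ∎
    where
    open ≤-Reasoning
    K = 1ℚ + ∣ c ∣
    instance
      _ : Positive K
      _ = pos+nonNeg⇒pos 1ℚ ∣ c ∣ {{nonNegative (0≤∣p∣ c)}}
      _ : NonZero K
      _ = pos⇒nonZero K
    ∣c∣≤K : ∣ c ∣ ≤ K
    ∣c∣≤K = subst (_≤ K) (+-identityˡ ∣ c ∣) (+-monoˡ-≤ ∣ c ∣ (<⇒≤ (positive⁻¹ 1ℚ)))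
    small = null (1/ K * ε) (0<a*b′ (positive⁻¹ (1/ K) {{1/pos⇒pos K}}) 0<ε)
    N = proj₁ small

  shift : ∀ p q → ι 1ℤ * (p - 1ℚ) + ι -1ℤ * (q - 1ℚ) ≡ ι 1ℤ * p + ι -1ℤ * q
  shift p q = trans (lemma (ι 1ℤ) (ι -1ℤ) 1ℚ p q) (+-identityʳ (ι 1ℤ * p + ι -1ℤ * q))
    where
    open +-*-Solver
    lemma : ∀ a b c p q → a * (p - c) + b * (q - c) ≡ a * p + b * q + (- ((a + b) * c))
    lemma = solve 5 (λ a b c p q →
      a :* (p :- c) :+ b :* (q :- c) := a :* p :+ b :* q :+ (:- ((a :+ b) :* c))) refl

  difference : Fin (suc m) → Functional {Subset (suc m)}
  difference {m} i = record
    { apply  = λ x → load x i ℤ.- load x zero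
    ; linear = λ a b x y → trans
        (cong₂ ℤ._-_ (load-linear a b x y i) (load-linear a b x y zero))
        (lemma a b (load x i) (load y i) (load x zero) (load y zero))
    ; null   = cong₂ ℤ._-_ (null (load-functional i)) (null (load-functional {suc m} zero))
    }
    where
    lemma : ∀ a b p q r s → a ℤ.* p ℤ.+ b ℤ.* q ℤ.- (a ℤ.* r ℤ.+ b ℤ.* s)
      ≡ a ℤ.* (p ℤ.- r) ℤ.+ b ℤ.* (q ℤ.- s)
    lemma = ℤ.solve-∀

  χ-difference : ∀ (S : Subset (suc m)) i →
    1ℤ ℤ.* χ S i ℤ.+ -1ℤ ℤ.* χ S zero ≡ apply (difference i) (δ S)
  χ-difference S i = trans (lemma (χ S i) (χ S zero))
    (sym (cong₂ ℤ._-_ (load-δ S i) (load-δ S zero)))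
    where
    lemma : ∀ p q → 1ℤ ℤ.* p ℤ.+ -1ℤ ℤ.* q ≡ p ℤ.- q
    lemma = ℤ.solve-∀

  differences : ∀ m → List (Functional {Subset (suc m)})
  differences m = map difference (allFin (suc m))

  Separation : Collection (suc m) → Set
  Separation {m} Φ = Separated (differences m) (map δ (members Φ))

  -- Paired with the real weights, the certificate tends to 0, for it is a combination of load
  -- differences and all loads tend to 1. Its coefficients on the members are nonnegative integers,
  -- one of them at least 1, so the pairing eventually stays above the positive gap ε of that
  -- member's weight.
  separation⇒¬balanced : {Φ : Collection (suc m)} → Separation Φ → ¬ Balanced Φ
  separation⇒¬balanced {m} {Φ} (g , g∈ , g≥0 , u₁ , u₁∈ , 0<gu₁) (w , w-pos , w-sum) =
    let S₁ , S₁∈ , eq = ∈-map⁻ δ u₁∈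
    in absurd S₁∈ (subst (λ u → 0ℤ ℤ.< g u) eq 0<gu₁)
    where
    open ≤-Reasoning
    v : Subset (suc m) → ℕ → ℚ
    v S = seq (w S)
    pairing : ((Subset (suc m) → ℤ) → ℤ) → ℕ → ℚ
    pairing g k = ∑ℚ (members Φ) (λ S → v S k * ι (g (δ S)))
    loadℚ : Fin (suc m) → ℕ → ℚ
    loadℚ i k = ∑ℚ (members Φ) (λ S → v S k * ι (χ S i))
    null-load : ∀ i → Null (λ k → loadℚ i k - 1ℚ)
    null-load i = Null-cong {λ k → seq (∑[ Φ ] (λ S → w S *ℝ 𝟏[ S ] i)) k - 1ℚ} {λ k → loadℚ i k - 1ℚ} (λ k → cong (_- 1ℚ) (seq-load Φ w i k)) (w-sum i)
    pairing-difference : ∀ i k →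
      ι 1ℤ * (loadℚ i k - 1ℚ) + ι -1ℤ * (loadℚ zero k - 1ℚ) ≡ pairing (apply (difference i)) k
    pairing-difference i k =
      trans (shift (loadℚ i k) (loadℚ zero k))
      (trans (sym (∑ℚ-linear (members Φ) (λ S → v S k) 1ℤ -1ℤ (λ S → χ S i) (λ S → χ S zero)))
             (∑ℚ-cong (members Φ) λ S → cong (λ t → v S k * ι t) (χ-difference S i)))
    null-difference : ∀ i → Null (pairing (apply (difference i)))
    null-difference i =
      Null-cong {λ k → ι 1ℤ * (loadℚ i k - 1ℚ) + ι -1ℤ * (loadℚ zero k - 1ℚ)}
        {pairing (apply (difference i))} (pairing-difference i)
        (Null-+ {λ k → ι 1ℤ * (loadℚ i k - 1ℚ)} {λ k → ι -1ℤ * (loadℚ zero k - 1ℚ)}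
          (Null-* (ι 1ℤ) {λ k → loadℚ i k - 1ℚ} (null-load i))
          (Null-* (ι -1ℤ) {λ k → loadℚ zero k - 1ℚ} (null-load zero)))
    null-span : ∀ {g} → Span (differences m) g → Null (pairing g)
    null-span (generator f∈) =
      let i , _ , eq = ∈-map⁻ difference f∈
      in subst (λ f → Null (pairing (apply f))) (sym eq) (null-difference i)
    null-span (combined a b {g} {h} s t) =
      Null-cong {λ k → ι a * pairing g k + ι b * pairing h k}
        {pairing (λ u → a ℤ.* g u ℤ.+ b ℤ.* h u)}
        (λ k → sym (∑ℚ-linear (members Φ) (λ S → v S k) a b (g ∘ δ) (h ∘ δ)))
        (Null-+ {λ k → ι a * pairing g k} {λ k → ι b * pairing h k}
          (Null-* (ι a) {pairing g} (null-span s)) (Null-* (ι b) {pairing h} (null-span t)))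
    -- A positive real controls its approximations only from some index on, so a common index for
    -- all members is extracted.
    eventually-nonneg : ∀ L → (∀ {S} → S ∈ L → S ∈ᶜ Φ) →
      ∃ λ N → ∀ k → N ℕ.≤ k → ∀ {S} → S ∈ L → 0ℚ ≤ v S k
    eventually-nonneg []      _   = 0 , λ _ _ ()
    eventually-nonneg (U ∷ L) L⊆Φ = M ℕ.⊔ N , both
      where
      η   = proj₁ (w-pos U (L⊆Φ (here refl)))
      0<η = proj₁ (proj₂ (w-pos U (L⊆Φ (here refl))))
      M   = proj₁ (proj₂ (proj₂ (w-pos U (L⊆Φ (here refl)))))
      p : ∀ k → M ℕ.≤ k → 0ℚ + η ≤ v U k
      p   = proj₂ (proj₂ (proj₂ (w-pos U (L⊆Φ (here refl)))))
      N   = proj₁ (eventually-nonneg L (L⊆Φ ∘ there))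
      both : ∀ k → M ℕ.⊔ N ℕ.≤ k → ∀ {S} → S ∈ U ∷ L → 0ℚ ≤ v S k
      both k k≥ (here refl) = ≤-trans (<⇒≤ 0<η)
        (subst (_≤ v U k) (+-identityˡ η) (p k (ℕ.m⊔n≤o⇒m≤o M N k≥)))
      both k k≥ (there S∈)  =
        proj₂ (eventually-nonneg L (L⊆Φ ∘ there)) k (ℕ.m⊔n≤o⇒n≤o M N k≥) S∈
    absurd : ∀ {S₁} → S₁ ∈ members Φ → 0ℤ ℤ.< g (δ S₁) → ⊥
    absurd {S₁} S₁∈ 0<g =
      let ε , 0<ε , N₁ , large = w-pos S₁ (members-∈ S₁∈)
          N₂ , v≥0 = eventually-nonneg (members Φ) members-∈
          N₃ , small = null-span g∈ ε 0<ε
          k  = N₁ ℕ.⊔ (N₂ ℕ.⊔ N₃)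
          k≥N₂N₃ = ℕ.m≤n⊔m N₁ (N₂ ℕ.⊔ N₃)
      in <-irrefl refl (begin-strict
      ε                        ≡⟨ *-identityʳ ε ⟨
      ε * 1ℚ                   ≤⟨ *-monoˡ-≤-nonNeg ε {{nonNegative (<⇒≤ 0<ε)}} (ι-mono-≤ (ℤ.i<j⇒suc[i]≤j 0<g)) ⟩
      ε * ι (g (δ S₁))         ≤⟨ *-monoʳ-≤-nonNeg (ι (g (δ S₁))) {{nonNegative (ι-mono-≤ (ℤ.<⇒≤ 0<g))}}
                                    (subst (_≤ v S₁ k) (+-identityˡ ε) (large k (ℕ.m≤m⊔n N₁ (N₂ ℕ.⊔ N₃)))) ⟩
      v S₁ k * ι (g (δ S₁))    ≤⟨ term≤∑ℚ (members Φ)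
                                    (λ {S} S∈ → subst (_≤ v S k * ι (g (δ S))) (*-zeroʳ (v S k))
                                      (*-monoˡ-≤-nonNeg (v S k)
                                        {{nonNegative (v≥0 k (ℕ.≤-trans (ℕ.m≤m⊔n N₂ N₃) k≥N₂N₃) S∈)}}
                                        (ι-mono-≤ (g≥0 (∈-map⁺ δ S∈))))) S₁∈ ⟩
      pairing g k              ≤⟨ p≤∣p∣ (pairing g k) ⟩
      ∣ pairing g k ∣          <⟨ small k (ℕ.≤-trans (ℕ.m≤n⊔m N₂ N₃) k≥N₂N₃) ⟩
      ε                        ∎)

  -- The load at 0 is constantly 0 and cannot tend to 1. Load differences do not detect this
  -- degenerate case, in which a feasible solution would have level 0, so it is split off
  -- beforehand.
  avoiding⇒¬balanced : {Φ : Collection (suc m)} → (∀ S → S ∈ᶜ Φ → lookup S zero ≡ outside) → ¬ Balanced Φ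
  avoiding⇒¬balanced {m} {Φ} avoid (w , _ , w-sum) =
    <-irrefl refl (subst (λ t → ∣ t - 1ℚ ∣ < 1ℚ)
      (trans (seq-load Φ w zero N) (vanish (members Φ) members-∈)) (proj₂ close N ℕ.≤-refl))
    where
    close = w-sum zero 1ℚ (positive⁻¹ 1ℚ)
    N = proj₁ close
    vanish : ∀ L → (∀ {S} → S ∈ L → S ∈ᶜ Φ) → ∑ℚ L (λ S → seq (w S) N * ι (χ S zero)) ≡ 0ℚ
    vanish []      _   = refl
    vanish (S ∷ L) L⊆Φ = cong₂ _+_
      (trans (cong (λ b → seq (w S) N * ι (if b then 1ℤ else 0ℤ)) (avoid S (L⊆Φ (here refl))))
             (*-zeroʳ (seq (w S) N)))
      (vanish L (L⊆Φ ∘ there))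

  module _ {m} (Φ : Collection (suc m)) where

    Supported : (Subset (suc m) → ℤ) → Set
    Supported u = (∀ S → 0ℤ ℤ.≤ u S) × (∀ S → S ∉ᶜ Φ → u S ≡ 0ℤ)
    supported : Cone Supported
    supported = record
      { nonneg = proj₁
      ; zero∈  = (λ _ → ℤ.≤-refl) , λ _ _ → refl
      ; closed = λ a b 0≤a 0≤b (u≥0 , u-off) (v≥0 , v-off) →
          (λ S → ℤ.+-mono-≤ (0≤a*b 0≤a (u≥0 S)) (0≤a*b 0≤b (v≥0 S))) ,
          (λ S S∉ → a*0+b*0≡0 a b (u-off S S∉) (v-off S S∉))
      }
    δ-supported : All Supported (map δ (members Φ))
    δ-supported = All.map⁺ (All.tabulate λ {U} U∈ →
      δ-nonneg U , λ S S∉ → δ-off U S λ { refl → S∉ (members-∈ U∈) })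

    feasible⇒weights : (∃ λ S → S ∈ᶜ Φ × lookup S zero ≡ inside) →
      Feasible Supported (differences m) (map δ (members Φ)) → Weights Φ
    feasible⇒weights (S , S∈ , 0∈S) (x , (x≥0 , x-off) , cover , vanish) = record
      { weight      = x
      ; positive-on = x-on
      ; zero-off    = λ {S} → x-off S
      ; level       = load-positive x≥0 {S} 0∈S (x-on S∈)
      ; equal       = λ i → ℤ.i-j≡0⇒i≡j (load x i) (load x zero)
                              (All.lookup vanish (∈-map⁺ difference (∈-allFin i)))
      }
      where
      x-on : ∀ {S} → S ∈ᶜ Φ → 0ℤ ℤ.< x S
      x-on {S} S∈ = cover S (lose (∈-map⁺ δ (∈-members S∈))
        (subst (0ℤ ℤ.<_) (sym (δ-diag S)) (ℤ.+<+ (ℕ.s≤s ℕ.z≤n))))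

    meets-zero? : Dec (∃ λ S → S ∈ᶜ Φ × lookup S zero ≡ inside)
    meets-zero? with any? (λ S → T? (Φ S) ×-dec (lookup S zero Bool.≟ inside)) (subsets (suc m))
    ... | no none = no λ (S , p) → none (lose (∈-subsets S) p)
    ... | yes any = yes (let S , _ , p = find any in S , p)

    -- The alternative is computed from Φ alone, with no case distinction on reals. It serves both
    -- to replace real weights by integer ones and to decide minimality.
    decide : Weights Φ ⊎ ¬ Balanced Φ
    decide = fromDec meets-zero?
      where
      fromDec : Dec (∃ λ S → S ∈ᶜ Φ × lookup S zero ≡ inside) → Weights Φ ⊎ ¬ Balanced Φ
      fromDec (no none)   = inj₂ (avoiding⇒¬balanced λ S S∈ → Bool.¬-not λ 0∈S → none (S , S∈ , 0∈S))
      fromDec (yes meets) = Sum.map (feasible⇒weights meets) separation⇒¬balanced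
        (stiemke (differences m) supported (map δ (members Φ)) δ-supported)

  balanced⇒weights : {Φ : Collection (suc m)} → Balanced Φ → Weights Φ
  balanced⇒weights {Φ = Φ} balanced =
    [ (λ W → W) , (λ ¬b → contradiction balanced ¬b) ]′ (decide Φ)

  minimalBalanced⇒minimal : {Φ : Collection (suc m)} → MinimalBalanced Φ → Minimal Φ
  minimalBalanced⇒minimal (balanced , min) = record
    { weights = balanced⇒weights balanced
    ; minimal = λ Ψ Ψ⊂Φ W → min Ψ Ψ⊂Φ (weights⇒balanced W)
    }

  minimal⇒minimalBalanced : {Φ : Collection (suc m)} → Minimal Φ → MinimalBalanced Φ
  minimal⇒minimalBalanced M =
    weights⇒balanced (Minimal.weights M) ,
    λ Ψ Ψ⊂Φ balanced → Minimal.minimal M Ψ Ψ⊂Φ (balanced⇒weights balanced)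

-- Enumerating minimal collections and bounding their number from above

module Censuses where

  open import Defs using (Collection; _∈ᶜ_; _⊂ᶜ_; subsets; MinimalBalanced; NumberOfMinimalBalanced)
  open Counting
  open Loads
  open MinimalCollections
  open RealWeights
  open import Data.Bool using (Bool; true; false; T; _∨_; if_then_else_)
  open import Data.Bool.Properties using (T?)
  import Data.Bool.Properties as Bool
  open import Data.Fin using (Fin)
  open import Data.Fin.Subset using (Subset; inside; outside; ∁)
  open import Data.List using (List; []; _∷_; filter; filterᵇ; length; lookup; tabulate; deduplicate; cartesianProduct; cartesianProductWith)
  open import Data.List.Properties using (length-map; length-tabulate)
  open import Data.List.Membership.Propositional using (_∈_; find; lose)
  open import Data.List.Membership.Propositional.Properties
  open import Data.List.Relation.Unary.All as All using (All; all?)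
  open import Data.List.Relation.Unary.Any as Any using (Any; any?; here; there)
  import Data.List.Relation.Unary.Any.Properties as Any
  open import Data.List.Relation.Unary.Unique.DecSetoid.Properties using (deduplicate-!)
  import Data.List.Relation.Unary.Unique.Propositional.Properties as Unique
  open import Data.Nat using (ℕ; zero; suc; _≤_; _*_)
  open import Data.Nat.Properties using (≤-trans; ≤-reflexive; *-comm)
  open import Data.Product using (∃; _×_; _,_; proj₁; proj₂)
  open import Data.Product.Properties using (,-injectiveˡ; ,-injectiveʳ)
  open import Data.Sum using (_⊎_; inj₁; inj₂; [_,_]′)
  import Data.Sum as Sum
  open import Data.Vec using ([]; _∷_)
  open import Function using (_∘_)
  open import Level using (0ℓ)
  open import Relation.Binary.Bundles using (DecSetoid)
  open import Relation.Binary.PropositionalEquality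
  open import Relation.Nullary using (Dec; yes; no; contradiction; ¬?)
  open import Relation.Nullary.Decidable using (_×-dec_; _→-dec_; map′)
  open import Relation.Unary using (Decidable)

  private
    variable
      m n b : ℕ

  -- Collections are functions, so a list of them without repetition or omission is meant up to
  -- pointwise equality. The bounds are proved for an arbitrary census.
  record Census (m b : ℕ) : Set where
    field
      family    : Fin b → Collection (suc m)
      minimal   : ∀ i → Minimal (family i)
      injective : ∀ {i j} → family i ≗ family j → i ≡ j
      complete  : ∀ {Φ} → Minimal Φ → ∃ λ i → family i ≗ Φ

  census⇒inverse : Census m b → NumberOfMinimalBalanced (suc m) b
  census⇒inverse {m} {b} census = record
    { to        = λ i → family i , minimal⇒minimalBalanced (minimal i)
    ; from      = index
    ; to-cong   = λ { refl _ → refl }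
    ; from-cong = λ {x} {y} eq → injective λ S → trans (index-family x S) (trans (eq S) (sym (index-family y S)))
    ; inverse   = (λ { {x} refl → index-family x })
                , (λ {i} {x} eq → injective λ S → trans (index-family x S) (eq S))
    }
    where
    open Census census
    index : ∃ MinimalBalanced → Fin b
    index (_ , M) = proj₁ (complete (minimalBalanced⇒minimal M))
    index-family : ∀ x → family (index x) ≗ proj₁ x
    index-family (_ , M) = proj₂ (complete (minimalBalanced⇒minimal M))

  glue : Collection n → Collection n → Collection (suc n)
  glue Φ Ψ (outside ∷ S) = Φ S
  glue Φ Ψ (inside  ∷ S) = Ψ S

  collections : ∀ n → List (Collection n)
  collections zero    = (λ _ → true) ∷ (λ _ → false) ∷ []
  collections (suc n) = cartesianProductWith glue (collections n) (collections n)

  collections-complete : (Φ : Collection n) → ∃ λ Ψ → Ψ ∈ collections n × Ψ ≗ Φ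
  collections-complete {zero} Φ with Φ [] in eq
  ... | true  = _ , here refl , λ { [] → sym eq }
  ... | false = _ , there (here refl) , λ { [] → sym eq }
  collections-complete {suc n} Φ =
    let Ψ₀ , Ψ₀∈ , eq₀ = collections-complete (λ S → Φ (outside ∷ S))
        Ψ₁ , Ψ₁∈ , eq₁ = collections-complete (λ S → Φ (inside ∷ S))
    in glue Ψ₀ Ψ₁ , ∈-cartesianProductWith⁺ glue Ψ₀∈ Ψ₁∈ ,
       λ { (outside ∷ S) → eq₀ S ; (inside ∷ S) → eq₁ S }

  module _ {P : Subset n → Set} (P? : Decidable P) where

    all-subsets? : Dec (∀ S → P S)
    all-subsets? = map′ (λ ps S → All.lookup ps (∈-subsets S)) (λ p → All.tabulate λ {S} _ → p S)
                        (all? P? (subsets n))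

    any-subset? : Dec (∃ P)
    any-subset? = map′ (λ any → let S , _ , p = find any in S , p)
                       (λ (S , p) → lose (∈-subsets S) p)
                       (any? P? (subsets n))

  _⊂?_ : (Ψ Φ : Collection n) → Dec (Ψ ⊂ᶜ Φ)
  Ψ ⊂? Φ = all-subsets? (λ S → T? (Ψ S) →-dec T? (Φ S))
           ×-dec any-subset? (λ S → T? (Φ S) ×-dec ¬? (T? (Ψ S)))

  ⊂-respˡ : {Φ Ψ Ψ′ : Collection n} → Ψ′ ≗ Ψ → Ψ ⊂ᶜ Φ → Ψ′ ⊂ᶜ Φ
  ⊂-respˡ eq (Ψ⊆Φ , S , S∈ , S∉) =
    (λ U U∈ → Ψ⊆Φ U (subst T (eq U) U∈)) , S , S∈ , S∉ ∘ subst T (eq S)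

  weights? : (Φ : Collection (suc m)) → Dec (Weights Φ)
  weights? Φ = [ yes , (λ ¬b → no (¬b ∘ weights⇒balanced)) ]′ (decide Φ)

  -- Every Ψ agrees pointwise with an entry of `collections`, and both inclusion and weights depend
  -- only on values, so the quantifier over Ψ reduces to a finite search.
  minimal? : (Φ : Collection (suc m)) → Dec (Minimal Φ)
  minimal? {m} Φ = map′
    (λ (W , none) → record
      { weights = W
      ; minimal = λ Ψ Ψ⊂Φ V →
          let Ψ′ , Ψ′∈ , eq = collections-complete Ψ
          in All.lookup none Ψ′∈ (⊂-respˡ eq Ψ⊂Φ , weights-cong (sym ∘ eq) V) })
    (λ M → Minimal.weights M , All.tabulate λ _ (Ψ⊂Φ , V) → Minimal.minimal M _ Ψ⊂Φ V)
    (weights? Φ ×-dec all? (λ Ψ → ¬? (Ψ ⊂? Φ ×-dec weights? Ψ)) (collections (suc m)))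

  minimal-cong : {Φ Ψ : Collection (suc m)} → Φ ≗ Ψ → Minimal Φ → Minimal Ψ
  minimal-cong eq M = record
    { weights = weights-cong eq (Minimal.weights M)
    ; minimal = λ Θ (Θ⊆Ψ , S , S∈ , S∉) → Minimal.minimal M Θ
        ((λ U U∈ → subst T (sym (eq U)) (Θ⊆Ψ U U∈)) , S , subst T (sym (eq S)) S∈ , S∉)
    }

  collectionDecSetoid : ℕ → DecSetoid 0ℓ 0ℓ
  collectionDecSetoid n = record
    { Carrier          = Collection n
    ; _≈_              = _≗_
    ; isDecEquivalence = record
      { isEquivalence = record
        { refl  = λ _ → refl
        ; sym   = λ eq S → sym (eq S)
        ; trans = λ eq eq′ S → trans (eq S) (eq′ S)
        }
      ; _≟_ = λ Φ Ψ → all-subsets? (λ S → Φ S Bool.≟ Ψ S)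
      }
    }

  census : ∀ m → ∃ (Census m)
  census m = length representatives , record
    { family    = lookup representatives
    ; minimal   = λ i → proj₂ (∈-filter⁻ minimal? {xs = collections (suc m)}
        (∈-deduplicate⁻ _≗?_ (filter minimal? (collections (suc m))) (∈-lookup i)))
    ; injective = lookup-injective (λ eq S → sym (eq S))
        (deduplicate-! (collectionDecSetoid (suc m)) (filter minimal? (collections (suc m))))
    ; complete  = λ {Φ} M →
        let Ψ , Ψ∈ , eq = collections-complete Φ
            found = Any.deduplicate⁺ _≗?_ {P = _≗ Φ} (λ eq eq′ S → trans (eq S) (eq′ S))
              (lose {P = _≗ Φ} (∈-filter⁺ minimal? Ψ∈ (minimal-cong (sym ∘ eq) M)) eq)
        in Any.index found , Any.lookup-index found
    }
    where
    _≗?_ = DecSetoid._≟_ (collectionDecSetoid (suc m))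
    representatives = deduplicate _≗?_ (filter minimal? (collections (suc m)))

  -- The class {S, ∁ S} is named by its member avoiding 0, with that coordinate deleted.
  HasClass : Collection (suc m) → Subset m → Bool
  HasClass Φ s = Φ (outside ∷ s) ∨ Φ (inside ∷ ∁ s)

  class : Subset (suc m) → Subset m
  class (outside ∷ s) = s
  class (inside  ∷ s) = ∁ s

  T-∨ : ∀ {x y} → T (x ∨ y) → T x ⊎ T y
  T-∨ {true}  p = inj₁ p
  T-∨ {false} p = inj₂ p

  ∈⇒hasClass : (Φ : Collection (suc m)) → ∀ S → S ∈ᶜ Φ → T (HasClass Φ (class S))
  ∈⇒hasClass Φ (outside ∷ s) S∈ with true ← Φ (outside ∷ s) = _
  ∈⇒hasClass Φ (inside  ∷ s) S∈ rewrite ∁-involutive s | Bool.∨-comm (Φ (outside ∷ ∁ s)) (Φ (inside ∷ s))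
    with true ← Φ (inside ∷ s) = _

  hasClass⇒∈ : (Φ : Collection (suc m)) → ∀ S → T (HasClass Φ (class S)) → S ∈ᶜ Φ ⊎ ∁ S ∈ᶜ Φ
  hasClass⇒∈ Φ (outside ∷ s) p = T-∨ p
  hasClass⇒∈ Φ (inside  ∷ s) p =
    Sum.swap (Sum.map₂ (subst (λ t → T (Φ (inside ∷ t))) (∁-involutive s)) (T-∨ p))

  classes : Collection (suc m) → List (Subset m)
  classes {m} Φ = filterᵇ (HasClass Φ) (subsets m)

  ∈-classes : (Φ : Collection (suc m)) → ∀ S → S ∈ᶜ Φ → class S ∈ classes Φ
  ∈-classes Φ S S∈ = ∈-filter⁺ (T? ∘ HasClass Φ) (∈-subsets (class S)) (∈⇒hasClass Φ S S∈)

  classes-∈ : (Φ : Collection (suc m)) → ∀ {s} → s ∈ classes Φ → T (HasClass Φ s)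
  classes-∈ {m} Φ s∈ = proj₂ (∈-filter⁻ (T? ∘ HasClass Φ) {xs = subsets m} s∈)

  -- Choosing one member from each class is injective, so there are no more classes than members.
  length-classes : {Φ : Collection (suc m)} → Minimal Φ → length (classes Φ) ≤ suc m
  length-classes {m} {Φ} M = ≤-trans (≤-reflexive (sym (length-map member (classes Φ))))
    (≤-trans (unique-⊆⇒length≤ (Unique.map⁺ member-injective (Unique.filter⁺ (T? ∘ HasClass Φ) (subsets-unique m)))
                λ {S} S∈ → let s , s∈ , eq = ∈-map⁻ member S∈ in
                  subst (_∈ members Φ) (sym eq) (∈-members (member-∈ s (classes-∈ Φ s∈))))
             (Minimal.length-members M))
    where
    member : Subset m → Subset (suc m)
    member s = if Φ (outside ∷ s) then outside ∷ s else inside ∷ ∁ s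
    class-member : ∀ s → class (member s) ≡ s
    class-member s with Φ (outside ∷ s)
    ... | true  = refl
    ... | false = ∁-involutive s
    member-injective : ∀ {s t} → member s ≡ member t → s ≡ t
    member-injective {s} {t} eq = trans (sym (class-member s)) (trans (cong class eq) (class-member t))
    member-∈ : ∀ s → T (HasClass Φ s) → member s ∈ᶜ Φ
    member-∈ s p with Φ (outside ∷ s) in eq
    ... | true  = subst T (sym eq) _
    ... | false = p

  -- A single bit, read at the first class, is enough to choose between the two orientations. The
  -- value at the empty list is a default: a minimal collection has at least one class.
  orientation : Collection (suc m) → List (Subset m) → Bool
  orientation Φ []      = false
  orientation Φ (s ∷ _) = Φ (outside ∷ s)

  code : Collection (suc m) → List (Subset m) × Bool
  code Φ = classes Φ , orientation Φ (classes Φ)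

  -- Equal bits exhibit a common member in the first class: the set avoiding 0 if the bit is `true`,
  -- its complement if the bit is `false`. This is the common set that `determined` asks for.
  code-injective : {Φ Ψ : Collection (suc m)} → Minimal Φ → Minimal Ψ → code Φ ≡ code Ψ → Φ ≗ Ψ
  code-injective {m} {Φ} {Ψ} M N eq = common (classes Φ) refl
    where
    eqᶜ : classes Φ ≡ classes Ψ
    eqᶜ = ,-injectiveˡ eq
    Φ→Ψ : ∀ S → S ∈ᶜ Φ → S ∈ᶜ Ψ ⊎ ∁ S ∈ᶜ Ψ
    Φ→Ψ S S∈ = hasClass⇒∈ Ψ S (classes-∈ Ψ (subst (class S ∈_) eqᶜ (∈-classes Φ S S∈)))
    Ψ→Φ : ∀ S → S ∈ᶜ Ψ → S ∈ᶜ Φ ⊎ ∁ S ∈ᶜ Φ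
    Ψ→Φ S S∈ = hasClass⇒∈ Φ S (classes-∈ Φ (subst (class S ∈_) (sym eqᶜ) (∈-classes Ψ S S∈)))
    common : ∀ K → K ≡ classes Φ → Φ ≗ Ψ
    common [] eqᴷ = let S , S∈ = Weights.inhabited (Minimal.weights M) in
      contradiction (subst (class S ∈_) (sym eqᴷ) (∈-classes Φ S S∈)) λ ()
    common (s ∷ K) eqᴷ = split (Φ (outside ∷ s)) (Ψ (outside ∷ s)) refl refl
      (trans (cong (orientation Φ) eqᴷ) (trans (,-injectiveʳ eq) (cong (orientation Ψ) (trans (sym eqᶜ) (sym eqᴷ)))))
      (classes-∈ Φ s∈Φ) (classes-∈ Ψ (subst (s ∈_) eqᶜ s∈Φ))
      where
      s∈Φ : s ∈ classes Φ
      s∈Φ = subst (s ∈_) eqᴷ (here refl)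
      split : ∀ p q → p ≡ Φ (outside ∷ s) → q ≡ Ψ (outside ∷ s) → Φ (outside ∷ s) ≡ Ψ (outside ∷ s) →
        T (HasClass Φ s) → T (HasClass Ψ s) → Φ ≗ Ψ
      split true  true  p q _  _  _  = determined M N Φ→Ψ Ψ→Φ (subst T p _) (subst T q _)
      split false false p q _  cΦ cΨ = determined M N Φ→Ψ Ψ→Φ
        (subst (λ t → T (t ∨ Φ (inside ∷ ∁ s))) (sym p) cΦ)
        (subst (λ t → T (t ∨ Ψ (inside ∷ ∁ s))) (sym q) cΨ)
      split true  false p q pq _  _  = contradiction (trans p (trans pq (sym q))) λ ()
      split false true  p q pq _  _  = contradiction (trans p (trans pq (sym q))) λ ()

  census-upper : Census m b → b ≤ 2 * length (combinationsUpTo (suc m) (subsets m))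
  census-upper {m} {b} census = ≤-trans (≤-reflexive (sym (length-tabulate codes)))
    (≤-trans (unique-⊆⇒length≤
        (Unique.tabulate⁺ {f = codes} λ {i} {j} eq → injective (code-injective (minimal i) (minimal j) eq))
        λ c∈ → let i , eq = ∈-tabulate⁻ c∈ in subst (_∈ codomain) (sym eq) (codes∈ i))
      (≤-reflexive (trans (length-cartesianProduct (combinationsUpTo (suc m) (subsets m)) bits)
                          (*-comm (length (combinationsUpTo (suc m) (subsets m))) 2))))
    where
    open Census census
    codes : Fin b → List (Subset m) × Bool
    codes i = code (family i)
    bits : List Bool
    bits = true ∷ false ∷ []
    codomain = cartesianProduct (combinationsUpTo (suc m) (subsets m)) bits
    bit∈ : ∀ c → c ∈ bits
    bit∈ true  = here refl
    bit∈ false = there (here refl)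
    small : ∀ {Φ : Collection (suc m)} K → K ≡ classes Φ → Minimal Φ → K ∈ combinationsUpTo (suc m) (subsets m)
    small {Φ} [] eq M = let S , S∈ = Weights.inhabited (Minimal.weights M) in
      contradiction (subst (class S ∈_) (sym eq) (∈-classes Φ S S∈)) λ ()
    small {Φ} (s ∷ K) eq M = ∈-combinationsUpTo {j = length K}
      (subst (λ L → length L ≤ suc m) (sym eq) (length-classes M))
      (subst (λ L → L ∈ combinations (length L) (subsets m)) (sym eq)
        (filterᵇ∈combinations (HasClass Φ) (subsets m)))
    codes∈ : ∀ i → codes i ∈ codomain
    codes∈ i = ∈-cartesianProduct⁺ (small (classes (family i)) refl (minimal i)) (bit∈ _)

-- Circuits over 𝔽₂ and the integer relations on them

module BinaryCircuits where

  open import Defs using (subsets)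
  open Counting
  open Arithmetic using (1+n≤2^n; independentTuples)
  open Loads
  open MinimalCollections using (relation)
  open import Data.Bool using (Bool; true; false; _∧_; _xor_; if_then_else_)
  import Data.Bool.Properties as Bool
  open import Data.Fin using (Fin; zero; suc)
  open import Data.Fin.Subset using (Subset; ⊥)
  open import Data.Integer as ℤ using (ℤ; +_; 0ℤ; 1ℤ; ∣_∣; _%ℕ_; _/ℕ_)
  import Data.Integer.DivMod as ℤ
  import Data.Integer.Properties as ℤ
  import Data.Integer.Tactic.RingSolver as ℤ
  open import Data.List using (List; []; _∷_; _++_; map; filter; length; concatMap)
  open import Data.List.Properties as List using (length-map; length-++)
  open import Data.List.Membership.Propositional using (_∈_; _∉_; find)
  open import Data.List.Membership.Propositional.Properties
  import Data.List.Membership.DecPropositional as DecMembership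
  open import Data.List.Relation.Unary.All as All using (All; []; _∷_)
  open import Data.List.Relation.Unary.AllPairs as AllPairs using ([]; _∷_)
  import Data.List.Relation.Unary.AllPairs.Properties as AllPairs
  import Data.List.Relation.Unary.All.Properties as All
  open import Data.List.Relation.Unary.Any using (here; there)
  open import Data.List.Relation.Unary.Unique.Propositional using (Unique)
  import Data.List.Relation.Unary.Unique.Propositional.Properties as Unique
  open import Data.Nat as ℕ using (ℕ; zero; suc; _+_; _*_; _∸_; _≤_; _<_; _^_; s≤s)
  open import Data.Nat.Properties
  open import Data.Product using (∃; _×_; _,_; proj₂)
  open import Data.Sum using (inj₂)
  open import Data.Unit using (⊤; tt)
  open import Data.Vec as Vec using ([]; _∷_; lookup; zipWith)
  import Data.Vec.Properties as Vec
  open import Function using (_∘_)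
  open import Relation.Binary.PropositionalEquality
  open import Relation.Nullary using (¬_; Dec; yes; no; contradiction; does; ¬?)

  private
    variable
      m : ℕ

  infixl 6 _⊕_

  _⊕_ : Subset m → Subset m → Subset m
  _⊕_ = zipWith _xor_

  ⊕-identityˡ : (s : Subset m) → ⊥ ⊕ s ≡ s
  ⊕-identityˡ = Vec.zipWith-identityˡ Bool.xor-identityˡ

  ⊕-identityʳ : (s : Subset m) → s ⊕ ⊥ ≡ s
  ⊕-identityʳ = Vec.zipWith-identityʳ Bool.xor-identityʳ

  ⊕-assoc : (s t u : Subset m) → (s ⊕ t) ⊕ u ≡ s ⊕ (t ⊕ u)
  ⊕-assoc = Vec.zipWith-assoc Bool.xor-assoc

  ⊕-comm : (s t : Subset m) → s ⊕ t ≡ t ⊕ s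
  ⊕-comm = Vec.zipWith-comm Bool.xor-comm

  ⊕-self : (s : Subset m) → s ⊕ s ≡ ⊥
  ⊕-self []      = refl
  ⊕-self (b ∷ s) = cong₂ _∷_ (Bool.xor-same b) (⊕-self s)

  ⊕-cancelˡ : (s : Subset m) {t u : Subset m} → s ⊕ t ≡ u → t ≡ s ⊕ u
  ⊕-cancelˡ s {t} {u} eq = begin
    t            ≡⟨ ⊕-identityˡ t ⟨
    ⊥ ⊕ t        ≡⟨ cong (_⊕ t) (⊕-self s) ⟨
    s ⊕ s ⊕ t    ≡⟨ ⊕-assoc s s t ⟩
    s ⊕ (s ⊕ t)  ≡⟨ cong (s ⊕_) eq ⟩
    s ⊕ u        ∎
    where open ≡-Reasoning

  ⊕-interchange : (s t u v : Subset m) → (s ⊕ t) ⊕ (u ⊕ v) ≡ (s ⊕ u) ⊕ (t ⊕ v)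
  ⊕-interchange s t u v = begin
    s ⊕ t ⊕ (u ⊕ v)    ≡⟨ ⊕-assoc s t (u ⊕ v) ⟩
    s ⊕ (t ⊕ (u ⊕ v))  ≡⟨ cong (s ⊕_) (trans (sym (⊕-assoc t u v)) (trans (cong (_⊕ v) (⊕-comm t u)) (⊕-assoc u t v))) ⟩
    s ⊕ (u ⊕ (t ⊕ v))  ≡⟨ ⊕-assoc s u (t ⊕ v) ⟨
    s ⊕ u ⊕ (t ⊕ v)    ∎
    where open ≡-Reasoning

  scale : Bool → Subset m → Subset m
  scale b s = if b then s else ⊥

  scale-xor : ∀ a b (s : Subset m) → scale a s ⊕ scale b s ≡ scale (a xor b) s
  scale-xor true  true  s = ⊕-self s
  scale-xor true  false s = ⊕-identityʳ s
  scale-xor false b     s = ⊕-identityˡ (scale b s)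

  -- Coefficients are indexed by vectors and not by positions, so the parities of an integer
  -- relation can be inserted directly.
  combination : (Subset m → Bool) → List (Subset m) → Subset m
  combination e []       = ⊥
  combination e (s ∷ ss) = scale (e s) s ⊕ combination e ss

  combination-xor : ∀ e e′ (ss : List (Subset m)) →
    combination e ss ⊕ combination e′ ss ≡ combination (λ s → e s xor e′ s) ss
  combination-xor e e′ []       = ⊕-identityˡ ⊥
  combination-xor e e′ (s ∷ ss) = trans
    (⊕-interchange (scale (e s) s) (combination e ss) (scale (e′ s) s) (combination e′ ss))
    (cong₂ _⊕_ (scale-xor (e s) (e′ s) s) (combination-xor e e′ ss))

  combination-cong : ∀ {e e′} {ss : List (Subset m)} → All (λ s → e s ≡ e′ s) ss →
    combination e ss ≡ combination e′ ss
  combination-cong []         = refl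
  combination-cong {ss = s ∷ ss} (p ∷ ps) = cong₂ (λ b t → scale b s ⊕ t) p (combination-cong ps)

  combination-false : (ss : List (Subset m)) → combination (λ _ → false) ss ≡ ⊥
  combination-false []       = refl
  combination-false (s ∷ ss) = trans (⊕-identityˡ _) (combination-false ss)

  span : List (Subset m) → List (Subset m)
  span []       = ⊥ ∷ []
  span (s ∷ ss) = span ss ++ map (s ⊕_) (span ss)

  length-span : (ss : List (Subset m)) → length (span ss) ≡ 2 ^ length ss
  length-span []       = refl
  length-span (s ∷ ss) = trans (length-++ (span ss))
    (cong₂ _+_ (length-span ss)
      (trans (length-map (s ⊕_) (span ss)) (trans (length-span ss) (sym (+-identityʳ _)))))

  combination∈span : ∀ e (ss : List (Subset m)) → combination e ss ∈ span ss
  combination∈span e []       = here refl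
  combination∈span e (s ∷ ss) with e s
  ... | true  = ∈-++⁺ʳ (span ss) (∈-map⁺ (s ⊕_) (combination∈span e ss))
  ... | false = ∈-++⁺ˡ (subst (_∈ span ss) (sym (⊕-identityˡ _)) (combination∈span e ss))

  ⊥∈span : (ss : List (Subset m)) → ⊥ ∈ span ss
  ⊥∈span []       = here refl
  ⊥∈span (s ∷ ss) = ∈-++⁺ˡ (⊥∈span ss)

  ∈⇒∈span : ∀ {t} (ss : List (Subset m)) → t ∈ ss → t ∈ span ss
  ∈⇒∈span (s ∷ ss) (here refl) = ∈-++⁺ʳ (span ss)
    (subst (_∈ map (s ⊕_) (span ss)) (⊕-identityʳ s) (∈-map⁺ (s ⊕_) (⊥∈span ss)))
  ∈⇒∈span (s ∷ ss) (there t∈)  = ∈-++⁺ˡ (∈⇒∈span ss t∈)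

  Independent : List (Subset m) → Set
  Independent []       = ⊤
  Independent (s ∷ ss) = s ∉ span ss × Independent ss

  independent⇒unique : {ss : List (Subset m)} → Independent ss → Unique ss
  independent⇒unique {ss = []}     _          = []
  independent⇒unique {ss = s ∷ ss} (s∉ , ind) =
    All.tabulate (λ { t∈ refl → s∉ (∈⇒∈span ss t∈) }) ∷ independent⇒unique ind

  combination-injective : ∀ {e e′} {ss : List (Subset m)} → Independent ss →
    combination e ss ≡ combination e′ ss → All (λ s → e s ≡ e′ s) ss
  combination-injective {ss = []}     _          _  = []
  combination-injective {e = e} {e′} {s ∷ ss} (s∉ , ind) eq with e s in p | e′ s in q
  ... | true  | true  = trans p (sym q) ∷ combination-injective ind
    (trans (⊕-cancelˡ s eq) (trans (sym (⊕-assoc s s _)) (trans (cong (_⊕ _) (⊕-self s)) (⊕-identityˡ _))))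
  ... | false | false = trans p (sym q) ∷ combination-injective ind
    (trans (sym (⊕-identityˡ _)) (trans eq (⊕-identityˡ _)))
  ... | true  | false = contradiction (subst (_∈ span ss)
    (sym (trans (⊕-cancelˡ (combination e ss) (trans (⊕-comm (combination e ss) s) (trans eq (⊕-identityˡ _))))
                (combination-xor e e′ ss)))
    (combination∈span _ ss)) s∉
  ... | false | true  = contradiction (subst (_∈ span ss)
    (sym (trans (⊕-cancelˡ (combination e′ ss) (trans (⊕-comm (combination e′ ss) s) (trans (sym eq) (⊕-identityˡ _))))
                (combination-xor e′ e ss)))
    (combination∈span _ ss)) s∉

  combination-single : ∀ {t} {ss : List (Subset m)} → Unique ss → t ∈ ss →
    combination (λ s → does (s ≟ˢ t)) ss ≡ t
  combination-single {t = t} {ss = s ∷ ss} (s≢ ∷ ss!) (here refl) with s ≟ˢ s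
  ... | no s≢s = contradiction refl s≢s
  ... | yes _  = trans (cong (s ⊕_) (trans (combination-cong (All.map off s≢)) (combination-false ss))) (⊕-identityʳ s)
    where
    off : ∀ {u} → s ≢ u → does (u ≟ˢ s) ≡ false
    off {u} s≢u with u ≟ˢ s
    ... | yes u≡s = contradiction (sym u≡s) s≢u
    ... | no _    = refl
  combination-single {t = t} {ss = s ∷ ss} (s≢ ∷ ss!) (there t∈) with s ≟ˢ t
  ... | yes s≡t = contradiction s≡t (All.lookup s≢ t∈)
  ... | no _    = trans (⊕-identityˡ _) (combination-single ss! t∈)

  parity-sum : List (Subset m) → Subset m
  parity-sum = combination (λ _ → true)

  circuit : List (Subset m) → List (Subset m)
  circuit ss = parity-sum ss ∷ ss

  -- If the parity sum were a member u, comparing coefficients would force every member to equal u.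
  -- With at least two members this is absurd, whereas a single vector is its own parity sum.
  circuit-unique : {ss : List (Subset m)} → 2 ≤ length ss → Independent ss → Unique (circuit ss)
  circuit-unique {ss = _ ∷ []} (s≤s ()) _
  circuit-unique {ss = s ∷ t ∷ ss} _ ind = All.tabulate fresh ∷ ss!
    where
    ss! = independent⇒unique {ss = s ∷ t ∷ ss} ind
    all-same : ∀ {u} → All (λ v → true ≡ does (v ≟ˢ u)) (s ∷ t ∷ ss) → s ≡ u × t ≡ u
    all-same {u} (p ∷ q ∷ _) with yes s≡u ← s ≟ˢ u | yes t≡u ← t ≟ˢ u = s≡u , t≡u
    fresh : ∀ {u} → u ∈ s ∷ t ∷ ss → parity-sum (s ∷ t ∷ ss) ≢ u
    fresh {u} u∈ eq =
      let s≡u , t≡u = all-same (combination-injective {e = λ _ → true} {ss = s ∷ t ∷ ss} ind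
            (trans eq (sym (combination-single ss! u∈))))
      in All.lookup (AllPairs.head ss!) (here refl) (trans s≡u (sym t≡u))

  half : ℤ → ℤ
  half z = z /ℕ 2

  odd : ℤ → Bool
  odd z = does (z %ℕ 2 ℕ.≟ 1)

  bit : Bool → ℤ
  bit b = if b then 1ℤ else 0ℤ

  half-odd : ∀ z → z ≡ + 2 ℤ.* half z ℤ.+ bit (odd z)
  half-odd z = begin
    z                                      ≡⟨ ℤ.a≡a%ℕn+[a/ℕn]*n z 2 ⟩
    + (z %ℕ 2) ℤ.+ half z ℤ.* + 2          ≡⟨ cong (ℤ._+ half z ℤ.* + 2) (small (z %ℕ 2) (ℤ.n%ℕd<d z 2)) ⟩
    bit (odd z) ℤ.+ half z ℤ.* + 2         ≡⟨ lemma (bit (odd z)) (half z) ⟩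
    + 2 ℤ.* half z ℤ.+ bit (odd z)         ∎
    where
    open ≡-Reasoning
    small : ∀ r → r < 2 → + r ≡ bit (does (r ℕ.≟ 1))
    small 0 _ = refl
    small 1 _ = refl
    small (suc (suc _)) (s≤s (s≤s ()))
    lemma : ∀ b h → b ℤ.+ h ℤ.* + 2 ≡ + 2 ℤ.* h ℤ.+ b
    lemma = ℤ.solve-∀

  2q+bit≡0 : ∀ q b → + 2 ℤ.* q ℤ.+ bit b ≡ 0ℤ → b ≡ false
  2q+bit≡0 q false _  = refl
  2q+bit≡0 q true  eq = contradiction (trans (sym (ℤ.abs-* (+ 2) q)) (cong ∣_∣ move)) (2n≢1 ∣ q ∣)
    where
    lemma : ∀ q → + 2 ℤ.* q ≡ + 2 ℤ.* q ℤ.+ 1ℤ ℤ.- 1ℤ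
    lemma = ℤ.solve-∀
    move : + 2 ℤ.* q ≡ ℤ.-1ℤ
    move = trans (lemma q) (cong (ℤ._- 1ℤ) eq)
    2n≢1 : ∀ n → 2 * n ≢ 1
    2n≢1 (suc n) eq with () ← trans (sym (+-suc n (n + 0))) (suc-injective eq)

  2q≡0 : ∀ q → + 2 ℤ.* q ≡ 0ℤ → q ≡ 0ℤ
  2q≡0 q eq with ℤ.i*j≡0⇒i≡0∨j≡0 (+ 2) eq
  ... | inj₂ q≡0 = q≡0

  half-even : ∀ z → odd z ≡ false → z ≡ + 2 ℤ.* half z
  half-even z even = trans (half-odd z)
    (trans (cong (λ b → + 2 ℤ.* half z ℤ.+ bit b) even) (ℤ.+-identityʳ _))

  -- Reduction mod 2 commutes with loads: coordinate j of the 𝔽₂-combination with the parities of z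
  -- is the parity of the integer sum.
  ∑-mod-2 : ∀ (z : Subset m → ℤ) j L → ∃ λ r →
    ∑ L (λ s → z s ℤ.* χ s j) ≡ + 2 ℤ.* r ℤ.+ bit (lookup (combination (odd ∘ z) L) j)
  ∑-mod-2 z j []      = 0ℤ , sym (cong (λ b → + 2 ℤ.* 0ℤ ℤ.+ bit b) (Vec.lookup-replicate j false))
  ∑-mod-2 z j (s ∷ L) =
    let r , eq = ∑-mod-2 z j L
        a = odd (z s)
        l = lookup s j
        c = lookup (combination (odd ∘ z) L) j
    -- The new quotient is the sum of the two halves plus the carry from adding the bits `a ∧ l` and
    -- `c`.
    in half (z s) ℤ.* χ s j ℤ.+ r ℤ.+ bit ((a ∧ l) ∧ c) , (begin
      z s ℤ.* χ s j ℤ.+ ∑ L (λ s → z s ℤ.* χ s j)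
        ≡⟨ cong₂ (λ t u → t ℤ.* χ s j ℤ.+ u) (half-odd (z s)) eq ⟩
      (+ 2 ℤ.* half (z s) ℤ.+ bit a) ℤ.* χ s j ℤ.+ (+ 2 ℤ.* r ℤ.+ bit c)
        ≡⟨ lemma₁ (half (z s)) (bit a) (χ s j) r (bit c) ⟩
      + 2 ℤ.* (half (z s) ℤ.* χ s j ℤ.+ r) ℤ.+ (bit a ℤ.* bit l ℤ.+ bit c)
        ≡⟨ cong (λ t → + 2 ℤ.* (half (z s) ℤ.* χ s j ℤ.+ r) ℤ.+ t) (carry a l c) ⟩
      + 2 ℤ.* (half (z s) ℤ.* χ s j ℤ.+ r) ℤ.+ (+ 2 ℤ.* bit ((a ∧ l) ∧ c) ℤ.+ bit ((a ∧ l) xor c))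
        ≡⟨ lemma₂ (half (z s) ℤ.* χ s j ℤ.+ r) (bit ((a ∧ l) ∧ c)) (bit ((a ∧ l) xor c)) ⟩
      + 2 ℤ.* (half (z s) ℤ.* χ s j ℤ.+ r ℤ.+ bit ((a ∧ l) ∧ c)) ℤ.+ bit ((a ∧ l) xor c)
        ≡⟨ cong (λ t → + 2 ℤ.* (half (z s) ℤ.* χ s j ℤ.+ r ℤ.+ bit ((a ∧ l) ∧ c)) ℤ.+ bit (t xor c)) (lookup-scale a) ⟨
      + 2 ℤ.* (half (z s) ℤ.* χ s j ℤ.+ r ℤ.+ bit ((a ∧ l) ∧ c)) ℤ.+ bit (lookup (scale a s) j xor c)
        ≡⟨ cong (λ t → + 2 ℤ.* (half (z s) ℤ.* χ s j ℤ.+ r ℤ.+ bit ((a ∧ l) ∧ c)) ℤ.+ bit t)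
             (Vec.lookup-zipWith _xor_ j (scale a s) (combination (odd ∘ z) L)) ⟨
      + 2 ℤ.* (half (z s) ℤ.* χ s j ℤ.+ r ℤ.+ bit ((a ∧ l) ∧ c)) ℤ.+ bit (lookup (combination (odd ∘ z) (s ∷ L)) j) ∎)
    where
    open ≡-Reasoning
    lemma₁ : ∀ h a x r c → (+ 2 ℤ.* h ℤ.+ a) ℤ.* x ℤ.+ (+ 2 ℤ.* r ℤ.+ c)
      ≡ + 2 ℤ.* (h ℤ.* x ℤ.+ r) ℤ.+ (a ℤ.* x ℤ.+ c)
    lemma₁ = ℤ.solve-∀
    lemma₂ : ∀ u b x → + 2 ℤ.* u ℤ.+ (+ 2 ℤ.* b ℤ.+ x) ≡ + 2 ℤ.* (u ℤ.+ b) ℤ.+ x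
    lemma₂ = ℤ.solve-∀
    carry : ∀ a l c → bit a ℤ.* bit l ℤ.+ bit c ≡ + 2 ℤ.* bit ((a ∧ l) ∧ c) ℤ.+ bit ((a ∧ l) xor c)
    carry true  true  true  = refl
    carry true  true  false = refl
    carry true  false true  = refl
    carry true  false false = refl
    carry false true  true  = refl
    carry false true  false = refl
    carry false false true  = refl
    carry false false false = refl
    lookup-scale : ∀ a → lookup (scale a s) j ≡ a ∧ lookup s j
    lookup-scale true  = refl
    lookup-scale false = Vec.lookup-replicate j false

  lookup-⊥ : {s : Subset m} → (∀ j → lookup s j ≡ false) → s ≡ ⊥
  lookup-⊥ {s = []}    _  = refl
  lookup-⊥ {s = b ∷ s} eq = cong₂ _∷_ (eq zero) (lookup-⊥ (eq ∘ suc))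

  module _ {ss : List (Subset m)} (2≤ : 2 ≤ length ss) (ind : Independent ss) where

    private
      L = circuit ss

    -- Over 𝔽₂ a circuit has only the zero relation and the full one. If b is the parity at the sum
    -- vector, then b times the sum equals the combination of the others, and independence makes all
    -- their parities equal to b.
    parity-constant : ∀ {z} → (∀ s → s ∉ L → z s ≡ 0ℤ) → (∀ j → load z j ≡ 0ℤ) →
      ∃ λ b → All (λ s → odd (z s) ≡ b) L
    parity-constant {z} z-off loads = constant (e (parity-sum ss)) refl
      where
      e = odd ∘ z
      relation₂ : combination e L ≡ ⊥
      relation₂ = lookup-⊥ λ j →
        let r , eq = ∑-mod-2 z j L
        in 2q+bit≡0 r _ (trans (sym eq) (trans (sym (total-support L (circuit-unique 2≤ ind)
             λ s s∉ → cong (ℤ._* χ s j) (z-off s s∉))) (loads j)))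
      constant : ∀ b → e (parity-sum ss) ≡ b → ∃ λ b → All (λ s → e s ≡ b) L
      constant b eq = b , eq ∷ combination-injective ind (trans (rest b eq) (value b))
        where
        rest : ∀ b → e (parity-sum ss) ≡ b → combination e ss ≡ scale b (parity-sum ss)
        rest b eq = trans (⊕-cancelˡ (scale b (parity-sum ss))
          (subst (λ b → scale b (parity-sum ss) ⊕ combination e ss ≡ ⊥) eq relation₂)) (⊕-identityʳ _)
        value : ∀ b → scale b (parity-sum ss) ≡ combination (λ _ → b) ss
        value true  = refl
        value false = sym (combination-false ss)

    -- A zero coefficient is even, hence so are all coefficients, since their parity is constant.
    -- Half the relation is again a relation with a zero in the same place, so the halving can be
    -- repeated.
    divisible : ∀ k {z} → (∀ s → s ∉ L → z s ≡ 0ℤ) → (∀ j → load z j ≡ 0ℤ) →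
      ∀ {s₀} → s₀ ∈ L → z s₀ ≡ 0ℤ → ∀ s → ∃ λ q → ∣ z s ∣ ≡ 2 ^ k * q
    divisible zero    {z} _     _     _   _      s = ∣ z s ∣ , sym (+-identityʳ ∣ z s ∣)
    divisible (suc k) {z} z-off loads {s₀} s₀∈ z₀≡0 s =
      let b , const = parity-constant z-off loads
          b≡false   = trans (sym (All.lookup const s₀∈)) (cong odd z₀≡0)
          double : ∀ s → z s ≡ + 2 ℤ.* half (z s)
          double s = doubled s (s ∈? L) (λ s∈ → trans (All.lookup const s∈) b≡false)
          q , eq = divisible k {half ∘ z}
            (λ s s∉ → cong half (z-off s s∉))
            (λ j → 2q≡0 (load (half ∘ z) j) (trans (sym (load-double double j)) (loads j)))
            s₀∈ (cong half z₀≡0) s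
      in q , trans (cong ∣_∣ (double s)) (trans (ℤ.abs-* (+ 2) (half (z s)))
               (trans (cong (2 *_) eq) (sym (*-assoc 2 (2 ^ k) q))))
      where
      open DecMembership _≟ˢ_ using (_∈?_)
      doubled : ∀ s → Dec (s ∈ L) → (s ∈ L → odd (z s) ≡ false) → z s ≡ + 2 ℤ.* half (z s)
      doubled s (yes s∈) even = half-even (z s) (even s∈)
      doubled s (no s∉)  _    = half-even (z s) (cong odd (z-off s s∉))
      load-double : (∀ s → z s ≡ + 2 ℤ.* half (z s)) → ∀ j → load z j ≡ + 2 ℤ.* load (half ∘ z) j
      load-double double j = trans
        (total-cong λ s → cong (ℤ._* χ s j) (trans (double s) (lemma (half (z s)))))
        (trans (load-linear (+ 2) 0ℤ (half ∘ z) (half ∘ z) j) (lemma′ (load (half ∘ z) j)))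
        where
        lemma : ∀ h → + 2 ℤ.* h ≡ + 2 ℤ.* h ℤ.+ 0ℤ ℤ.* h
        lemma = ℤ.solve-∀
        lemma′ : ∀ h → + 2 ℤ.* h ℤ.+ 0ℤ ℤ.* h ≡ + 2 ℤ.* h
        lemma′ = ℤ.solve-∀

    -- A relation with a zero coefficient on the circuit is divisible by every power of 2.
    circuit-rigid : ∀ {z} → (∀ s → s ∉ L → z s ≡ 0ℤ) → (∀ j → load z j ≡ 0ℤ) →
      ∀ {s₀} → s₀ ∈ L → z s₀ ≡ 0ℤ → ∀ s → z s ≡ 0ℤ
    circuit-rigid {z} z-off loads s₀∈ z₀≡0 s =
      -- The exponent is the absolute value n itself: since 2^n exceeds n, divisibility of n by 2^n
      -- forces n = 0.
      ℤ.∣i∣≡0⇒i≡0 (zero-abs (divisible ∣ z s ∣ z-off loads s₀∈ z₀≡0 s))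
      where
      zero-abs : ∀ {n} → (∃ λ q → n ≡ 2 ^ n * q) → n ≡ 0
      zero-abs {n} (zero  , eq) = trans eq (*-zeroʳ (2 ^ n))
      zero-abs {n} (suc q , eq) = contradiction (begin
        suc n          ≤⟨ 1+n≤2^n n ⟩
        2 ^ n          ≤⟨ m≤m*n (2 ^ n) (suc q) ⟩
        2 ^ n * suc q  ≡⟨ eq ⟨
        n              ∎) (<-irrefl refl)
        where open ≤-Reasoning

    -- The m+1 vectors of the circuit satisfy a nontrivial relation in ℤᵐ, and by rigidity one
    -- vanishing coefficient would make all of them vanish.
    circuit-relation : length ss ≡ m →
      ∃ λ z → (∀ s → s ∉ L → z s ≡ 0ℤ) × (∀ {s} → s ∈ L → z s ≢ 0ℤ) × (∀ j → load z j ≡ 0ℤ)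
    circuit-relation eq =
      let z , z-off , (s , zs≢0) , loads = relation L (circuit-unique 2≤ ind) (s≤s (≤-reflexive (sym eq)))
      in z , z-off , (λ s₀∈ z₀≡0 → zs≢0 (circuit-rigid z-off loads s₀∈ z₀≡0 s)) , loads

  independents : ∀ m → ℕ → List (List (Subset m))
  extensions : List (Subset m) → List (Subset m)

  extensions {m} ss = filter (λ s → ¬? (s ∈? span ss)) (subsets m)
    where open DecMembership _≟ˢ_ using (_∈?_)

  independents m zero    = [] ∷ []
  independents m (suc k) = concatMap (λ ss → map (_∷ ss) (extensions ss)) (independents m k)

  ∈-extensions⁻ : ∀ {s} (ss : List (Subset m)) → s ∈ extensions ss → s ∉ span ss
  ∈-extensions⁻ {m} ss s∈ = proj₂ (∈-filter⁻ (λ s → ¬? (s ∈? span ss)) {xs = subsets m} s∈)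
    where open DecMembership _≟ˢ_ using (_∈?_)

  independents-sound : ∀ k {ss : List (Subset m)} → ss ∈ independents m k →
    Independent ss × length ss ≡ k
  independents-sound zero    (here refl) = tt , refl
  independents-sound {m} (suc k) ss∈ = sound (find (∈-concatMap⁻ (λ ss → map (_∷ ss) (extensions ss)) {xs = independents m k} ss∈))
    where
    sound : ∀ {ss} → (∃ λ ts → ts ∈ independents m k × ss ∈ map (_∷ ts) (extensions ts)) →
      Independent ss × length ss ≡ suc k
    sound (ts , ts∈ , ss∈) with s , s∈ , refl ← ∈-map⁻ (_∷ ts) ss∈ =
      let ind , len = independents-sound k ts∈
      in (∈-extensions⁻ ts s∈ , ind) , cong suc len

  -- Every vector is an extension or lies in the span, and the list `span ss` has 2^k entries
  -- counted with repetition.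
  length-extensions : (ss : List (Subset m)) → 2 ^ m ∸ 2 ^ length ss ≤ length (extensions ss)
  length-extensions {m} ss = m≤n+o⇒m∸n≤o (2 ^ m) (2 ^ length ss) (begin
    2 ^ m                                     ≡⟨ length-subsets m ⟨
    length (subsets m)                        ≤⟨ unique-⊆⇒length≤ (subsets-unique m) (λ {s} _ → cover s (s ∈? span ss)) ⟩
    length (span ss ++ extensions ss)         ≡⟨ length-++ (span ss) ⟩
    length (span ss) + length (extensions ss) ≡⟨ cong (_+ length (extensions ss)) (length-span ss) ⟩
    2 ^ length ss + length (extensions ss)    ∎)
    where
    open ≤-Reasoning
    open DecMembership _≟ˢ_ using (_∈?_)
    cover : ∀ s → Dec (s ∈ span ss) → s ∈ span ss ++ extensions ss
    cover s (yes s∈) = ∈-++⁺ˡ s∈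
    cover s (no s∉)  = ∈-++⁺ʳ (span ss) (∈-filter⁺ (λ s → ¬? (s ∈? span ss)) (∈-subsets s) s∉)

  length-independents : ∀ m k → independentTuples (2 ^ m) k ≤ length (independents m k)
  length-independents m zero    = ≤-refl
  length-independents m (suc k) = ≤-trans (*-monoˡ-≤ (2 ^ m ∸ 2 ^ k) (length-independents m k))
    (length-concatMap-≥ (λ ss → map (_∷ ss) (extensions ss)) (All.tabulate λ {ss} ss∈ →
      ≤-trans (≤-reflexive (cong (λ l → 2 ^ m ∸ 2 ^ l) (sym (proj₂ (independents-sound k ss∈)))))
      (≤-trans (length-extensions ss) (≤-reflexive (sym (length-map (_∷ ss) (extensions ss)))))))

  independents-unique : ∀ m k → Unique (independents m k)
  independents-unique m zero    = [] ∷ []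
  independents-unique m (suc k) = Unique.concat⁺
    (All.map⁺ (All.tabulate λ {ss} _ → Unique.map⁺ (λ { refl → refl })
      (Unique.filter⁺ (λ s → ¬? (s ∈? span ss)) (subsets-unique m))))
    (AllPairs.map⁺ (AllPairs.map disjoint (independents-unique m k)))
    where
    open DecMembership _≟ˢ_ using (_∈?_)
    disjoint : ∀ {ss ts} → ss ≢ ts → ∀ {us} →
      ¬ (us ∈ map (_∷ ss) (extensions ss) × us ∈ map (_∷ ts) (extensions ts))
    disjoint {ss} {ts} ss≢ts (p , q) =
      let _ , _ , eq = ∈-map⁻ (_∷ ss) p
          _ , _ , eq′ = ∈-map⁻ (_∷ ts) q
      in ss≢ts (List.∷-injectiveʳ (trans (sym eq) eq′))

-- Minimal collections from circuits, the lower bound, and n = 1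

module LowerBound where

  open import Defs using (Collection; _∈ᶜ_)
  open Counting
  open Arithmetic using (independentTuples; lower-arithmetic)
  open IntegerLinearAlgebra
  open Loads
  open MinimalCollections
  open Censuses
  open BinaryCircuits
  open import Data.Bool using (Bool; true; false; T; if_then_else_)
  import Data.Bool.Properties as Bool
  open import Data.Fin as Fin using (Fin; zero; suc)
  import Data.Fin.Properties as Fin
  open import Data.Fin.Subset using (Subset; inside; outside; ∁; ⊥; ⊤)
  open import Data.Integer as ℤ using (ℤ; +_; -[1+_]; 0ℤ; 1ℤ)
  import Data.Integer.Properties as ℤ
  import Data.Integer.Tactic.RingSolver as ℤ
  open import Data.List using (List; []; _∷_; map; length; concatMap; allFin; cartesianProduct)
  open import Data.List.Properties using (length-map; length-tabulate; map-∘; map-id; map-cong)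
  open import Data.List.Membership.Propositional using (_∈_; _∉_; lose)
  open import Data.List.Membership.Propositional.Properties
  open import Data.List.Relation.Unary.All as All using (All)
  open import Data.List.Relation.Unary.Any as Any using (here; there)
  import Data.List.Relation.Unary.Unique.Propositional.Properties as Unique
  open import Data.List.Relation.Unary.Unique.Propositional using (Unique)
  open import Data.List.Relation.Unary.AllPairs using ([]; _∷_)
  open import Data.Nat as ℕ using (ℕ; zero; suc; _≤_; _*_; _∸_; _^_; _!; z≤n; s≤s)
  open import Data.Nat.Properties
  open import Data.Product using (∃; _×_; _,_; proj₁; proj₂)
  open import Data.Vec using ([]; _∷_; lookup)
  import Data.Vec.Properties as Vec
  open import Function using (_∘_)
  open import Relation.Binary.PropositionalEquality
  open import Relation.Nullary using (¬_; yes; no; contradiction; ⌊_⌋)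
  open import Relation.Nullary.Decidable using (toWitness; fromWitness; decidable-stable)

  open Weights

  private
    variable
      m b : ℕ

  positivePart : ℤ → ℤ
  positivePart (+ n)    = + n
  positivePart -[1+ n ] = 0ℤ

  positivePart-nonneg : ∀ z → 0ℤ ℤ.≤ positivePart z
  positivePart-nonneg (+ n)    = ℤ.+≤+ z≤n
  positivePart-nonneg -[1+ n ] = ℤ.≤-refl

  positivePart-difference : ∀ z → positivePart z ℤ.- positivePart (ℤ.- z) ≡ z
  positivePart-difference (+ zero)  = refl
  positivePart-difference (+ suc n) = ℤ.+-identityʳ (+ suc n)
  positivePart-difference -[1+ n ]  = refl

  positivePart-positive : ∀ {z} → 0ℤ ℤ.< z → 0ℤ ℤ.< positivePart z
  positivePart-positive {+ n} 0<z = 0<z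

  -- A section of `signed` with values in nonnegative weights: a positive coefficient goes to the
  -- set avoiding 0, the size of a negative one to its complement.
  unsign : (Subset m → ℤ) → Subset (suc m) → ℤ
  unsign z (outside ∷ s) = positivePart (z s)
  unsign z (inside  ∷ s) = positivePart (ℤ.- z (∁ s))

  unsign-nonneg : (z : Subset m → ℤ) → ∀ S → 0ℤ ℤ.≤ unsign z S
  unsign-nonneg z (outside ∷ s) = positivePart-nonneg (z s)
  unsign-nonneg z (inside  ∷ s) = positivePart-nonneg (ℤ.- z (∁ s))

  signed-unsign : (z : Subset m → ℤ) → ∀ s → signed (unsign z) s ≡ z s
  signed-unsign z s = trans
    (cong (λ t → positivePart (z s) ℤ.- positivePart (ℤ.- z t)) (∁-involutive s))
    (positivePart-difference (z s))

  unsign-class : (z : Subset m → ℤ) → ∀ S → z (class S) ≡ 0ℤ → unsign z S ≡ 0ℤ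
  unsign-class z (outside ∷ s) eq = cong positivePart eq
  unsign-class z (inside  ∷ s) eq = cong (positivePart ∘ ℤ.-_) eq

  unsign-∁ : (z : Subset m → ℤ) → ∀ S → 0ℤ ℤ.< unsign z S → unsign z (∁ S) ≡ 0ℤ
  unsign-∁ z (outside ∷ s) 0<z rewrite ∁-involutive s with z s
  ... | + suc _  = refl
  ... | + zero   = refl
  ... | -[1+ _ ] = contradiction refl (ℤ.<⇒≢ 0<z)
  unsign-∁ z (inside ∷ s) 0<z with z (∁ s)
  ... | -[1+ _ ] = refl
  ... | + zero   = refl
  ... | + suc _  = contradiction refl (ℤ.<⇒≢ 0<z)

  -- Up to sign, `signed y` at the class of `S` is y S - y (∁ S), whichever of the two avoids 0.
  signed-class⁺ : (y : Subset (suc m) → ℤ) → ∀ S → y S ≡ y (∁ S) → signed y (class S) ≡ 0ℤ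
  signed-class⁺ y (outside ∷ s) eq = ℤ.i≡j⇒i-j≡0 eq
  signed-class⁺ y (inside  ∷ s) eq = ℤ.i≡j⇒i-j≡0
    (sym (trans (cong (λ t → y (inside ∷ t)) (∁-involutive s)) eq))

  signed-class⁻ : (y : Subset (suc m) → ℤ) → ∀ S → signed y (class S) ≡ 0ℤ → y S ≡ y (∁ S)
  signed-class⁻ y (outside ∷ s) eq = ℤ.i-j≡0⇒i≡j _ _ eq
  signed-class⁻ y (inside  ∷ s) eq = sym (trans (ℤ.i-j≡0⇒i≡j _ _ eq)
    (cong (λ t → y (inside ∷ t)) (∁-involutive s)))

  orient : (Subset m → ℤ) → Subset m → Subset (suc m)
  orient z s = if ⌊ 0ℤ ℤ.<? z s ⌋ then outside ∷ s else inside ∷ ∁ s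

  class-orient : (z : Subset m → ℤ) → ∀ s → class (orient z s) ≡ s
  class-orient z s with 0ℤ ℤ.<? z s
  ... | yes _ = refl
  ... | no _  = ∁-involutive s

  unsign-orient : (z : Subset m → ℤ) → ∀ s → z s ≢ 0ℤ → 0ℤ ℤ.< unsign z (orient z s)
  unsign-orient z s z≢0 with 0ℤ ℤ.<? z s
  ... | yes 0<z = positivePart-positive 0<z
  ... | no  z≯0 rewrite ∁-involutive s =
    positivePart-positive (ℤ.neg-mono-< (ℤ.≤∧≢⇒< (ℤ.≮⇒≥ z≯0) z≢0))

  nonempty : (s : Subset m) → s ≢ ⊥ → ∃ λ j → lookup s j ≡ inside
  nonempty s s≢⊥ with Fin.any? (λ j → lookup s j Bool.≟ inside)
  ... | yes found = found
  ... | no  none  = contradiction (lookup-⊥ λ j → Bool.¬-not λ eq → none (j , eq)) s≢⊥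

  orient-nonempty : (z : Subset m → ℤ) → ∀ s → s ≢ ⊥ → ∃ λ i → lookup (orient z s) i ≡ inside
  orient-nonempty z s s≢⊥ with 0ℤ ℤ.<? z s
  ... | yes _ = let j , eq = nonempty s s≢⊥ in suc j , eq
  ... | no _  = zero , refl

  module _ {ss : List (Subset m)} (2≤ : 2 ≤ length ss) (ind : Independent ss) {z : Subset m → ℤ}
           (z-off : ∀ s → s ∉ circuit ss → z s ≡ 0ℤ) (z-on : ∀ {s} → s ∈ circuit ss → z s ≢ 0ℤ)
           (loads : ∀ j → load z j ≡ 0ℤ) where

    private
      x = unsign z

      x>0⇒class∈ : ∀ S → 0ℤ ℤ.< x S → class S ∈ circuit ss
      x>0⇒class∈ S 0<x = decidable-stable (class S ∈? circuit ss) λ class∉ →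
        ℤ.<⇒≢ 0<x (sym (unsign-class z S (z-off (class S) class∉)))
        where
        open import Data.List.Membership.DecPropositional _≟ˢ_ using (_∈?_)

      equalLoads : EqualLoads x
      equalLoads = signed⇒equalLoads x λ j →
        trans (total-cong λ s → cong (ℤ._* χ s j) (signed-unsign z s)) (loads j)

      -- The oriented set of `s` need not contain 0. It is nonempty, so the load at one of its
      -- elements is positive, and all loads agree.
      level-positive : ∀ {s} → s ∈ ss → s ≢ ⊥ → 0ℤ ℤ.< load x zero
      level-positive {s} s∈ s≢⊥ = let i , i∈ = orient-nonempty z s s≢⊥ in
        subst (0ℤ ℤ.<_) (equalLoads i)
          (load-positive (unsign-nonneg z) {orient z s} i∈ (unsign-orient z s (z-on (there s∈))))

    -- Weights on a proper subcollection fold to a relation on the circuit that vanishes at the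
    -- class of the missing set. Rigidity makes the whole folded relation zero, and with no
    -- complementary pair in the support every member would then have weight 0.
    circuit-minimal : Minimal (support (unsign z))
    circuit-minimal = record
      { weights = support-weights x (unsign-nonneg z) (load-positive′ ss refl) equalLoads
      ; minimal = λ Ψ (Ψ⊆ , S₀ , S₀∈ , S₀∉) V →
          let y = weight V
              x>0 : ∀ {S} → S ∈ᶜ Ψ → 0ℤ ℤ.< x S
              x>0 = λ {S} S∈ → toWitness (Ψ⊆ S S∈)
              pair-free : ∀ {S} → 0ℤ ℤ.< x S → y (∁ S) ≡ 0ℤ
              pair-free = λ {S} 0<x → zero-off V λ ∁S∈ → ℤ.<⇒≢ (x>0 ∁S∈) (sym (unsign-∁ z S 0<x))
              y-off : ∀ s → s ∉ circuit ss → signed y s ≡ 0ℤ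
              y-off = λ s s∉ → ℤ.i≡j⇒i-j≡0 (trans
                (zero-off V {outside ∷ s} λ S∈ → s∉ (x>0⇒class∈ (outside ∷ s) (x>0 S∈)))
                (sym (zero-off V {inside ∷ ∁ s} λ S∈ → s∉ (subst (_∈ circuit ss) (∁-involutive s)
                  (x>0⇒class∈ (inside ∷ ∁ s) (x>0 S∈))))))
              vanish : ∀ s → signed y s ≡ 0ℤ
              vanish = circuit-rigid 2≤ ind y-off (equalLoads⇒signed y (equal V))
                (x>0⇒class∈ S₀ (toWitness S₀∈))
                (signed-class⁺ y S₀ (trans (zero-off V S₀∉) (sym (pair-free (toWitness S₀∈)))))
              S , S∈ = inhabited V
          in ℤ.<⇒≢ (positive-on V S∈) (sym (trans (signed-class⁻ y S (vanish (class S))) (pair-free (x>0 S∈))))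
      }
      where
      load-positive′ : ∀ ts → ts ≡ ss → 0ℤ ℤ.< load x zero
      load-positive′ []       eq = contradiction (≤-trans 2≤ (≤-reflexive (cong length (sym eq)))) λ ()
      load-positive′ (s ∷ ts) eq = level-positive (subst (s ∈_) eq (here refl))
        λ s≡⊥ → proj₁ (subst Independent (sym eq) ind) (subst (_∈ span ts) (sym s≡⊥) (⊥∈span ts))

  firstPositive : (Subset m → ℤ) → List (Subset m) → Bool
  firstPositive z []      = false
  firstPositive z (s ∷ _) = ⌊ 0ℤ ℤ.<? z s ⌋

  firstAvoidsZero : List (Subset (suc m)) → Bool
  firstAvoidsZero []                  = false
  firstAvoidsZero ((outside ∷ _) ∷ _) = true
  firstAvoidsZero ((inside  ∷ _) ∷ _) = false

  -- Recovers tuple and sign from the oriented sets alone, without reference to the relation that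
  -- oriented them.
  decode : List (Subset (suc m)) → List (Subset m) × Bool
  decode Ss = map class Ss , firstAvoidsZero Ss

  decode-orient : (z : Subset m → ℤ) → ∀ ss → decode (map (orient z) ss) ≡ (ss , firstPositive z ss)
  decode-orient z ss = cong₂ _,_
    (trans (sym (map-∘ ss)) (trans (map-cong (class-orient z) ss) (map-id ss))) (first ss)
    where
    first : ∀ ss → firstAvoidsZero (map (orient z) ss) ≡ firstPositive z ss
    first []      = refl
    first (s ∷ _) with 0ℤ ℤ.<? z s
    ... | yes _ = refl
    ... | no _  = refl

  firstPositive-neg : (z : Subset m → ℤ) → ∀ s ss → z s ≢ 0ℤ →
    ∀ b → firstPositive z (s ∷ ss) ≢ b → firstPositive (ℤ.-_ ∘ z) (s ∷ ss) ≡ b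
  firstPositive-neg z s ss z≢0 b ≢b with z s | b
  ... | + zero   | _     = contradiction refl z≢0
  ... | + suc _  | false = refl
  ... | + suc _  | true  = contradiction refl ≢b
  ... | -[1+ _ ] | true  = refl
  ... | -[1+ _ ] | false = contradiction refl ≢b

  -- The relation on a circuit is unique up to scaling; its sign is chosen by b.
  oriented-relation : (ss : List (Subset m)) → 2 ≤ length ss → Independent ss → length ss ≡ m → ∀ b →
    ∃ λ z → (∀ s → s ∉ circuit ss → z s ≡ 0ℤ) × (∀ {s} → s ∈ circuit ss → z s ≢ 0ℤ) ×
            (∀ j → load z j ≡ 0ℤ) × firstPositive z ss ≡ b
  oriented-relation ss@(s ∷ ss′) 2≤ ind len b
    with z , z-off , z-on , loads ← circuit-relation 2≤ ind len
    with firstPositive z ss Bool.≟ b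
  ... | yes eq = z , z-off , z-on , loads , eq
  ... | no ≢b  = ℤ.-_ ∘ z
    , (λ s s∉ → cong ℤ.-_ (z-off s s∉))
    , (λ s∈ eq → z-on s∈ (ℤ.neg-injective eq))
    , (λ j → trans (total-cong λ s → cong (ℤ._* χ s j) (lemma (z s)))
               (trans (load-linear ℤ.-1ℤ 0ℤ z z j) (a*0+b*0≡0 ℤ.-1ℤ 0ℤ (loads j) (loads j))))
    , firstPositive-neg z s ss′ (z-on (there (here refl))) b ≢b
    where
    lemma : ∀ a → ℤ.- a ≡ ℤ.-1ℤ ℤ.* a ℤ.+ 0ℤ ℤ.* a
    lemma = ℤ.solve-∀

  -- Pairs of an independent m-tuple and a bit are recovered from arrangements of
  -- m of the m + 1 members of a minimal collection.
  census-lower : 2 ≤ m → Census m b → 2 * independentTuples (2 ^ m) m ≤ b * suc m !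
  census-lower {m} {b} 2≤m census = begin
    2 * independentTuples (2 ^ m) m    ≤⟨ *-monoʳ-≤ 2 (length-independents m m) ⟩
    2 * length (independents m m)      ≡⟨ *-comm 2 (length (independents m m)) ⟩
    length (independents m m) * 2      ≡⟨ length-cartesianProduct (independents m m) bits ⟨
    length (cartesianProduct (independents m m) bits)
      ≤⟨ unique-⊆⇒length≤ (Unique.cartesianProduct⁺ (independents-unique m m) bits-unique)
           (λ {c} c∈ → decoded (proj₁ c) (proj₂ c) (proj₁ (∈-cartesianProduct⁻ (independents m m) bits c∈))) ⟩
    length (concatMap arranged (allFin b))
      ≤⟨ length-concatMap-≤ arranged {xs = allFin b} (All.tabulate λ {i} _ → ≤-trans
           (≤-reflexive (length-map decode (arrangements m (members (family i)))))
           (length-arrangements m (members (family i)) (Minimal.length-members (minimal i)))) ⟩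
    length (allFin b) * suc m !        ≡⟨ cong (_* suc m !) (length-tabulate {n = b} (λ i → i)) ⟩
    b * suc m !                        ∎
    where
    open ≤-Reasoning
    open Census census
    bits : List Bool
    bits = true ∷ false ∷ []
    bits-unique : Unique bits
    bits-unique = ((λ ()) All.∷ All.[]) ∷ (All.[] ∷ [])
    arranged : Fin b → List (List (Subset m) × Bool)
    arranged i = map decode (arrangements m (members (family i)))
    decoded : ∀ ss b → ss ∈ independents m m → (ss , b) ∈ concatMap arranged (allFin _)
    decoded ss b ss∈ =
      -- The arrangement lists the oriented members of `ss` in order. Left out is the member in the
      -- class of the parity sum, which the tuple determines.
      let ind , len = independents-sound m ss∈
          2≤ = subst (2 ≤_) (sym len) 2≤m
          z , z-off , z-on , loads , sign = oriented-relation ss 2≤ ind len b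
          i , eq = complete (circuit-minimal 2≤ ind z-off z-on loads)
          Ss⊆ : ∀ {S} → S ∈ map (orient z) ss → S ∈ members (family i)
          Ss⊆ = λ S∈ → let s , s∈ , S≡ = ∈-map⁻ (orient z) S∈ in
            subst (_∈ members (family i)) (sym S≡) (∈-members (subst T (sym (eq (orient z s)))
              (fromWitness (unsign-orient z s (z-on (there s∈))))))
          Ss! = Unique.map⁺ (λ {s} {t} eq → trans (sym (class-orient z s)) (trans (cong class eq) (class-orient z t)))
                  (independent⇒unique ind)
          arr : map (orient z) ss ∈ arrangements m (members (family i))
          arr = subst (λ k → map (orient z) ss ∈ arrangements k (members (family i)))
                  (trans (length-map (orient z) ss) len) (∈-arrangements Ss! Ss⊆)
      in ∈-concatMap⁺ arranged (lose (∈-allFin i)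
           (subst (_∈ arranged i) (trans (decode-orient z ss) (cong (ss ,_) sign)) (∈-map⁺ decode arr)))

  whole : Collection (suc m)
  whole = support (δ ⊤)

  whole-minimal : Minimal (whole {m})
  whole-minimal {m} = record
    { weights = support-weights (δ ⊤) (δ-nonneg ⊤) (subst (0ℤ ℤ.<_) (sym (load-1 zero)) (ℤ.+<+ (s≤s z≤n)))
        (λ i → trans (load-1 i) (sym (load-1 zero)))
    ; minimal = λ Ψ (Ψ⊆ , S₀ , S₀∈ , S₀∉) V →
        let S , S∈ = inhabited V
        in S₀∉ (subst (_∈ᶜ Ψ) (trans (only S (Ψ⊆ S S∈)) (sym (only S₀ S₀∈))) S∈)
    }
    where
    load-1 : ∀ i → load (δ (⊤ {suc m})) i ≡ 1ℤ
    load-1 i = trans (load-δ ⊤ i) (cong (λ b → if b then 1ℤ else 0ℤ) (Vec.lookup-replicate i inside))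
    only : ∀ S → S ∈ᶜ whole → S ≡ ⊤
    only S S∈ = decidable-stable (S ≟ˢ ⊤) λ S≢⊤ → ℤ.<⇒≢ (toWitness S∈) (sym (δ-off ⊤ S S≢⊤))

  census-nonempty : Census m b → 1 ≤ b
  census-nonempty {b = zero}  census with () ← proj₁ (Census.complete census whole-minimal)
  census-nonempty {b = suc b} census = s≤s z≤n

  -- Members of a minimal collection are nonempty, and a one-point ground set has a single nonempty
  -- subset. Any two entries of the census therefore coincide.
  census-1 : Census 0 b → b ≡ 1
  census-1 {zero}        census with () ← census-nonempty census
  census-1 {1}           census = refl
  census-1 {suc (suc b)} census = contradiction (injective {zero} {suc zero} same) λ ()
    where
    open Census census
    top : ∀ i → (inside ∷ []) ∈ᶜ family i
    top i = let S , S∈ = inhabited (Minimal.weights (minimal i))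
                j , j∈ = Minimal.∅∉ (minimal i) S∈
            in subst (_∈ᶜ family i) (full S j j∈) S∈
      where
      full : ∀ (S : Subset 1) j → lookup S j ≡ inside → S ≡ inside ∷ []
      full (inside ∷ []) zero refl = refl
    bottom : ∀ i → ¬ (outside ∷ []) ∈ᶜ family i
    bottom i S∈ with zero , () ← Minimal.∅∉ (minimal i) S∈
    same : family zero ≗ family (suc zero)
    same = minimal-⊆ (minimal zero) (minimal (suc zero)) λ
      { (inside  ∷ []) _  → top (suc zero)
      ; (outside ∷ []) S∈ → contradiction S∈ (bottom zero) }

  census-lower-bound : 1 ≤ m → Census m b →
    2 ^ (suc m * suc m ∸ suc m ∸ 1) ≤ b * (suc m ! * (2 ^ suc m ∸ suc m))
  -- For n = 2 a tuple has a single vector and forms no circuit, but the claim reads 2 ≤ 4b and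
  -- follows from b ≥ 1.
  census-lower-bound {1} {b} _ census = ≤-trans (s≤s (s≤s z≤n)) (*-monoˡ-≤ 4 (census-nonempty census))
  census-lower-bound {suc (suc m)} {b} 1≤m census =
    lower-arithmetic (suc (suc m)) b 1≤m (census-lower (s≤s (s≤s z≤n)) census)

-- The bounds in rational form

open import Data.Nat as ℕ using (ℕ; _!; _^_; _∸_)
open import Data.Nat.Properties using (_!≢0)
open import Data.Integer using (+_)
open import Data.Rational using (_/_; _≤_; _<_; _*_)
open import Data.Product using (Σ; _×_; _,_; proj₁; proj₂)
open import Relation.Binary.PropositionalEquality using (_≡_; subst; sym)
import Data.Nat.Properties as ℕ
open Arithmetic using (upper-arithmetic)
open Rationals using (/-mono-≤; <-/-*)
open Censuses using (Census; census; census⇒inverse; census-upper)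
open LowerBound using (census-1; census-lower-bound)

census-bounds : ∀ m {b} → 1 ℕ.≤ m → Census m b → let n = ℕ.suc m in
  ((+ (2 ^ (n ℕ.* n ∸ n ∸ 1)) / (n ! ℕ.* (2 ^ n ∸ n))) {{n!*[2^n∸n]≢0 n}} ≤ + b / 1) ×
  (+ b / 1 < (+ 4 / n !) {{n !≢0}} * (+ (2 ^ (n ℕ.* n ∸ n)) / 1))
census-bounds m {b} 1≤m c =
  /-mono-≤ {2 ^ (n ℕ.* n ∸ n ∸ 1)} {n ! ℕ.* (2 ^ n ∸ n)} {b} {1} {{n!*[2^n∸n]≢0 n}}
    (subst (ℕ._≤ b ℕ.* (n ! ℕ.* (2 ^ n ∸ n))) (sym (ℕ.*-identityʳ _)) (census-lower-bound 1≤m c)) ,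
  <-/-* {b} {4} {n !} {2 ^ (n ℕ.* n ∸ n)} {{n !≢0}} (upper-arithmetic m b 1≤m (census-upper c))
  where n = ℕ.suc m

minimalBalancedCount : ℕ → ℕ
-- A default value; the count is asserted for n ≥ 1.
minimalBalancedCount ℕ.zero    = 0
minimalBalancedCount (ℕ.suc m) = proj₁ (census m)

propositionB1 : Σ (ℕ → ℕ) λ B →
    (∀ n → 1 ℕ.≤ n → NumberOfMinimalBalanced n (B n)) ×
    (∀ n → 2 ℕ.≤ n →
    ((+ (2 ^ (n ℕ.* n ∸ n ∸ 1)) / (n ! ℕ.* (2 ^ n ∸ n))) {{n!*[2^n∸n]≢0 n}} ≤ + B n / 1) ×
    (+ B n / 1 < (+ 4 / n !) {{n !≢0}} * (+ (2 ^ (n ℕ.* n ∸ n)) / 1))) ×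
    (B 1 ≡ 1)
propositionB1 = minimalBalancedCount
  , (λ { (ℕ.suc m) _ → census⇒inverse (proj₂ (census m)) })
  , (λ { (ℕ.suc m) (ℕ.s≤s 1≤m) → census-bounds m 1≤m (proj₂ (census m)) })
  , census-1 (proj₂ (census 0))
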